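{- In the ring of formal power series in the variables $x=(x_1,x_2,\dots)$ with coefficients polynomial in the indeterminates $a,b,t$, the following identity holds: \[ \sum_{\lambda} a^{l(\lambda_{\mathrm{o}})}\, h_{\lambda_{\mathrm{e}}}(ab;t)\,h_{\lambda_{\mathrm{o}}}(b/a;t)\,P_{\lambda}(x;t) =\prod_{i\geq 1}\frac{(1+ax_i)(1+bx_i)}{(1-x_i)(1+x_i)}\prod_{i<j}\frac{1-tx_ix_j}{1-x_ix_j}, \] where the sum is over all partitions $\lambda$.
   Context: $P_\lambda(x;t)$ denotes the Hall–Littlewood symmetric function indexed by the partition $\lambda$ (so $P_\lambda(x;0)=s_\lambda(x)$ is the Schur function and $P_\lambda(x;1)=m_\lambda(x)$ the monomial symmetric function). For a partition $\lambda$, $l(\lambda)$ is its number of nonzero parts and $m_i(\lambda)$ the multiplicity of the part $i$. $\lambda_{\mathrm{e}}$ (resp. $\lambda_{\mathrm{o}}$) is the partition formed by the even (resp. odd) parts of $\lambda$; e.g. for $\lambda=(4,3,3,2,1,1,1)$, $\lambda_{\mathrm{e}}=(4,2)$, $\lambda_{\mathrm{o}}=(3,3,1,1,1)$. The Rogers–Szegő polynomial is $H_m(z;t)=\sum_{i=0}^m z^i \binom{m}{i}_t$, where $\binom{m}{i}_t=\frac{(t;t)_m}{(t;t)_i(t;t)_{m-i}}$ for $0\le i\le m$ is the $t$-binomial coefficient and $(t;t)_n=\prod_{k=1}^n(1-t^k)$. For a partition $\lambda$, $h_\lambda(z;t)=\prod_{i\ge1}H_{m_i(\lambda)}(z;t)$.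 (Note $a^{l(\lambda_{\mathrm{o}})}h_{\lambda_{\mathrm{o}}}(b/a;t)$ is a polynomial in $a,b$.) -}

module Defs where

open import Data.Bool using (Bool; true; false; if_then_else_; _∧_)
open import Data.Nat using (ℕ; zero; suc; _+_; _∸_; _≤_; _≡ᵇ_; _≤ᵇ_; _<ᵇ_; _⊔_) renaming (_⊓_ to minℕ)
open import Data.Integer using (ℤ; +_; -_) renaming (_+_ to _+ℤ_; _*_ to _*ℤ_)
open import Data.List using (List; []; _∷_; _++_; map; concatMap; upTo; foldr; replicate; length; drop)
open import Data.Product using (_×_; _,_)
open import Relation.Binary.PropositionalEquality using (_≡_)

-- Polynomials with integer coefficients in the variables
--   a = var 0, b = var 1, t = var 2, x_i = var (3 + i)  (i = 0,1,2,...)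
-- A monomial is a list of exponents (trailing zeros irrelevant);
-- a polynomial is a finite formal sum of terms (coefficient, monomial).
-- Equality of polynomials is equality of all coefficients.

Mon : Set
Mon = List ℕ

Poly : Set
Poly = List (ℤ × Mon)

addMon : Mon → Mon → Mon
addMon [] ys = ys
addMon (x ∷ xs) [] = x ∷ xs
addMon (x ∷ xs) (y ∷ ys) = (x + y) ∷ addMon xs ys

monEq : Mon → Mon → Bool
monEq [] [] = true
monEq [] (y ∷ ys) = (y ≡ᵇ 0) ∧ monEq [] ys
monEq (x ∷ xs) [] = (x ≡ᵇ 0) ∧ monEq xs []
monEq (x ∷ xs) (y ∷ ys) = (x ≡ᵇ y) ∧ monEq xs ys

coeff : Poly → Mon → ℤ
coeff [] m = + 0
coeff ((c , m') ∷ p) m = if monEq m' m then c +ℤ coeff p m else coeff p m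

_≈ₚ_ : Poly → Poly → Set
p ≈ₚ q = ∀ (m : Mon) → coeff p m ≡ coeff q m

infixl 6 _⊕_ _⊖_
infixl 7 _⊗_

_⊕_ : Poly → Poly → Poly
p ⊕ q = p ++ q

_⊗_ : Poly → Poly → Poly
p ⊗ q = concatMap (λ { (c , m) → map (λ { (c' , m') → (c *ℤ c' , addMon m m') }) q }) p

neg : Poly → Poly
neg p = map (λ { (c , m) → (- c , m) }) p

_⊖_ : Poly → Poly → Poly
p ⊖ q = p ⊕ neg q

cst : ℤ → Poly
cst c = (c , []) ∷ []

one : Poly
one = cst (+ 1)

var : ℕ → Poly
var i = (+ 1 , replicate i 0 ++ (1 ∷ [])) ∷ []

A B T : Poly
A = var 0
B = var 1
T = var 2

X : ℕ → Poly
X i = var (3 + i)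

pow : Poly → ℕ → Poly
pow p zero = one
pow p (suc k) = p ⊗ pow p k

sumP : List Poly → Poly
sumP = foldr _⊕_ []

prodP : List Poly → Poly
prodP = foldr _⊗_ one

xdeg : Mon → ℕ
xdeg m = foldr _+_ 0 (drop 3 m)

pairs : ℕ → List (ℕ × ℕ)
pairs n = concatMap (λ j → map (λ i → (i , j)) (upTo j)) (upTo n)

qPoch : ℕ → Poly
qPoch k = prodP (map (λ j → one ⊖ pow T (suc j)) (upTo k))

-- t-binomial coefficient [m choose k]_t (zero for k > m), via the t-Pascal rule
-- [m+1, k+1]_t = [m, k]_t + t^(k+1) [m, k+1]_t
gbin : ℕ → ℕ → Poly
gbin m zero = one
gbin zero (suc k) = []
gbin (suc m) (suc k) = gbin m k ⊕ pow T (suc k) ⊗ gbin m (suc k)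

rogers : ℕ → Poly → Poly
rogers m z = sumP (map (λ k → pow z k ⊗ gbin m k) (upTo (suc m)))

-- a^m H_m(b/a;t) = Σ_{i=0}^m a^(m-i) b^i [m,i]_t
rogersHom : ℕ → Poly
rogersHom m = sumP (map (λ k → pow A (m ∸ k) ⊗ pow B k ⊗ gbin m k) (upTo (suc m)))

data Decreasing : List ℕ → Set where
  dnil  : Decreasing []
  done  : ∀ {x} → Decreasing (x ∷ [])
  dcons : ∀ {x y ys} → y ≤ x → Decreasing (y ∷ ys) → Decreasing (x ∷ y ∷ ys)

data AllPos : List ℕ → Set where
  pnil  : AllPos []
  pcons : ∀ {x xs} → 1 ≤ x → AllPos xs → AllPos (x ∷ xs)

IsPartition : List ℕ → Set
IsPartition la = Decreasing la × AllPos la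

-- partitions of k with all parts ≤ mx (f is fuel, f ≥ k suffices)
partsB : ℕ → ℕ → ℕ → List (List ℕ)
partsB _ zero _ = [] ∷ []
partsB zero (suc k) _ = []
partsB (suc f) (suc k) mx =
  concatMap (λ p → map (p ∷_) (partsB f (suc k ∸ p) p)) (map suc (upTo (minℕ (suc k) mx)))

partitions : ℕ → List (List ℕ)
partitions e = partsB e e e

filterB : {S : Set} → (S → Bool) → List S → List S
filterB f [] = []
filterB f (x ∷ xs) = if f x then x ∷ filterB f xs else filterB f xs

mult : ℕ → List ℕ → ℕ
mult i [] = 0
mult i (p ∷ ps) = if p ≡ᵇ i then suc (mult i ps) else mult i ps

maxPart : List ℕ → ℕ
maxPart = foldr _⊔_ 0

evenb : ℕ → Bool
evenb zero = true
evenb (suc zero) = false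
evenb (suc (suc n)) = evenb n

-- a^{l(λ_o)} h_{λ_e}(ab;t) h_{λ_o}(b/a;t)
--   = ∏_{i ≥ 1 even} H_{m_i}(ab;t) · ∏_{i odd} a^{m_i} H_{m_i}(b/a;t)
coefLHS : List ℕ → Poly
coefLHS la = prodP (map f (map suc (upTo (maxPart la))))
  where
  f : ℕ → Poly
  f i = if evenb i then rogers (mult i la) (A ⊗ B) else rogersHom (mult i la)

-- Hall–Littlewood polynomials in n variables x_0..x_{n-1} (Macdonald III.2):
--   P_λ = (1/v_λ(t)) Σ_{w ∈ S_n} w( x^λ ∏_{i<j} (x_i - t x_j)/(x_i - x_j) ),
--   v_λ(t) = ∏_{i ≥ 0} v_{m_i}(t),  v_m(t) = ∏_{j=1}^m (1-t^j)/(1-t),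
-- with m_0 = n - l(λ). Clearing denominators (v_λ(t)(1-t)^n = ∏_{i≥0}(t;t)_{m_i},
-- and w(∏_{i<j}(x_i-x_j)) = ε(w) a_δ) this is the identity in ℤ[a,b,t,x]
--   ∏_{i≥0}(t;t)_{m_i} · a_δ · P_λ = (1-t)^n Σ_w ε(w) w(x^λ ∏_{i<j}(x_i - t x_j)),
-- which determines P_λ uniquely (ℤ[a,b,t,x] is an integral domain).

insertAll : ℕ → List ℕ → List (List ℕ)
insertAll x [] = (x ∷ []) ∷ []
insertAll x (y ∷ ys) = (x ∷ y ∷ ys) ∷ map (y ∷_) (insertAll x ys)

perms : ℕ → List (List ℕ)
perms zero = [] ∷ []
perms (suc n) = concatMap (insertAll n) (perms n)

countLess : ℕ → List ℕ → ℕ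
countLess x [] = 0
countLess x (y ∷ ys) = if y <ᵇ x then suc (countLess x ys) else countLess x ys

inversions : List ℕ → ℕ
inversions [] = 0
inversions (x ∷ xs) = countLess x xs + inversions xs

sign : List ℕ → ℤ
sign w = if evenb (inversions w) then + 1 else - (+ 1)

-- i-th entry, default 0 (so λ is automatically padded by zeros)
at : List ℕ → ℕ → ℕ
at [] _ = 0
at (x ∷ xs) zero = x
at (x ∷ xs) (suc i) = at xs i

symTerm : ℕ → List ℕ → List ℕ → Poly
symTerm n la w =
  cst (sign w)
  ⊗ prodP (map (λ i → pow (X (at w i)) (at la i)) (upTo n))
  ⊗ prodP (map (λ { (i , j) → X (at w i) ⊖ T ⊗ X (at w j) }) (pairs n))

vandermonde : ℕ → Poly
vandermonde n = prodP (map (λ { (i , j) → X i ⊖ X j }) (pairs n))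

-- ∏_{i ≥ 0} (t;t)_{m_i(λ)} for λ padded to length n
vfact : ℕ → List ℕ → Poly
vfact n la = qPoch (n ∸ length la) ⊗ prodP (map (λ i → qPoch (mult (suc i) la)) (upTo (maxPart la)))

IsHL : ℕ → List ℕ → Poly → Set
IsHL n la P =
  (vfact n la ⊗ vandermonde n ⊗ P)
  ≈ₚ (pow (one ⊖ T) n ⊗ sumP (map (symTerm n la) (perms n)))

LHS : ℕ → ℕ → (List ℕ → Poly) → Poly
LHS n d P =
  sumP (map (λ la → coefLHS la ⊗ P la)
            (filterB (λ la → length la ≤ᵇ n) (concatMap partitions (upTo (suc d)))))

geom : ℕ → Poly → Poly
geom d y = sumP (map (pow y) (upTo (suc d)))

-- ∏_i (1+a x_i)(1+b x_i)/((1-x_i)(1+x_i)) ∏_{i<j} (1 - t x_i x_j)/(1 - x_i x_j),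
-- with each 1/(1-y) expanded as a geometric series truncated at y^d
RHS : ℕ → ℕ → Poly
RHS n d =
  prodP (map (λ i → (one ⊕ A ⊗ X i) ⊗ (one ⊕ B ⊗ X i) ⊗ geom d (X i) ⊗ geom d (neg (X i))) (upTo n))
  ⊗ prodP (map (λ { (i , j) → (one ⊖ T ⊗ X i ⊗ X j) ⊗ geom d (X i ⊗ X j) }) (pairs n))

-- Write [φ] for the function S ↦ ∏_{i∈S} φ(x_i) on finite sets of variables and put
-- (f ⋆ g)(xs) = Σ_{S ⊔ C = xs} f(S) g(C) D(S,C) with D(S,C) = ∏_{i∈S, j∈C} (x_i - t x_j)/(x_i - x_j).
-- This product is associative, and P_λ is the ⋆-product of the blocks x^r in degree m_r(λ), largest r first.
-- The t-binomial theorem turns the block weights H_m(ab), a^m H_m(b/a) into [x^r] ⋆ [ab x^r] and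
-- [a x^r] ⋆ [b x^r]; then [ux] ⋆ [1] = [1 + ux] collapses the whole sum to an iteration of
-- Φ ↦ (x² Φ) ⋆ [(1 + ax)(1 + bx)].  The product side is a fixed point of this map, which by the same rule
-- reduces to Ψ = (x Ψ) ⋆ [1 - x] for Ψ = ∏_{i<j} (1 - t x_i x_j)/(1 - x_i x_j).
-- The identities for ⋆ are rational function identities, proved by Lagrange interpolation in one variable.
-- Truncation is harmless since the iteration contracts the x-adic filtration.
module Submission where

open import Algebra.Bundles using (CommutativeRing)
open import Data.Bool using (Bool; true; false; if_then_else_)
open import Data.Integer as ℤ using (ℤ; +_; -[1+_])
import Data.Integer.Properties as ℤₚ
open import Data.List using (List; []; _∷_; _++_; length; map; replicate; concatMap; upTo; downFrom)
open import Data.List.Membership.Propositional using (_∈_)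
open import Data.List.Membership.Propositional.Properties using (∈-++⁺ˡ; ∈-++⁺ʳ; ∈-++⁻; ∈-map⁻; ∈-upTo⁻)
open import Data.List.Properties using (length-++; length-map; length-replicate; length-downFrom; ++-assoc; ++-identityʳ; map-upTo; upTo-∷ʳ)
open import Data.List.Relation.Binary.Permutation.Propositional using (_↭_; ↭-refl; ↭-sym; ↭-trans; ↭-prep)
open import Data.List.Relation.Binary.Permutation.Propositional.Properties using (↭-length; ∈-resp-↭)
import Data.List.Relation.Binary.Permutation.Propositional as Perm
open import Data.List.Relation.Unary.All as All using (All; []; _∷_)
import Data.List.Relation.Unary.All.Properties as All
open import Data.List.Relation.Unary.AllPairs as AllPairs using (AllPairs; []; _∷_)
import Data.List.Relation.Unary.AllPairs.Properties as AllPairs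
open import Data.List.Relation.Unary.Any using (here; there)
open import Data.List.Relation.Unary.Unique.Propositional using (Unique)
open import Data.Nat as ℕ using (ℕ; zero; suc; z≤n; s≤s; _∸_; _≤ᵇ_)
open import Data.Nat.ListAction using (sum)
import Data.Nat.Properties as ℕₚ
open import Data.Product using (Σ; ∃; _×_; _,_; proj₁; proj₂)
open import Data.Sum using (inj₁; inj₂)
open import Data.Unit using (⊤; tt)
import Defs
open import Function using (_∘_)
open import Level using (_⊔_)
open import Relation.Binary.PropositionalEquality as ≡ using (_≡_; _≢_)
open import Relation.Nullary using (yes; no; contradiction)

-- The weights `D` are rational functions, while truncation needs an x-adic order. The identities
-- are therefore proved in any commutative ring with a `GenericPoint`, and then applied in the
-- localisation of the polynomials at the `Good` elements: those of some order e, division by which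
-- lowers the order by at most e. Among them are the x i, x i - x j, 1 - x i x j and 1 - t^k, so
-- every fraction that occurs has an order. The iteration never passes to a limit. After k rounds
-- the product side is (x^(2k) Φ) ⋆ `tail k`, and the sum over partitions with parts at most 2k is
-- [x^(2k)] ⋆ `tail k`, with the same right factor. In the difference only splittings with nonempty
-- left part survive, since Φ is 1 on the empty set, so it has order at least 2k. Interpolation
-- frees the first of n + 1 variables. Degree n is settled by the nodes 0 and the other x i; the
-- identity for Ψ has degree 2n + 1 and also needs 1 and the 1/x i. At these last nodes it reduces
-- to the same identity with one variable removed.

module RingSolver {c ℓ} (K : CommutativeRing c ℓ) where

  open import Data.Maybe using (just; nothing)
  open import Algebra.Solver.Ring.AlmostCommutativeRing using (fromCommutativeRing; _-Raw-AlmostCommutative⟶_; Induced-equivalence)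
  open import Relation.Binary.Definitions using (WeaklyDecidable)

  open CommutativeRing K
  open import Algebra.Properties.Semiring.Mult.TCOptimised semiring using (×-homo-+; ×1-homo-*; 1+×) renaming (_×_ to _×ₘ_)
  open import Algebra.Properties.Ring ring using (-‿distribˡ-*; -‿distribʳ-*; -0#≈0#; -‿involutive)
  open import Algebra.Properties.AbelianGroup +-abelianGroup using (⁻¹-∙-comm)
  open import Relation.Binary.Reasoning.Setoid setoid

  -- Equality in `K` need not be decidable, so the solver works with integer coefficients, whose
  -- equality is.
  fromℤ : ℤ → Carrier
  fromℤ (+ n) = n ×ₘ 1#
  fromℤ -[1+ n ] = - (suc n ×ₘ 1#)

  private
    neg-homo : ∀ i → fromℤ (ℤ.- i) ≈ - fromℤ i
    neg-homo (+ zero) = sym -0#≈0#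
    neg-homo (+ suc n) = refl
    neg-homo -[1+ n ] = sym (-‿involutive _)

    ⊖-homo : ∀ m n → fromℤ (m ℤ.⊖ n) ≈ m ×ₘ 1# + - (n ×ₘ 1#)
    ⊖-homo m zero = sym (trans (+-congˡ -0#≈0#) (+-identityʳ _))
    ⊖-homo zero (suc n) = sym (+-identityˡ _)
    ⊖-homo (suc m) (suc n) = begin
      fromℤ (suc m ℤ.⊖ suc n) ≡⟨ ≡.cong fromℤ (ℤₚ.[1+m]⊖[1+n]≡m⊖n m n) ⟩
      fromℤ (m ℤ.⊖ n) ≈⟨ ⊖-homo m n ⟩
      M + - N ≈⟨ +-congʳ (trans (sym (+-identityˡ M)) (trans (+-congʳ (sym (-‿inverseʳ 1#))) (trans (+-assoc _ _ _) (trans (+-congˡ (+-comm _ _)) (sym (+-assoc _ _ _)))))) ⟩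
      ((1# + M) + - 1#) + - N ≈⟨ +-assoc _ _ _ ⟩
      (1# + M) + (- 1# + - N) ≈⟨ +-cong (sym (1+× m 1#)) (trans (⁻¹-∙-comm _ _) (-‿cong (sym (1+× n 1#)))) ⟩
      suc m ×ₘ 1# + - (suc n ×ₘ 1#) ∎
      where
      M = m ×ₘ 1#
      N = n ×ₘ 1#

    +-homo : ∀ i j → fromℤ (i ℤ.+ j) ≈ fromℤ i + fromℤ j
    +-homo (+ m) (+ n) = ×-homo-+ 1# m n
    +-homo (+ m) -[1+ n ] = ⊖-homo m (suc n)
    +-homo -[1+ m ] (+ n) = trans (⊖-homo n (suc m)) (+-comm _ _)
    +-homo -[1+ m ] -[1+ n ] = begin
      - (suc (suc (m ℕ.+ n)) ×ₘ 1#) ≡⟨ ≡.cong (λ k → - (suc k ×ₘ 1#)) (≡.sym (ℕₚ.+-suc m n)) ⟩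
      - ((suc m ℕ.+ suc n) ×ₘ 1#) ≈⟨ -‿cong (×-homo-+ 1# (suc m) (suc n)) ⟩
      - (suc m ×ₘ 1# + suc n ×ₘ 1#) ≈⟨ sym (⁻¹-∙-comm _ _) ⟩
      - (suc m ×ₘ 1#) + - (suc n ×ₘ 1#) ∎

    *-homo⁺ : ∀ m j → fromℤ (+ m ℤ.* j) ≈ m ×ₘ 1# * fromℤ j
    *-homo⁺ m (+ n) = trans (reflexive (≡.cong fromℤ (≡.sym (ℤₚ.pos-* m n)))) (×1-homo-* m n)
    *-homo⁺ m -[1+ n ] = begin
      fromℤ (+ m ℤ.* -[1+ n ]) ≡⟨ ≡.cong fromℤ (≡.sym (ℤₚ.neg-distribʳ-* (+ m) (+ suc n))) ⟩
      fromℤ (ℤ.- (+ m ℤ.* + suc n)) ≈⟨ neg-homo (+ m ℤ.* + suc n) ⟩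
      - fromℤ (+ m ℤ.* + suc n) ≈⟨ -‿cong (*-homo⁺ m (+ suc n)) ⟩
      - (m ×ₘ 1# * suc n ×ₘ 1#) ≈⟨ -‿distribʳ-* _ _ ⟩
      m ×ₘ 1# * - (suc n ×ₘ 1#) ∎

    *-homo : ∀ i j → fromℤ (i ℤ.* j) ≈ fromℤ i * fromℤ j
    *-homo (+ m) j = *-homo⁺ m j
    *-homo -[1+ m ] j = begin
      fromℤ (-[1+ m ] ℤ.* j) ≡⟨ ≡.cong fromℤ (≡.sym (ℤₚ.neg-distribˡ-* (+ suc m) j)) ⟩
      fromℤ (ℤ.- (+ suc m ℤ.* j)) ≈⟨ neg-homo (+ suc m ℤ.* j) ⟩
      - fromℤ (+ suc m ℤ.* j) ≈⟨ -‿cong (*-homo⁺ (suc m) j) ⟩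
      - (suc m ×ₘ 1# * fromℤ j) ≈⟨ -‿distribˡ-* _ _ ⟩
      - (suc m ×ₘ 1#) * fromℤ j ∎

    morphism : ℤ.+-*-rawRing -Raw-AlmostCommutative⟶ fromCommutativeRing K
    morphism = record
      { ⟦_⟧ = fromℤ ; +-homo = +-homo ; *-homo = *-homo
      ; -‿homo = neg-homo ; 0-homo = refl ; 1-homo = refl }

    _coeff≟_ : WeaklyDecidable (Induced-equivalence morphism)
    i coeff≟ j with i ℤ.≟ j
    ... | yes ≡.refl = just refl
    ... | no _ = nothing

  open import Algebra.Solver.Ring ℤ.+-*-rawRing (fromCommutativeRing K) morphism _coeff≟_ public
    using (solve; _:+_; _:*_; _:-_; :-_; _:=_; con; var)

-- Finite sums and products, and sums over splittings of a list.

module SumsAndProducts {c ℓ} (K : CommutativeRing c ℓ) where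

  open import Data.List.Relation.Binary.Permutation.Propositional.Properties using (shift)

  open CommutativeRing K public hiding (zero)
  open RingSolver K public using (solve; _:+_; _:*_; _:-_; :-_; _:=_; con)
  open import Relation.Binary.Reasoning.Setoid setoid

  infixr 8 _^_
  _^_ : Carrier → ℕ → Carrier
  a ^ zero = 1#
  a ^ suc n = a * a ^ n

  ^-cong : ∀ {a b} n → a ≈ b → a ^ n ≈ b ^ n
  ^-cong zero e = refl
  ^-cong (suc n) e = *-cong e (^-cong n e)

  ^-+ : ∀ a m n → a ^ (m ℕ.+ n) ≈ a ^ m * a ^ n
  ^-+ a zero n = sym (*-identityˡ _)
  ^-+ a (suc m) n = trans (*-congˡ (^-+ a m n)) (sym (*-assoc _ _ _))

  module _ {i} {I : Set i} where

    ∏ : (I → Carrier) → List I → Carrier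
    ∏ φ [] = 1#
    ∏ φ (i ∷ is) = φ i * ∏ φ is

    ∏-cong∈ : ∀ {φ ψ} is → (∀ {i} → i ∈ is → φ i ≈ ψ i) → ∏ φ is ≈ ∏ ψ is
    ∏-cong∈ [] e = refl
    ∏-cong∈ (i ∷ is) e = *-cong (e (here ≡.refl)) (∏-cong∈ is (λ m → e (there m)))

    ∏-cong : ∀ {φ ψ} is → (∀ i → φ i ≈ ψ i) → ∏ φ is ≈ ∏ ψ is
    ∏-cong is e = ∏-cong∈ is (λ {i} _ → e i)

    ∏-1 : ∀ is → ∏ (λ _ → 1#) is ≈ 1#
    ∏-1 [] = refl
    ∏-1 (_ ∷ is) = trans (*-identityˡ _) (∏-1 is)

    ∏-* : ∀ φ ψ is → ∏ (λ i → φ i * ψ i) is ≈ ∏ φ is * ∏ ψ is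
    ∏-* φ ψ [] = sym (*-identityˡ _)
    ∏-* φ ψ (i ∷ is) = trans (*-congˡ (∏-* φ ψ is))
      (solve 4 (λ a b p q → a :* b :* (p :* q) := a :* p :* (b :* q)) refl (φ i) (ψ i) (∏ φ is) (∏ ψ is))

    ∏-++ : ∀ φ is js → ∏ φ (is ++ js) ≈ ∏ φ is * ∏ φ js
    ∏-++ φ [] js = sym (*-identityˡ _)
    ∏-++ φ (i ∷ is) js = trans (*-congˡ (∏-++ φ is js)) (sym (*-assoc _ _ _))

    ∏-↭ : ∀ φ {is js} → is ↭ js → ∏ φ is ≈ ∏ φ js
    ∏-↭ φ Perm.refl = refl
    ∏-↭ φ (Perm.prep i p) = *-congˡ (∏-↭ φ p)
    ∏-↭ φ (Perm.swap {ys = ys} i j p) = trans (*-congˡ (*-congˡ (∏-↭ φ p)))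
      (solve 3 (λ a b p → a :* (b :* p) := b :* (a :* p)) refl (φ i) (φ j) (∏ φ ys))
    ∏-↭ φ (Perm.trans p q) = trans (∏-↭ φ p) (∏-↭ φ q)

    ∏-zero : ∀ φ {is i} → i ∈ is → φ i ≈ 0# → ∏ φ is ≈ 0#
    ∏-zero φ (here ≡.refl) e = trans (*-congʳ e) (zeroˡ _)
    ∏-zero φ (there m) e = trans (*-congˡ (∏-zero φ m e)) (zeroʳ _)

    ∏-const : ∀ a (is : List I) → ∏ (λ _ → a) is ≈ a ^ length is
    ∏-const a [] = refl
    ∏-const a (_ ∷ is) = *-congˡ (∏-const a is)
    -- Both parts keep the order of the list; independence of that order is `splitSum-↭`, for
    -- summands invariant under permutations.
    splitSum : (List I → List I → Carrier) → List I → Carrier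
    splitSum f [] = f [] []
    splitSum f (x ∷ xs) = splitSum (λ S C → f (x ∷ S) C) xs + splitSum (λ S C → f S (x ∷ C)) xs

    -- The permutation in the hypothesis records that S and C make up xs: products over the two
    -- parts recombine, lengths add up, and uniqueness passes to S and C.
    splitSum-cong : ∀ {f g} xs → (∀ S C → S ++ C ↭ xs → f S C ≈ g S C) → splitSum f xs ≈ splitSum g xs
    splitSum-cong [] e = e [] [] ↭-refl
    splitSum-cong (x ∷ xs) e = +-cong
      (splitSum-cong xs (λ S C p → e (x ∷ S) C (↭-prep x p)))
      (splitSum-cong xs (λ S C p → e S (x ∷ C) (↭-trans (shift x S C) (↭-prep x p))))

    splitSum-cong′ : ∀ {f g} xs → (∀ S C → f S C ≈ g S C) → splitSum f xs ≈ splitSum g xs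
    splitSum-cong′ xs e = splitSum-cong xs (λ S C _ → e S C)

    splitSum-0 : ∀ xs → splitSum (λ _ _ → 0#) xs ≈ 0#
    splitSum-0 [] = refl
    splitSum-0 (x ∷ xs) = trans (+-cong (splitSum-0 xs) (splitSum-0 xs)) (+-identityˡ _)

    splitSum-+ : ∀ f g xs → splitSum (λ S C → f S C + g S C) xs ≈ splitSum f xs + splitSum g xs
    splitSum-+ f g [] = refl
    splitSum-+ f g (x ∷ xs) = trans (+-cong (splitSum-+ _ _ xs) (splitSum-+ _ _ xs))
      (solve 4 (λ a b p q → a :+ b :+ (p :+ q) := a :+ p :+ (b :+ q)) refl _ _ _ _)

    splitSum-*ˡ : ∀ a f xs → splitSum (λ S C → a * f S C) xs ≈ a * splitSum f xs
    splitSum-*ˡ a f [] = refl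
    splitSum-*ˡ a f (x ∷ xs) = trans (+-cong (splitSum-*ˡ a _ xs) (splitSum-*ˡ a _ xs)) (sym (distribˡ a _ _))

    splitSum-*ʳ : ∀ a f xs → splitSum (λ S C → f S C * a) xs ≈ splitSum f xs * a
    splitSum-*ʳ a f xs = trans (splitSum-cong′ xs (λ _ _ → *-comm _ a)) (trans (splitSum-*ˡ a f xs) (*-comm a _))

    Invariant₂ : (List I → List I → Carrier) → Set _
    Invariant₂ f = ∀ {S S′ C C′} → S ↭ S′ → C ↭ C′ → f S C ≈ f S′ C′

    splitSum-↭ : ∀ {f} → Invariant₂ f → ∀ {xs ys} → xs ↭ ys → splitSum f xs ≈ splitSum f ys
    splitSum-↭ inv Perm.refl = refl
    splitSum-↭ inv (Perm.prep x p) = +-cong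
      (splitSum-↭ (λ s c → inv (↭-prep x s) c) p) (splitSum-↭ (λ s c → inv s (↭-prep x c)) p)
    splitSum-↭ {f} inv (Perm.swap {xs = xs} {ys = ys} x y p) = begin
        (A x y xs + B x y xs) + (B y x xs + C x y xs)
          ≈⟨ +-cong (+-cong A≈ (splitSum-↭ (λ s c → inv (↭-prep x s) (↭-prep y c)) p))
                    (+-cong (splitSum-↭ (λ s c → inv (↭-prep y s) (↭-prep x c)) p) C≈) ⟩
        (A y x ys + B x y ys) + (B y x ys + C y x ys)
          -- The two mixed terms, with x and y on different sides, trade places.
          ≈⟨ solve 4 (λ a b c d → a :+ b :+ (c :+ d) := a :+ c :+ (b :+ d)) refl _ _ _ _ ⟩
        (A y x ys + B y x ys) + (B x y ys + C y x ys) ∎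
      where
      A B C : I → I → List I → Carrier
      A x y = splitSum (λ S C → f (x ∷ y ∷ S) C)
      B x y = splitSum (λ S C → f (x ∷ S) (y ∷ C))
      C x y = splitSum (λ S C → f S (x ∷ y ∷ C))
      A≈ : A x y xs ≈ A y x ys
      A≈ = trans (splitSum-cong′ xs (λ S C → inv (Perm.swap x y ↭-refl) ↭-refl))
                 (splitSum-↭ (λ s c → inv (↭-prep y (↭-prep x s)) c) p)
      C≈ : C x y xs ≈ C y x ys
      C≈ = trans (splitSum-cong′ xs (λ S C → inv ↭-refl (Perm.swap x y ↭-refl)))
                 (splitSum-↭ (λ s c → inv s (↭-prep y (↭-prep x c))) p)
    splitSum-↭ inv (Perm.trans p q) = trans (splitSum-↭ inv p) (splitSum-↭ inv q)

    -- Both sides run over the ordered splittings of xs into three parts.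
    splitSum-assoc : ∀ (f : List I → List I → List I → Carrier) xs →
      splitSum (λ S C → splitSum (λ S₁ S₂ → f S₁ S₂ C) S) xs ≈
      splitSum (λ S₁ R → splitSum (λ S₂ C → f S₁ S₂ C) R) xs
    splitSum-assoc f [] = refl
    splitSum-assoc f (x ∷ xs) = begin
      splitSum (λ S C → splitSum (λ S₁ S₂ → f (x ∷ S₁) S₂ C) S + splitSum (λ S₁ S₂ → f S₁ (x ∷ S₂) C) S) xs
        + splitSum (λ S C → splitSum (λ S₁ S₂ → f S₁ S₂ (x ∷ C)) S) xs
        ≈⟨ +-congʳ (splitSum-+ _ _ xs) ⟩
      (_ + _) + _
        ≈⟨ +-assoc _ _ _ ⟩
      _ + (_ + _)
        ≈⟨ +-cong (splitSum-assoc (λ a b c → f (x ∷ a) b c) xs)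
            (trans (+-cong (splitSum-assoc (λ a b c → f a (x ∷ b) c) xs) (splitSum-assoc (λ a b c → f a b (x ∷ c)) xs))
                   (sym (splitSum-+ _ _ xs))) ⟩
      splitSum (λ S₁ R → splitSum (λ S₂ C → f (x ∷ S₁) S₂ C) R) xs
        + splitSum (λ S₁ R → splitSum (λ S₂ C → f S₁ (x ∷ S₂) C) R + splitSum (λ S₂ C → f S₁ S₂ (x ∷ C)) R) xs ∎

  module _ {i} {I : Set i} where

    ∑ : (I → Carrier) → List I → Carrier
    ∑ f [] = 0#
    ∑ f (i ∷ is) = f i + ∑ f is

    ∑-cong∈ : ∀ {f g} is → (∀ {i} → i ∈ is → f i ≈ g i) → ∑ f is ≈ ∑ g is
    ∑-cong∈ [] e = refl
    ∑-cong∈ (i ∷ is) e = +-cong (e (here ≡.refl)) (∑-cong∈ is (λ m → e (there m)))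

    ∑-++ : ∀ f is js → ∑ f (is ++ js) ≈ ∑ f is + ∑ f js
    ∑-++ f [] js = sym (+-identityˡ _)
    ∑-++ f (i ∷ is) js = trans (+-congˡ (∑-++ f is js)) (sym (+-assoc _ _ _))

    ∑-+ : ∀ f g is → ∑ (λ i → f i + g i) is ≈ ∑ f is + ∑ g is
    ∑-+ f g [] = sym (+-identityˡ _)
    ∑-+ f g (i ∷ is) = trans (+-congˡ (∑-+ f g is))
      (solve 4 (λ a b p q → a :+ b :+ (p :+ q) := a :+ p :+ (b :+ q)) refl (f i) (g i) (∑ f is) (∑ g is))

    ∑-*ˡ : ∀ k f is → ∑ (λ i → k * f i) is ≈ k * ∑ f is
    ∑-*ˡ k f [] = sym (zeroʳ k)
    ∑-*ˡ k f (i ∷ is) = trans (+-congˡ (∑-*ˡ k f is)) (sym (distribˡ _ _ _))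

    ∑-0 : ∀ is → ∑ (λ _ → 0#) is ≈ 0#
    ∑-0 [] = refl
    ∑-0 (_ ∷ is) = trans (+-identityˡ _) (∑-0 is)

    ∑-↭ : ∀ f {is js} → is ↭ js → ∑ f is ≈ ∑ f js
    ∑-↭ f Perm.refl = refl
    ∑-↭ f (Perm.prep i p) = +-congˡ (∑-↭ f p)
    ∑-↭ f (Perm.swap {ys = ys} i j p) = trans (+-congˡ (+-congˡ (∑-↭ f p)))
      (solve 3 (λ a b p → a :+ (b :+ p) := b :+ (a :+ p)) refl (f i) (f j) (∑ f ys))
    ∑-↭ f (Perm.trans p q) = trans (∑-↭ f p) (∑-↭ f q)

  ∑-map : ∀ {i j} {I : Set i} {J : Set j} (f : J → Carrier) (h : I → J) is → ∑ f (map h is) ≡ ∑ (f ∘ h) is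
  ∑-map f h [] = ≡.refl
  ∑-map f h (i ∷ is) = ≡.cong (λ z → f (h i) + z) (∑-map f h is)

  ∑-concatMap : ∀ {i j} {I : Set i} {J : Set j} (f : J → Carrier) (h : I → List J) is →
    ∑ f (concatMap h is) ≈ ∑ (λ i → ∑ f (h i)) is
  ∑-concatMap f h [] = refl
  ∑-concatMap f h (i ∷ is) = trans (∑-++ f (h i) (concatMap h is)) (+-congˡ (∑-concatMap f h is))

  splitSum-∑ : ∀ {i j} {I : Set i} {J : Set j} (f : J → List I → List I → Carrier) js xs →
    splitSum (λ S C → ∑ (λ j → f j S C) js) xs ≈ ∑ (λ j → splitSum (f j) xs) js
  splitSum-∑ f [] xs = splitSum-0 xs
  splitSum-∑ f (j ∷ js) xs = trans (splitSum-+ _ _ xs) (+-congˡ (splitSum-∑ f js xs))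

  ∑-upTo-suc : ∀ (f : ℕ → Carrier) n → ∑ f (upTo (suc n)) ≈ f 0 + ∑ (f ∘ suc) (upTo n)
  ∑-upTo-suc f n = +-congˡ (reflexive (≡.trans (≡.cong (∑ f) (≡.sym (map-upTo suc n))) (∑-map f suc (upTo n))))

  ∏-map : ∀ {i j} {I : Set i} {J : Set j} (φ : J → Carrier) (h : I → J) is → ∏ φ (map h is) ≡ ∏ (φ ∘ h) is
  ∏-map φ h [] = ≡.refl
  ∏-map φ h (i ∷ is) = ≡.cong (λ z → φ (h i) * z) (∏-map φ h is)

  ∏-concatMap : ∀ {i j} {I : Set i} {J : Set j} (φ : J → Carrier) (h : I → List J) is →
    ∏ φ (concatMap h is) ≈ ∏ (λ i → ∏ φ (h i)) is
  ∏-concatMap φ h [] = refl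
  ∏-concatMap φ h (i ∷ is) = trans (∏-++ φ (h i) (concatMap h is)) (*-congˡ (∏-concatMap φ h is))

  ∏-upTo-suc : ∀ (φ : ℕ → Carrier) n → ∏ φ (upTo (suc n)) ≈ φ 0 * ∏ (φ ∘ suc) (upTo n)
  ∏-upTo-suc φ n = *-congˡ (reflexive (≡.trans (≡.cong (∏ φ) (≡.sym (map-upTo suc n))) (∏-map φ suc (upTo n))))

  ∏-upTo-∷ʳ : ∀ (φ : ℕ → Carrier) n → ∏ φ (upTo (suc n)) ≈ ∏ φ (upTo n) * φ n
  ∏-upTo-∷ʳ φ n = trans (reflexive (≡.cong (∏ φ) (≡.sym (upTo-∷ʳ n)))) (trans (∏-++ φ (upTo n) (n ∷ [])) (*-congˡ (*-identityʳ _)))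

-- Polynomial functions over a commutative ring and the bound on their roots.

module Interpolation {c ℓ} (K : CommutativeRing c ℓ) where

  open SumsAndProducts K
  open import Relation.Binary.Reasoning.Setoid setoid

  Invertible : Carrier → Set (c ⊔ ℓ)
  Invertible a = ∃ λ b → a * b ≈ 1#

  Invertible-resp : ∀ {a b} → a ≈ b → Invertible a → Invertible b
  Invertible-resp e (c , p) = c , trans (*-congʳ (sym e)) p

  Invertible-* : ∀ {a b} → Invertible a → Invertible b → Invertible (a * b)
  Invertible-* {a} {b} (c , p) (d , q) = c * d ,
    trans (solve 4 (λ a b c d → a :* b :* (c :* d) := (a :* c) :* (b :* d)) refl a b c d) (trans (*-cong p q) (*-identityˡ _))

  Invertible-factor : ∀ {a b} → Invertible (a * b) → Invertible a
  Invertible-factor {a} {b} (c , p) = b * c , trans (sym (*-assoc _ _ _)) p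

  Invertible-neg : ∀ {a} → Invertible a → Invertible (- a)
  Invertible-neg {a} (c , p) = - c , trans (solve 2 (λ a c → (:- a) :* (:- c) := a :* c) refl a c) p

  Invertible-∏ : ∀ {i} {I : Set i} (φ : I → Carrier) {is : List I} → All (λ i → Invertible (φ i)) is → Invertible (∏ φ is)
  Invertible-∏ φ [] = 1# , *-identityˡ _
  Invertible-∏ φ (p ∷ ps) = Invertible-* p (Invertible-∏ φ ps)

  *-cancelˡ : ∀ {a b c} → Invertible a → a * b ≈ a * c → b ≈ c
  *-cancelˡ {a} {b} {c} (d , p) e = begin
    b           ≈⟨ sym (*-identityˡ b) ⟩
    1# * b      ≈⟨ *-congʳ (sym p) ⟩
    a * d * b   ≈⟨ solve 3 (λ a d b → a :* d :* b := d :* (a :* b)) refl a d b ⟩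
    d * (a * b) ≈⟨ *-congˡ e ⟩
    d * (a * c) ≈⟨ solve 3 (λ a d b → d :* (a :* b) := a :* d :* b) refl a d c ⟩
    a * d * c   ≈⟨ *-congʳ p ⟩
    1# * c      ≈⟨ *-identityˡ c ⟩
    c ∎

  -- "f is a polynomial function of degree at most k", in the form of division with remainder by every z - a.
  PolyFn : ℕ → (Carrier → Carrier) → Set (c ⊔ ℓ)
  PolyFn zero f = ∀ z w → f z ≈ f w
  PolyFn (suc k) f = ∀ a → Σ (Carrier → Carrier) λ g → PolyFn k g × (∀ z → f z ≈ f a + (z - a) * g z)

  PolyFn-resp : ∀ k {f g} → (∀ z → f z ≈ g z) → PolyFn k f → PolyFn k g
  PolyFn-resp zero e p z w = trans (sym (e z)) (trans (p z w) (e w))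
  PolyFn-resp (suc k) e p a with p a
  ... | h , q , eq = h , q , λ z → trans (sym (e z)) (trans (eq z) (+-congʳ (e a)))

  PolyFn-const : ∀ k a → PolyFn k (λ _ → a)
  PolyFn-const zero a z w = refl
  PolyFn-const (suc k) a b = (λ _ → 0#) , PolyFn-const k 0# ,
    λ z → solve 3 (λ a z b → a := a :+ (z :- b) :* con (+ 0)) refl a z b

  PolyFn-suc : ∀ k {f} → PolyFn k f → PolyFn (suc k) f
  PolyFn-suc zero {f} p a = (λ _ → 0#) , PolyFn-const 0 0# ,
    λ z → trans (p z a) (solve 3 (λ a z b → a := a :+ (z :- b) :* con (+ 0)) refl (f a) z a)
  PolyFn-suc (suc k) p a with p a
  ... | h , q , eq = h , PolyFn-suc k q , eq

  PolyFn-+ : ∀ k {f g} → PolyFn k f → PolyFn k g → PolyFn k (λ z → f z + g z)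
  PolyFn-+ zero p q z w = +-cong (p z w) (q z w)
  PolyFn-+ (suc k) {f} {g} p q a with p a | q a
  ... | f′ , p′ , e | g′ , q′ , e′ = (λ z → f′ z + g′ z) , PolyFn-+ k p′ q′ , λ z → trans (+-cong (e z) (e′ z))
    (solve 6 (λ fa ga z a fz gz → fa :+ (z :- a) :* fz :+ (ga :+ (z :- a) :* gz) := fa :+ ga :+ (z :- a) :* (fz :+ gz))
      refl (f a) (g a) z a (f′ z) (g′ z))

  PolyFn-scale : ∀ k b {f} → PolyFn k f → PolyFn k (λ z → b * f z)
  PolyFn-scale zero b p z w = *-congˡ (p z w)
  PolyFn-scale (suc k) b {f} p a with p a
  ... | f′ , p′ , e = (λ z → b * f′ z) , PolyFn-scale k b p′ , λ z → trans (*-congˡ (e z))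
    (solve 5 (λ b fa z a fz → b :* (fa :+ (z :- a) :* fz) := b :* fa :+ (z :- a) :* (b :* fz)) refl b (f a) z a (f′ z))

  -- From α + βz = (α + βa) + β(z - a), the quotient by z - a is β f + (α + βa) g, where g is the
  -- quotient of f.
  PolyFn-linear : ∀ k α β {f} → PolyFn k f → PolyFn (suc k) (λ z → (α + β * z) * f z)
  PolyFn-linear zero α β {f} p a = (λ z → β * f z) , PolyFn-scale 0 β p ,
    λ z → trans (*-congˡ (p z a)) (trans (solve 5 (λ α β z a fz → (α :+ β :* z) :* fz := (α :+ β :* a) :* fz :+ (z :- a) :* (β :* fz))
      refl α β z a (f a)) (+-congˡ (*-congˡ (*-congˡ (p a z)))))
  PolyFn-linear (suc k) α β {f} p a with p a
  ... | g , q , e = (λ z → β * f z + (α + β * a) * g z) ,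
    PolyFn-+ (suc k) (PolyFn-scale (suc k) β p) (PolyFn-scale (suc k) (α + β * a) (PolyFn-suc k q)) ,
    λ z → begin
      (α + β * z) * f z
        ≈⟨ solve 5 (λ α β z a fz → (α :+ β :* z) :* fz := (α :+ β :* a) :* fz :+ (z :- a) :* (β :* fz)) refl α β z a (f z) ⟩
      (α + β * a) * f z + (z - a) * (β * f z)
        ≈⟨ +-congʳ (*-congˡ (e z)) ⟩
      (α + β * a) * (f a + (z - a) * g z) + (z - a) * (β * f z)
        ≈⟨ solve 5 (λ l fa d g bf → l :* (fa :+ d :* g) :+ d :* bf := l :* fa :+ d :* (bf :+ l :* g)) refl (α + β * a) (f a) (z - a) (g z) (β * f z) ⟩
      (α + β * a) * f a + (z - a) * (β * f z + (α + β * a) * g z) ∎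

  Affine : (Carrier → Carrier) → Set (c ⊔ ℓ)
  Affine l = Σ Carrier λ α → Σ Carrier λ β → ∀ z → l z ≈ α + β * z

  PolyFn-affine : ∀ k {l f} → Affine l → PolyFn k f → PolyFn (suc k) (λ z → l z * f z)
  PolyFn-affine k (α , β , e) p = PolyFn-resp (suc k) (λ z → *-congʳ (sym (e z))) (PolyFn-linear k α β p)

  PolyFn-∏ : ∀ {i} {I : Set i} k (l : I → Carrier → Carrier) {f} → (∀ i → Affine (l i)) → ∀ is → PolyFn k f →
    PolyFn (length is ℕ.+ k) (λ z → ∏ (λ i → l i z) is * f z)
  PolyFn-∏ k l a [] p = PolyFn-resp k (λ z → sym (*-identityˡ _)) p
  PolyFn-∏ k l a (i ∷ is) p = PolyFn-resp (suc (length is ℕ.+ k)) (λ z → sym (*-assoc _ _ _))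
    (PolyFn-affine (length is ℕ.+ k) (a i) (PolyFn-∏ k l a is p))

  PolyFn-splitSum : ∀ {i} {I : Set i} k (f : List I → List I → Carrier → Carrier) xs →
    (∀ S C → length S ℕ.+ length C ≡ length xs → PolyFn k (f S C)) → PolyFn k (λ z → splitSum (λ S C → f S C z) xs)
  PolyFn-splitSum k f [] p = p [] [] ≡.refl
  PolyFn-splitSum k f (x ∷ xs) p = PolyFn-+ k
    (PolyFn-splitSum k _ xs (λ S C e → p (x ∷ S) C (≡.cong suc e)))
    (PolyFn-splitSum k _ xs (λ S C e → p S (x ∷ C) (≡.trans (ℕₚ.+-suc (length S) (length C)) (≡.cong suc e))))

  -- Invertibility of the difference takes the place of distinctness, as `K` may have zero divisors.
  Apart : Carrier → Carrier → Set (c ⊔ ℓ)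
  Apart a b = Invertible (b - a)

  -- The quotient by z - r has degree one less and vanishes at every other node s, because s - r can
  -- be cancelled.
  PolyFn-roots : ∀ k {f} → PolyFn k f → ∀ rs → length rs ≡ suc k → AllPairs Apart rs →
    All (λ r → f r ≈ 0#) rs → ∀ z → f z ≈ 0#
  PolyFn-roots zero p (r ∷ []) _ _ (e ∷ []) z = trans (p z r) e
  PolyFn-roots (suc k) {f} p (r ∷ rs) l (a ∷ as) (e ∷ es) z with p r
  ... | g , q , eq = begin
    f z ≈⟨ eq z ⟩
    f r + (z - r) * g z ≈⟨ +-cong e (*-congˡ (PolyFn-roots k q rs (ℕₚ.suc-injective l) as (All.zipWith g-root (a , es)) z)) ⟩
    0# + (z - r) * 0# ≈⟨ trans (+-identityˡ _) (zeroʳ _) ⟩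
    0# ∎
    where
    g-root : ∀ {s} → Apart r s × f s ≈ 0# → g s ≈ 0#
    g-root {s} (inv , fs) = *-cancelˡ inv (begin
      (s - r) * g s ≈⟨ sym (+-identityˡ _) ⟩
      0# + (s - r) * g s ≈⟨ +-congʳ (sym e) ⟩
      f r + (s - r) * g s ≈⟨ sym (eq s) ⟩
      f s ≈⟨ fs ⟩
      0# ≈⟨ sym (zeroʳ _) ⟩
      (s - r) * 0# ∎)

-- Duplicate-free lists.

module UniqueLists where

  open import Data.List.Relation.Binary.Permutation.Propositional using (↭⇒↭ₛ)
  import Data.List.Relation.Binary.Permutation.Setoid.Properties as Permₛ

  module _ {a} {A : Set a} where

    Unique-resp-↭ : ∀ {xs ys : List A} → xs ↭ ys → Unique xs → Unique ys
    Unique-resp-↭ p = Permₛ.Unique-resp-↭ (≡.setoid A) (↭⇒↭ₛ p)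

    Unique-++⁻ : ∀ (xs : List A) {ys} → Unique (xs ++ ys) → Unique xs × Unique ys
    Unique-++⁻ [] u = [] , u
    Unique-++⁻ (x ∷ xs) (p ∷ u) with Unique-++⁻ xs u
    ... | uxs , uys = All.++⁻ˡ xs p ∷ uxs , uys

    ∈⇒↭ : ∀ {x : A} {xs} → x ∈ xs → ∃ λ ys → xs ↭ x ∷ ys
    ∈⇒↭ {xs = _ ∷ xs} (here ≡.refl) = xs , ↭-refl
    ∈⇒↭ {x} {y ∷ xs} (there m) with ∈⇒↭ m
    ... | ys , p = y ∷ ys , ↭-trans (↭-prep y p) (Perm.swap y x ↭-refl)

-- Enumeration of partitions by their parts and by their multiplicities.

module Partitions where

  open import Data.Bool using (T)
  open import Data.Bool.Properties using (T-≡; ¬-not)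
  open import Data.Nat using (_⊓_; _+_; _*_; _≤_; _<_; _≡ᵇ_)
  open import Data.Nat.Properties
  open import Data.List.Properties using (∷-injectiveˡ)
  open import Data.Nat.ListAction.Properties using (sum-++)
  open import Data.List.Membership.Propositional.Properties using (∈-map⁺; ∈-upTo⁺)
  open import Data.List.Membership.Propositional.Properties.WithK using (unique∧set⇒bag)
  open import Data.List.Relation.Binary.BagAndSetEquality using (∼bag⇒↭)
  open import Data.List.Relation.Unary.Unique.Propositional.Properties using (map⁺; ++⁺; upTo⁺)
  open import Function using (mk⇔; Equivalence)
  open import Relation.Binary.PropositionalEquality
  open import Defs using (partsB; partitions; filterB; mult; maxPart; IsPartition; Decreasing; AllPos; dnil; done; dcons; pnil; pcons)

  module _ {a b} {A : Set a} {B : Set b} where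

    ∈-concatMap⁻ : ∀ (h : A → List B) xs {y} → y ∈ concatMap h xs → ∃ λ x → x ∈ xs × y ∈ h x
    ∈-concatMap⁻ h (x ∷ xs) m with ∈-++⁻ (h x) m
    ... | inj₁ m′ = x , here refl , m′
    ... | inj₂ m′ with ∈-concatMap⁻ h xs m′
    ...   | z , z∈ , y∈ = z , there z∈ , y∈

    ∈-concatMap⁺ : ∀ (h : A → List B) {xs x y} → x ∈ xs → y ∈ h x → y ∈ concatMap h xs
    ∈-concatMap⁺ h (here refl) m = ∈-++⁺ˡ m
    ∈-concatMap⁺ h {x ∷ xs} (there x∈) m = ∈-++⁺ʳ (h x) (∈-concatMap⁺ h x∈ m)

    Unique-concatMap : ∀ (h : A → List B) {xs} → Unique xs → (∀ x → Unique (h x)) →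
      (∀ {x z y} → y ∈ h x → y ∈ h z → x ≡ z) → Unique (concatMap h xs)
    Unique-concatMap h [] u d = []
    Unique-concatMap h {x ∷ xs} (x∉ ∷ uxs) u d = ++⁺ (u x) (Unique-concatMap h uxs u d) disjoint
      where
      disjoint : ∀ {y} → y ∈ h x × y ∈ concatMap h xs → _
      disjoint (m , m′) with ∈-concatMap⁻ h xs m′
      ... | z , z∈ , y∈ = All.lookup x∉ z∈ (d m y∈)

  module _ {A : Set} where

    ∈-filterB⁻ : ∀ (f : A → Bool) xs {x} → x ∈ filterB f xs → x ∈ xs × T (f x)
    ∈-filterB⁻ f (z ∷ xs) m with f z in eq
    ∈-filterB⁻ f (z ∷ xs) (here refl) | true = here refl , subst T (sym eq) tt
    ∈-filterB⁻ f (z ∷ xs) (there m) | true with ∈-filterB⁻ f xs m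
    ... | m′ , t = there m′ , t
    ∈-filterB⁻ f (z ∷ xs) m | false with ∈-filterB⁻ f xs m
    ... | m′ , t = there m′ , t

    ∈-filterB⁺ : ∀ (f : A → Bool) {xs x} → x ∈ xs → T (f x) → x ∈ filterB f xs
    ∈-filterB⁺ f {z ∷ xs} (here refl) t with f z
    ... | true = here refl
    ∈-filterB⁺ f {z ∷ xs} (there m) t with f z
    ... | true = there (∈-filterB⁺ f m t)
    ... | false = ∈-filterB⁺ f m t

    Unique-filterB : ∀ (f : A → Bool) {xs} → Unique xs → Unique (filterB f xs)
    Unique-filterB f [] = []
    Unique-filterB f {x ∷ xs} (x∉ ∷ u) with f x
    ... | true = All.tabulate (λ m → All.lookup x∉ (proj₁ (∈-filterB⁻ f xs m))) ∷ Unique-filterB f u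
    ... | false = Unique-filterB f u
  -- Each part becomes the bound for the rest, which follows the recursion of `partsB`; weak
  -- decrease is thereby built in.
  Part : ℕ → List ℕ → Set
  Part M [] = ⊤
  Part M (p ∷ la) = 1 ≤ p × p ≤ M × Part p la

  Part-IsPartition : ∀ {M} la → Part M la → IsPartition la
  Part-IsPartition la p = decreasing la p , positive la p
    where
    decreasing : ∀ {M} la → Part M la → Decreasing la
    decreasing [] _ = dnil
    decreasing (x ∷ []) _ = done
    decreasing (x ∷ y ∷ la) (_ , _ , q@(_ , y≤x , _)) = dcons y≤x (decreasing (y ∷ la) q)
    positive : ∀ {M} la → Part M la → AllPos la
    positive [] _ = pnil
    positive (x ∷ la) (1≤x , _ , q) = pcons 1≤x (positive la q)

  Part-≤ : ∀ {M N} la → M ≤ N → Part M la → Part N la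
  Part-≤ [] l p = tt
  Part-≤ (x ∷ la) l (1≤x , x≤M , q) = 1≤x , ≤-trans x≤M l , q

  Part-sum : ∀ {M} la → Part M la → Part (sum la) la
  Part-sum [] p = tt
  Part-sum (x ∷ la) (1≤x , x≤M , q) = 1≤x , m≤m+n x (sum la) , q

  ∈-map-∷⁻ : ∀ {x : ℕ} (L : List (List ℕ)) {l} → l ∈ map (x ∷_) L → ∃ λ l′ → l′ ∈ L × l ≡ x ∷ l′
  ∈-map-∷⁻ {x} L m = ∈-map⁻ (x ∷_) m

  map-∷-head : ∀ {x y : ℕ} (L L′ : List (List ℕ)) {l} → l ∈ map (x ∷_) L → l ∈ map (y ∷_) L′ → x ≡ y
  map-∷-head L L′ m m′ with ∈-map-∷⁻ L m | ∈-map-∷⁻ L′ m′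
  ... | _ , _ , refl | _ , _ , e = ∷-injectiveˡ e

  map-∷-Unique : ∀ (x : ℕ) {L : List (List ℕ)} → Unique L → Unique (map (x ∷_) L)
  map-∷-Unique x u = map⁺ (λ { refl → refl }) u

  partsB-sound : ∀ f k mx {la} → la ∈ partsB f k mx → Part mx la × sum la ≡ k
  partsB-sound f zero mx (here refl) = tt , refl
  partsB-sound (suc f) (suc k) mx m with ∈-concatMap⁻ (λ p → map (p ∷_) (partsB f (suc k ∸ p) p)) (map suc (upTo (suc k ⊓ mx))) m
  ... | p , p∈ , m′ with ∈-map⁻ suc p∈ | ∈-map-∷⁻ (partsB f (suc k ∸ p) p) m′
  ...   | i , i∈ , refl | la′ , la∈ , refl with partsB-sound f (suc k ∸ suc i) (suc i) la∈
  ...     | q , e = (s≤s z≤n , ≤-trans i<min (m⊓n≤n (suc k) mx) , q) ,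
                    trans (cong (λ k → suc i + k) e) (m+[n∸m]≡n (≤-trans i<min (m⊓n≤m (suc k) mx)))
    where
    i<min : suc i ≤ suc k ⊓ mx
    i<min = ∈-upTo⁻ i∈

  partsB-complete : ∀ f mx la → sum la ≤ f → Part mx la → la ∈ partsB f (sum la) mx
  partsB-complete f mx [] l p = here refl
  partsB-complete (suc f) mx (suc i ∷ la) (s≤s l) (_ , i<mx , q) =
    ∈-concatMap⁺ (λ p → map (p ∷_) (partsB f (suc (i + sum la) ∸ p) p))
      (∈-map⁺ suc (∈-upTo⁺ (⊓-glb (m≤m+n (suc i) (sum la)) i<mx)))
      (∈-map⁺ (suc i ∷_) (subst (λ k → la ∈ partsB f k (suc i)) (sym (m+n∸m≡n (suc i) (sum la)))
        (partsB-complete f (suc i) la (≤-trans (m≤n+m (sum la) i) l) q)))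

  partsB-Unique : ∀ f k mx → Unique (partsB f k mx)
  partsB-Unique f zero mx = [] ∷ []
  partsB-Unique zero (suc k) mx = []
  partsB-Unique (suc f) (suc k) mx = Unique-concatMap (λ p → map (p ∷_) (partsB f (suc k ∸ p) p))
    (map⁺ suc-injective (upTo⁺ (suc k ⊓ mx)))
    (λ p → map-∷-Unique p (partsB-Unique f (suc k ∸ p) p))
    (λ {p} {q} → map-∷-head (partsB f (suc k ∸ p) p) (partsB f (suc k ∸ q) q))

  -- A partition with parts at most M is encoded by its multiplicities m_M ∷ … ∷ m_1 ∷ [].

  part : List ℕ → List ℕ
  part [] = []
  part (m ∷ ms) = replicate m (suc (length ms)) ++ part ms

  -- What the entries leave over of n is the multiplicity of the part 0 when the partition is padded
  -- to n variables.
  multiplicities : ℕ → ℕ → List (List ℕ)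
  multiplicities zero n = [] ∷ []
  multiplicities (suc M) n = concatMap (λ j → map (j ∷_) (multiplicities M (n ∸ j))) (upTo (suc n))

  ∈-multiplicities⁻ : ∀ M n {ms} → ms ∈ multiplicities (suc M) n →
    ∃ λ j → ∃ λ ms′ → ms ≡ j ∷ ms′ × j ≤ n × ms′ ∈ multiplicities M (n ∸ j)
  ∈-multiplicities⁻ M n m with ∈-concatMap⁻ (λ j → map (j ∷_) (multiplicities M (n ∸ j))) (upTo (suc n)) m
  ... | j , j∈ , m′ with ∈-map-∷⁻ (multiplicities M (n ∸ j)) m′
  ...   | ms′ , ms∈ , e = j , ms′ , e , ≤-pred (∈-upTo⁻ j∈) , ms∈

  ∈-multiplicities⁺ : ∀ M {n j ms} → j ≤ n → ms ∈ multiplicities M (n ∸ j) → (j ∷ ms) ∈ multiplicities (suc M) n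
  ∈-multiplicities⁺ M {n} {j} l m = ∈-concatMap⁺ (λ j → map (j ∷_) (multiplicities M (n ∸ j))) (∈-upTo⁺ (s≤s l)) (∈-map⁺ (j ∷_) m)

  multiplicities-length : ∀ M n {ms} → ms ∈ multiplicities M n → length ms ≡ M
  multiplicities-length zero n (here refl) = refl
  multiplicities-length (suc M) n m with ∈-multiplicities⁻ M n m
  ... | j , ms′ , refl , _ , m′ = cong suc (multiplicities-length M (n ∸ j) m′)

  multiplicities-sum : ∀ M n {ms} → ms ∈ multiplicities M n → sum ms ≤ n
  multiplicities-sum zero n (here refl) = z≤n
  multiplicities-sum (suc M) n m with ∈-multiplicities⁻ M n m
  ... | j , ms′ , refl , j≤n , m′ = subst (λ k → j + sum ms′ ≤ k) (m+[n∸m]≡n j≤n) (+-monoʳ-≤ j (multiplicities-sum M (n ∸ j) m′))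

  multiplicities-Unique : ∀ M n → Unique (multiplicities M n)
  multiplicities-Unique zero n = [] ∷ []
  multiplicities-Unique (suc M) n = Unique-concatMap (λ j → map (j ∷_) (multiplicities M (n ∸ j))) (upTo⁺ (suc n))
    (λ j → map-∷-Unique j (multiplicities-Unique M (n ∸ j)))
    (λ {i} {j} → map-∷-head (multiplicities M (n ∸ i)) (multiplicities M (n ∸ j)))

  part-Part : ∀ ms → Part (length ms) (part ms)
  part-Part [] = tt
  part-Part (m ∷ ms) = go m
    where
    M = suc (length ms)
    go : ∀ m → Part M (replicate m M ++ part ms)
    go zero = Part-≤ (part ms) (n≤1+n _) (part-Part ms)
    go (suc m) = s≤s z≤n , ≤-refl , go m

  part-length : ∀ ms → length (part ms) ≡ sum ms
  part-length [] = refl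
  part-length (m ∷ ms) = trans (length-++ (replicate m (suc (length ms)))) (cong₂ _+_ (length-replicate m) (part-length ms))

  size : List ℕ → ℕ
  size [] = 0
  size (m ∷ ms) = m * suc (length ms) + size ms

  part-sum : ∀ ms → sum (part ms) ≡ size ms
  part-sum [] = refl
  part-sum (m ∷ ms) = trans (sum-++ (replicate m (suc (length ms))) (part ms)) (cong₂ _+_ (sum-replicate m) (part-sum ms))
    where
    sum-replicate : ∀ m → sum (replicate m (suc (length ms))) ≡ m * suc (length ms)
    sum-replicate zero = refl
    sum-replicate (suc m) = cong (λ k → suc (length ms) + k) (sum-replicate m)

  part-complete : ∀ M n la → Part M la → length la ≤ n → ∃ λ ms → ms ∈ multiplicities M n × part ms ≡ la
  part-complete zero n [] p l = [] , here refl , refl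
  part-complete zero n (x ∷ la) (1≤x , x≤0 , _) l = contradiction (≤-trans 1≤x x≤0) (λ ())
  part-complete (suc M) n [] p l with part-complete M n [] tt z≤n
  ... | ms , m , e = 0 ∷ ms , ∈-multiplicities⁺ M z≤n m , e
  part-complete (suc M) (suc n) (x ∷ la) (1≤x , x≤M , q) (s≤s l) with x ℕ.≟ suc M
  ... | yes refl with part-complete (suc M) n la q l
  ...   | ms , m , e with ∈-multiplicities⁻ M n m
  ...     | j , ms′ , refl , j≤n , m′ = suc j ∷ ms′ , ∈-multiplicities⁺ M (s≤s j≤n) m′ ,
              cong₂ _∷_ (cong suc (multiplicities-length M (n ∸ j) m′)) e
  part-complete (suc M) (suc n) (x ∷ la) (1≤x , x≤M , q) (s≤s l) | no ne
    with part-complete M (suc n) (x ∷ la) (1≤x , ≤-pred (≤∧≢⇒< x≤M ne) , q) (s≤s l)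
  ... | ms , m , e = 0 ∷ ms , ∈-multiplicities⁺ M z≤n m , e

  ≡ᵇ-refl : ∀ n → (n ≡ᵇ n) ≡ true
  ≡ᵇ-refl n = Equivalence.to T-≡ (≡⇒≡ᵇ n n refl)

  ≡ᵇ-≢ : ∀ {m n} → m ≢ n → (m ≡ᵇ n) ≡ false
  ≡ᵇ-≢ {m} {n} ne = ¬-not (λ e → ne (≡ᵇ⇒≡ m n (Equivalence.from T-≡ e)))

  mult-replicate : ∀ i m la → mult i (replicate m i ++ la) ≡ m + mult i la
  mult-replicate i zero la = refl
  mult-replicate i (suc m) la rewrite ≡ᵇ-refl i = cong suc (mult-replicate i m la)

  mult-replicate-≢ : ∀ {i j} m la → j ≢ i → mult i (replicate m j ++ la) ≡ mult i la
  mult-replicate-≢ zero la ne = refl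
  mult-replicate-≢ (suc m) la ne rewrite ≡ᵇ-≢ ne = mult-replicate-≢ m la ne

  mult-large : ∀ {i} la → maxPart la < i → mult i la ≡ 0
  mult-large [] l = refl
  mult-large (x ∷ la) l rewrite ≡ᵇ-≢ (<⇒≢ (≤-<-trans (m≤m⊔n x (maxPart la)) l)) = mult-large la (≤-<-trans (m≤n⊔m x (maxPart la)) l)

  Part-maxPart : ∀ {M} la → Part M la → maxPart la ≤ M
  Part-maxPart [] p = z≤n
  Part-maxPart (x ∷ la) (_ , x≤M , q) = ⊔-lub x≤M (≤-trans (Part-maxPart la q) x≤M)

  counts : ℕ → List ℕ → List ℕ
  counts zero la = []
  counts (suc M) la = mult (suc M) la ∷ counts M la

  counts-length : ∀ M la → length (counts M la) ≡ M
  counts-length zero la = refl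
  counts-length (suc M) la = cong suc (counts-length M la)

  -- A left inverse of `part` on lists of given length, hence the injectivity behind `parts-Unique`.
  counts-part : ∀ ms → counts (length ms) (part ms) ≡ ms
  counts-part [] = refl
  counts-part (m ∷ ms) = cong₂ _∷_
    (trans (mult-replicate M m (part ms)) (trans (cong (λ k → m + k) (mult-large (part ms) (s≤s (Part-maxPart (part ms) (part-Part ms))))) (+-identityʳ m)))
    (trans (below (length ms) ≤-refl) (counts-part ms))
    where
    M = suc (length ms)
    below : ∀ N → N ≤ length ms → counts N (replicate m M ++ part ms) ≡ counts N (part ms)
    below zero l = refl
    below (suc N) l = cong₂ _∷_ (mult-replicate-≢ m (part ms) (λ e → <⇒≢ (s≤s l) (sym e))) (below N (≤-trans (n≤1+n N) l))

  Unique-map-∈ : ∀ {A B : Set} (f : A → B) {xs} → (∀ {x y} → x ∈ xs → y ∈ xs → f x ≡ f y → x ≡ y) → Unique xs → Unique (map f xs)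
  Unique-map-∈ f inj [] = []
  Unique-map-∈ f inj (x∉ ∷ u) = All.tabulate (λ m e → go m e) ∷ Unique-map-∈ f (λ p q → inj (there p) (there q)) u
    where
    go : ∀ {y} → y ∈ map f _ → f _ ≡ y → _
    go m e with ∈-map⁻ f m
    ... | z , z∈ , refl = All.lookup x∉ z∈ (inj (here refl) (there z∈) e)

  parts-Unique : ∀ M n → Unique (map part (multiplicities M n))
  parts-Unique M n = Unique-map-∈ part
    (λ {ms} {ms′} p q e → trans (sym (counts-part ms)) (trans (cong₂ counts
       (trans (multiplicities-length M n p) (sym (multiplicities-length M n q))) e) (counts-part ms′)))
    (multiplicities-Unique M n)

  partitions≤ : ℕ → ℕ → List (List ℕ)
  partitions≤ n d = filterB (λ la → length la ≤ᵇ n) (concatMap partitions (upTo (suc d)))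

  ∈-partitions≤⁻ : ∀ n d {la} → la ∈ partitions≤ n d → Part d la × length la ≤ n × sum la ≤ d
  ∈-partitions≤⁻ n d {la} m with ∈-filterB⁻ (λ la → length la ≤ᵇ n) (concatMap partitions (upTo (suc d))) m
  ... | m′ , t with ∈-concatMap⁻ partitions (upTo (suc d)) m′
  ...   | e , e∈ , m″ with partsB-sound e e e m″
  ...     | p , refl = Part-≤ la e≤d p , ≤ᵇ⇒≤ (length la) n t , e≤d
    where
    e≤d : sum la ≤ d
    e≤d = ≤-pred (∈-upTo⁻ e∈)

  -- Two duplicate-free lists with the same members are permutations of each other. Since d ≤ M, no
  -- part of a partition of size at most d exceeds M; the filter discards the larger partitions that
  -- the multiplicities also enumerate.
  partitions≤-↭ : ∀ n d M → d ≤ M → partitions≤ n d ↭ filterB (λ la → sum la ≤ᵇ d) (map part (multiplicities M n))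
  partitions≤-↭ n d M d≤M = ∼bag⇒↭ (unique∧set⇒bag
    (Unique-filterB (λ la → length la ≤ᵇ n) (Unique-concatMap partitions (upTo⁺ (suc d)) (λ e → partsB-Unique e e e)
      (λ {e} {e′} p q → trans (sym (proj₂ (partsB-sound e e e p))) (proj₂ (partsB-sound e′ e′ e′ q)))))
    (Unique-filterB (λ la → sum la ≤ᵇ d) (parts-Unique M n))
    (mk⇔ to from))
    where
    to : ∀ {la} → la ∈ partitions≤ n d → la ∈ filterB (λ la → sum la ≤ᵇ d) (map part (multiplicities M n))
    to {la} m with ∈-partitions≤⁻ n d m
    ... | p , l , s with part-complete M n la (Part-≤ la d≤M p) l
    ...   | ms , ms∈ , refl = ∈-filterB⁺ (λ la → sum la ≤ᵇ d) (∈-map⁺ part ms∈) (≤⇒≤ᵇ s)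
    from : ∀ {la} → la ∈ filterB (λ la → sum la ≤ᵇ d) (map part (multiplicities M n)) → la ∈ partitions≤ n d
    from m with ∈-filterB⁻ (λ la → sum la ≤ᵇ d) (map part (multiplicities M n)) m
    ... | m′ , t with ∈-map⁻ part m′
    ...   | ms , ms∈ , refl = ∈-filterB⁺ (λ la → length la ≤ᵇ n)
      (∈-concatMap⁺ partitions (∈-upTo⁺ (s≤s (≤ᵇ⇒≤ (sum (part ms)) d t)))
        (partsB-complete (sum (part ms)) (sum (part ms)) (part ms) ≤-refl (Part-sum (part ms) (part-Part ms))))
      (≤⇒≤ᵇ (subst (_≤ n) (sym (part-length ms)) (multiplicities-sum M n ms∈)))

-- The variables and the inverses attached to them.

module Points where

  -- These inverses make the differences of the nodes 0, 1, x i and 1/x i invertible. In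
  -- `1-*-inverse` the indices may coincide, which covers 1 - x i ^ 2 and with it 1 - x i; the
  -- diagonal values 1/[ i - i ] are unconstrained.
  record GenericPoint {c ℓ} (K : CommutativeRing c ℓ) : Set (c ⊔ ℓ) where
    open CommutativeRing K
    field
      t : Carrier
      x x⁻¹ : ℕ → Carrier
      1/[_-_] 1/[1-_*_] : ℕ → ℕ → Carrier
      x-inverse : ∀ i → x i * x⁻¹ i ≈ 1#
      ∸-inverse : ∀ {i j} → i ≢ j → (x i - x j) * 1/[ i - j ] ≈ 1#
      1-*-inverse : ∀ i j → (1# - x i * x j) * 1/[1- i * j ] ≈ 1#

open Points using (GenericPoint)

-- The product ⋆ and the removal of one variable from a splitting sum.

module ShuffleAlgebra {c ℓ} (K : CommutativeRing c ℓ) (V : GenericPoint K) where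

  open UniqueLists
  open SumsAndProducts K
  open Interpolation K
  open GenericPoint V
  open import Relation.Binary.Reasoning.Setoid setoid

  x-Apart : ∀ {i j} → i ≢ j → Apart (x i) (x j)
  x-Apart i≢j = 1/[ _ - _ ] , ∸-inverse (λ e → i≢j (≡.sym e))
  χ : ℕ → ℕ → Carrier
  χ i j = (x i - t * x j) * 1/[ i - j ]

  χˡ : ∀ {i j} → i ≢ j → χ i j * (x i - x j) ≈ x i - t * x j
  χˡ ne = trans (solve 3 (λ a d e → a :* d :* e := a :* (e :* d)) refl _ _ _)
    (trans (*-congˡ (∸-inverse ne)) (*-identityʳ _))

  χʳ : ∀ {i j} → j ≢ i → χ i j * (x j - x i) ≈ t * x j - x i
  χʳ {i} {j} ne = begin
    (x i - t * x j) * 1/[ i - j ] * (x j - x i)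
      ≈⟨ solve 4 (λ xi tj d xj → (xi :- tj) :* d :* (xj :- xi) := (tj :- xi) :* ((xi :- xj) :* d)) refl (x i) (t * x j) 1/[ i - j ] (x j) ⟩
    (t * x j - x i) * ((x i - x j) * 1/[ i - j ])
      ≈⟨ trans (*-congˡ (∸-inverse (λ e → ne (≡.sym e)))) (*-identityʳ _) ⟩
    t * x j - x i ∎

  D : List ℕ → List ℕ → Carrier
  D S C = ∏ (λ i → ∏ (χ i) C) S

  D-∷ʳ : ∀ S j C → D S (j ∷ C) ≈ ∏ (λ i → χ i j) S * D S C
  D-∷ʳ S j C = ∏-* _ _ S

  D-↭ : ∀ {S S′ C C′} → S ↭ S′ → C ↭ C′ → D S C ≈ D S′ C′
  D-↭ {S} {S′} {C} s c = trans (∏-↭ _ s) (∏-cong S′ (λ i → ∏-↭ (χ i) c))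

  D-++ˡ : ∀ S S′ C → D (S ++ S′) C ≈ D S C * D S′ C
  D-++ˡ S S′ C = ∏-++ _ S S′

  D-++ʳ : ∀ S C C′ → D S (C ++ C′) ≈ D S C * D S C′
  D-++ʳ S C C′ = trans (∏-cong S (λ i → ∏-++ (χ i) C C′)) (∏-* _ _ S)

  infixr 7 _⋆_
  infix 4 _≐_

  _⋆_ : (List ℕ → Carrier) → (List ℕ → Carrier) → List ℕ → Carrier
  (f ⋆ g) = splitSum (λ S C → f S * g C * D S C)

  -- Only duplicate-free lists of indices are compared, because χ i i involves the unconstrained
  -- 1/[ i - i ].
  _≐_ : (List ℕ → Carrier) → (List ℕ → Carrier) → Set ℓ
  f ≐ g = ∀ xs → Unique xs → f xs ≈ g xs

  ≐-trans : ∀ {f g h} → f ≐ g → g ≐ h → f ≐ h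
  ≐-trans p q xs u = trans (p xs u) (q xs u)

  ≐-sym : ∀ {f g} → f ≐ g → g ≐ f
  ≐-sym p xs u = sym (p xs u)

  ⋆-cong : ∀ {f f′ g g′} → f ≐ f′ → g ≐ g′ → f ⋆ g ≐ f′ ⋆ g′
  ⋆-cong p q xs u = splitSum-cong xs (λ S C r → let w = Unique-++⁻ S (Unique-resp-↭ (↭-sym r) u) in
    *-congʳ (*-cong (p S (proj₁ w)) (q C (proj₂ w))))

  -- `D` is multiplicative in each argument, so both sides are the sum over splittings into three
  -- parts, weighted by `D` for each of the three ordered pairs of parts.
  ⋆-assoc : ∀ f g h → (f ⋆ g) ⋆ h ≐ f ⋆ (g ⋆ h)
  ⋆-assoc f g h xs _ = begin
    splitSum (λ S C → splitSum (λ S₁ S₂ → f S₁ * g S₂ * D S₁ S₂) S * h C * D S C) xs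
      ≈⟨ splitSum-cong′ xs (λ S C → trans (*-assoc _ _ _) (trans (sym (splitSum-*ʳ (h C * D S C) _ S))
           (splitSum-cong S (λ S₁ S₂ p → trans (*-congˡ (*-congˡ (trans (sym (D-↭ {C = C} p ↭-refl)) (D-++ˡ S₁ S₂ C))))
             (solve 6 (λ a b c d e k → a :* b :* c :* (d :* (e :* k)) := a :* b :* d :* c :* e :* k) refl
               (f S₁) (g S₂) (D S₁ S₂) (h C) (D S₁ C) (D S₂ C)))))) ⟩
    splitSum (λ S C → splitSum (λ S₁ S₂ → F S₁ S₂ C) S) xs
      ≈⟨ splitSum-assoc F xs ⟩
    splitSum (λ S₁ R → splitSum (λ S₂ C → F S₁ S₂ C) R) xs
      ≈⟨ splitSum-cong′ xs (λ S₁ R → sym (trans (trans (*-assoc _ _ _) (trans (*-congˡ (*-comm _ _)) (sym (*-assoc _ _ _)))) (trans (sym (splitSum-*ˡ (f S₁ * D S₁ R) _ R))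
           (splitSum-cong R (λ S₂ C p → trans (*-congʳ (*-congˡ (trans (sym (D-↭ (↭-refl {x = S₁}) p)) (D-++ʳ S₁ S₂ C))))
             (solve 6 (λ a c e b d k → a :* (c :* e) :* (b :* d :* k) := a :* b :* d :* c :* e :* k) refl
               (f S₁) (D S₁ S₂) (D S₁ C) (g S₂) (h C) (D S₂ C))))))) ⟩
    splitSum (λ S₁ R → f S₁ * splitSum (λ S₂ C → g S₂ * h C * D S₂ C) R * D S₁ R) xs ∎
    where
    F : List ℕ → List ℕ → List ℕ → Carrier
    F S₁ S₂ C = f S₁ * g S₂ * h C * D S₁ S₂ * D S₁ C * D S₂ C

  infixr 8 _·_
  _·_ : (List ℕ → Carrier) → (List ℕ → Carrier) → List ℕ → Carrier
  (f · g) xs = f xs * g xs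

  -- A multiplicative function contributes the same factor `∏ φ xs` to every splitting.
  ∏-·-⋆ : ∀ φ f g → (∏ φ · f) ⋆ (∏ φ · g) ≐ ∏ φ · (f ⋆ g)
  ∏-·-⋆ φ f g xs _ = trans
    (splitSum-cong xs (λ S C p → trans
      (solve 5 (λ a b c d e → a :* b :* (c :* d) :* e := a :* c :* (b :* d :* e)) refl (∏ φ S) (f S) (∏ φ C) (g C) (D S C))
      (*-congʳ (trans (sym (∏-++ φ S C)) (∏-↭ φ p)))))
    (splitSum-*ˡ (∏ φ xs) _ xs)

  -- Splitting off one variable Z from a sum over splittings of Z ∷ xs, after clearing the denominators Z - x i.
  module _ (α β : List ℕ → List ℕ → Carrier → Carrier) where

    residueTerm : Carrier → List ℕ → List ℕ → Carrier
    residueTerm Z S C = D S C *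
      ( α S C Z * (∏ (λ i → t * Z - x i) S * ∏ (λ i → Z - x i) C)
      + β S C Z * (∏ (λ i → Z - t * x i) C * ∏ (λ i → Z - x i) S))

    cleared : List ℕ → Carrier → Carrier
    cleared xs Z = splitSum (residueTerm Z) xs

    cleared-∷ : ∀ (h : List ℕ → List ℕ → Carrier) (Q : Carrier) {z xs} → All (z ≢_) xs →
      (∀ S C → S ++ C ↭ xs → h (z ∷ S) C * Q ≈ β S C (x z)) →
      (∀ S C → S ++ C ↭ xs → h S (z ∷ C) * Q ≈ α S C (x z)) →
      splitSum (λ S C → h S C * D S C) (z ∷ xs) * (Q * ∏ (λ i → x z - x i) xs) ≈ cleared xs (x z)
    cleared-∷ h Q {z} {xs} z∉ hβ hα = begin
      (splitSum f₁ xs + splitSum f₂ xs) * R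
        ≈⟨ *-congʳ (sym (splitSum-+ f₁ f₂ xs)) ⟩
      splitSum (λ S C → f₁ S C + f₂ S C) xs * R
        ≈⟨ sym (splitSum-*ʳ R _ xs) ⟩
      splitSum (λ S C → (f₁ S C + f₂ S C) * R) xs
        ≈⟨ splitSum-cong xs term ⟩
      cleared xs (x z) ∎
      where
      f₁ f₂ : List ℕ → List ℕ → Carrier
      f₁ S C = h (z ∷ S) C * D (z ∷ S) C
      f₂ S C = h S (z ∷ C) * D S (z ∷ C)
      P : List ℕ → Carrier
      P = ∏ (λ i → x z - x i)
      R = Q * P xs
      ∈xs : ∀ {i} → i ∈ xs → z ≢ i
      ∈xs = All.lookup z∉
      term : ∀ S C → S ++ C ↭ xs → (f₁ S C + f₂ S C) * R ≈ residueTerm (x z) S C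
      term S C p = begin
        (h₁ * (∏ (χ z) C * D S C) + h₂ * D S (z ∷ C)) * (Q * P xs)
          ≈⟨ *-cong (+-congˡ (*-congˡ (D-∷ʳ S z C))) (*-congˡ (trans (sym (∏-↭ _ p)) (∏-++ _ S C))) ⟩
        (h₁ * (∏ (χ z) C * D S C) + h₂ * (∏ (λ i → χ i z) S * D S C)) * (Q * (P S * P C))
          ≈⟨ solve 8 (λ h₁ χC d h₂ χS q ps pc →
               (h₁ :* (χC :* d) :+ h₂ :* (χS :* d)) :* (q :* (ps :* pc))
               := d :* ((h₂ :* q) :* ((χS :* ps) :* pc) :+ (h₁ :* q) :* ((χC :* pc) :* ps)))
             refl h₁ (∏ (χ z) C) (D S C) h₂ (∏ (λ i → χ i z) S) Q (P S) (P C) ⟩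
        D S C * ((h₂ * Q) * ((∏ (λ i → χ i z) S * P S) * P C) + (h₁ * Q) * ((∏ (χ z) C * P C) * P S))
          ≈⟨ *-congˡ (+-cong
               (*-cong (hα S C p) (*-congʳ (trans (sym (∏-* _ _ S)) (∏-cong∈ S (λ m → χʳ (∈xs (∈-resp-↭ p (∈-++⁺ˡ m))))))))
               (*-cong (hβ S C p) (*-congʳ (trans (sym (∏-* _ _ C)) (∏-cong∈ C (λ m → χˡ (∈xs (∈-resp-↭ p (∈-++⁺ʳ S m))))))))) ⟩
        residueTerm (x z) S C ∎
        where
        h₁ = h (z ∷ S) C
        h₂ = h S (z ∷ C)

    module _ (α-↭ : ∀ Z → Invariant₂ (λ S C → α S C Z)) (β-↭ : ∀ Z → Invariant₂ (λ S C → β S C Z)) where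

      residueTerm-↭ : ∀ Z → Invariant₂ (residueTerm Z)
      residueTerm-↭ Z s c = *-cong (D-↭ s c) (+-cong
        (*-cong (α-↭ Z s c) (*-cong (∏-↭ _ s) (∏-↭ _ c)))
        (*-cong (β-↭ Z s c) (*-cong (∏-↭ _ c) (∏-↭ _ s))))

      -- the two simple poles at Z = x y cancel
      cleared-root : ∀ {y xs} → Unique xs → y ∈ xs →
        (∀ S C → α (y ∷ S) C (x y) ≈ β S (y ∷ C) (x y)) → cleared xs (x y) ≈ 0#
      cleared-root {y} {xs} u m αβ = begin
        cleared xs (x y) ≈⟨ splitSum-↭ (residueTerm-↭ (x y)) xs↭ ⟩
        splitSum f₁ ys + splitSum f₂ ys ≈⟨ sym (splitSum-+ f₁ f₂ ys) ⟩
        splitSum (λ S C → f₁ S C + f₂ S C) ys ≈⟨ splitSum-cong ys cancel ⟩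
        splitSum (λ _ _ → 0#) ys ≈⟨ splitSum-0 ys ⟩
        0# ∎
        where
        ys = proj₁ (∈⇒↭ m)
        xs↭ : xs ↭ y ∷ ys
        xs↭ = proj₂ (∈⇒↭ m)
        y∉ : All (y ≢_) ys
        y∉ = AllPairs.head (Unique-resp-↭ xs↭ u)
        f₁ f₂ : List ℕ → List ℕ → Carrier
        f₁ S C = residueTerm (x y) (y ∷ S) C
        f₂ S C = residueTerm (x y) S (y ∷ C)
        cancel : ∀ S C → S ++ C ↭ ys → f₁ S C + f₂ S C ≈ 0#
        cancel S C p = begin
          f₁ S C + f₂ S C
            ≈⟨ +-cong
              (*-congˡ (trans (+-congˡ (*-congˡ (*-congˡ (trans (*-congʳ (-‿inverseʳ _)) (zeroˡ _))))) (+-congʳ (*-congʳ (αβ S C)))))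
              (*-cong (D-∷ʳ S y C) (+-congʳ (*-congˡ (*-congˡ (trans (*-congʳ (-‿inverseʳ _)) (zeroˡ _)))))) ⟩
          (∏ (χ y) C * D S C) * (B * (((t * x y - x y) * tS) * PC) + β (y ∷ S) C (x y) * (tC * 0#))
            + (∏ (λ i → χ i y) S * D S C) * (α S (y ∷ C) (x y) * (tS * 0#) + B * (((x y - t * x y) * tC) * PS))
            ≈⟨ solve 12 (λ χC d b t xy tS PC b′ tC χS a PS →
                 (χC :* d) :* (b :* (((t :* xy :- xy) :* tS) :* PC) :+ b′ :* (tC :* con (+ 0)))
                   :+ (χS :* d) :* (a :* (tS :* con (+ 0)) :+ b :* (((xy :- t :* xy) :* tC) :* PS))
                 := d :* b :* (t :* xy :- xy) :* ((χC :* PC) :* tS :- (χS :* PS) :* tC))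
               refl (∏ (χ y) C) (D S C) B t (x y) tS PC _ tC (∏ (λ i → χ i y) S) _ PS ⟩
          D S C * B * (t * x y - x y) * ((∏ (χ y) C * PC) * tS - (∏ (λ i → χ i y) S * PS) * tC)
            ≈⟨ *-congˡ (+-cong (*-congʳ eC) (-‿cong (*-congʳ eS))) ⟩
          D S C * B * (t * x y - x y) * (tC * tS - tS * tC)
            ≈⟨ solve 3 (λ a b c → a :* (b :* c :- c :* b) := con (+ 0)) refl _ _ _ ⟩
          0# ∎
          where
          B = β S (y ∷ C) (x y)
          tS = ∏ (λ i → t * x y - x i) S
          PS = ∏ (λ i → x y - x i) S
          tC = ∏ (λ i → x y - t * x i) C
          PC = ∏ (λ i → x y - x i) C
          y≢ : ∀ {i} → i ∈ S ++ C → y ≢ i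
          y≢ m = All.lookup y∉ (∈-resp-↭ p m)
          eC : ∏ (χ y) C * PC ≈ tC
          eC = trans (sym (∏-* _ _ C)) (∏-cong∈ C (λ m → χˡ (y≢ (∈-++⁺ʳ S m))))
          eS : ∏ (λ i → χ i y) S * PS ≈ tS
          eS = trans (sym (∏-* _ _ S)) (∏-cong∈ S (λ m → χʳ (y≢ (∈-++⁺ˡ m))))

-- The t-binomial evaluation and the rule [ux] ⋆ [1] = [1 + ux].

module ShuffleIdentities {c ℓ} (K : CommutativeRing c ℓ) (V : GenericPoint K) where

  open UniqueLists
  open SumsAndProducts K
  open Interpolation K
  open ShuffleAlgebra K V
  open GenericPoint V
  open import Relation.Binary.Reasoning.Setoid setoid

  affine-Z- : ∀ a → Affine (λ Z → Z - a)
  affine-Z- a = - a , 1# , λ Z → solve 2 (λ Z a → Z :- a := :- a :+ con (+ 1) :* Z) refl Z a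

  affine-tZ- : ∀ a → Affine (λ Z → t * Z - a)
  affine-tZ- a = - a , t , λ Z → solve 3 (λ Z a t → t :* Z :- a := :- a :+ t :* Z) refl Z a t

  affine-1-Z : ∀ a → Affine (λ Z → 1# - Z * a)
  affine-1-Z a = 1# , - a , λ Z → solve 2 (λ Z a → con (+ 1) :- Z :* a := con (+ 1) :+ (:- a) :* Z) refl Z a

  affine-1-tZ : ∀ a → Affine (λ Z → 1# - t * (Z * a))
  affine-1-tZ a = 1# , - (t * a) , λ Z → solve 3 (λ Z a t → con (+ 1) :- t :* (Z :* a) := con (+ 1) :+ (:- (t :* a)) :* Z) refl Z a t

  -- In either summand each index of xs contributes exactly one linear factor, whichever side it is
  -- on.
  PolyFn-cleared : ∀ k {α β} xs →
    (∀ S C → length S ℕ.+ length C ≡ length xs → PolyFn k (α S C) × PolyFn k (β S C)) →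
    PolyFn (length xs ℕ.+ k) (cleared α β xs)
  PolyFn-cleared k {α} {β} xs p = PolyFn-splitSum (length xs ℕ.+ k) (λ S C Z → residueTerm α β Z S C) xs term
    where
    term : ∀ S C → length S ℕ.+ length C ≡ length xs → PolyFn (length xs ℕ.+ k) (λ Z → residueTerm α β Z S C)
    term S C e = PolyFn-scale (length xs ℕ.+ k) (D S C) (PolyFn-+ (length xs ℕ.+ k)
      (≡.subst (λ n → PolyFn n (λ Z → α S C Z * (∏ (λ i → t * Z - x i) S * ∏ (λ i → Z - x i) C)))
        (≡.trans (≡.sym (ℕₚ.+-assoc (length S) (length C) k)) (≡.cong (ℕ._+ k) e))
        (PolyFn-resp (length S ℕ.+ (length C ℕ.+ k)) (λ Z → trans (sym (*-assoc _ _ _)) (*-comm _ _))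
          (PolyFn-∏ (length C ℕ.+ k) (λ i Z → t * Z - x i) (λ i → affine-tZ- (x i)) S
            (PolyFn-∏ k (λ i Z → Z - x i) (λ i → affine-Z- (x i)) C (proj₁ (p S C e))))))
      (≡.subst (λ n → PolyFn n (λ Z → β S C Z * (∏ (λ i → Z - t * x i) C * ∏ (λ i → Z - x i) S)))
        (≡.trans (≡.trans (≡.sym (ℕₚ.+-assoc (length C) (length S) k)) (≡.cong (ℕ._+ k) (ℕₚ.+-comm (length C) (length S)))) (≡.cong (ℕ._+ k) e))
        (PolyFn-resp (length C ℕ.+ (length S ℕ.+ k)) (λ Z → trans (sym (*-assoc _ _ _)) (*-comm _ _))
          (PolyFn-∏ (length S ℕ.+ k) (λ i Z → Z - t * x i) (λ i → affine-Z- (t * x i)) C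
            (PolyFn-∏ k (λ i Z → Z - x i) (λ i → affine-Z- (x i)) S (proj₂ (p S C e)))))))

  x-inv : ∀ i → Invertible (x i)
  x-inv i = x⁻¹ i , x-inverse i

  x⁻¹-inv : ∀ i → Invertible (x⁻¹ i)
  x⁻¹-inv i = x i , trans (*-comm _ _) (x-inverse i)

  Apart-0 : ∀ {a} → Invertible a → Apart 0# a
  Apart-0 = Invertible-resp (solve 1 (λ a → a := a :- con (+ 0)) refl _)

  Apart-x : ∀ {xs} → Unique xs → AllPairs Apart (map x xs)
  Apart-x u = AllPairs.map⁺ (AllPairs.map x-Apart u)

  ∏Z-inv : ∀ {z xs} → All (z ≢_) xs → Invertible (∏ (λ i → x z - x i) xs)
  ∏Z-inv z∉ = Invertible-∏ _ (All.map (λ ne → x-Apart (λ e → ne (≡.sym e))) z∉)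

  x-y≈0⇒x≈y : ∀ {a b} → a - b ≈ 0# → a ≈ b
  x-y≈0⇒x≈y {a} {b} e = begin
    a ≈⟨ solve 2 (λ a b → a := (a :- b) :+ b) refl a b ⟩
    (a - b) + b ≈⟨ +-congʳ e ⟩
    0# + b ≈⟨ +-identityˡ b ⟩
    b ∎

  x≈y⇒x-y≈0 : ∀ {a b} → a ≈ b → a - b ≈ 0#
  x≈y⇒x-y≈0 {a} {b} e = trans (+-congʳ e) (-‿inverseʳ b)

  -- gauss w n = Σ_k [n choose k]_t w(k), by the t-Pascal rule
  gauss : (ℕ → Carrier) → ℕ → Carrier
  gauss w zero = w 0
  gauss w (suc n) = gauss (w ∘ suc) n + gauss (λ k → t ^ k * w k) n

  -- Multiplied by ∏ (Z - x i), both sides have degree at most n in the first variable Z and agree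
  -- at the n + 1 nodes 0 and x i: both vanish at x i, and Z = 0 reproduces the Pascal rule of
  -- `gauss`. In particular the sum does not depend on the x i.
  splitSum-gauss : ∀ w xs → Unique xs → splitSum (λ S C → w (length C) * D S C) xs ≈ gauss w (length xs)
  splitSum-gauss w [] _ = *-identityʳ _
  splitSum-gauss w (z ∷ xs) (z∉ ∷ u) = *-cancelˡ (∏Z-inv z∉) (begin
    P (x z) * splitSum (λ S C → w (length C) * D S C) (z ∷ xs)
      ≈⟨ trans (*-comm _ _) (*-congˡ (sym (*-identityˡ _))) ⟩
    splitSum (λ S C → w (length C) * D S C) (z ∷ xs) * (1# * P (x z))
      ≈⟨ cleared-∷ α β (λ S C → w (length C)) 1# z∉ (λ S C _ → *-identityʳ _) (λ S C _ → *-identityʳ _) ⟩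
    cleared α β xs (x z)
      ≈⟨ x-y≈0⇒x≈y (PolyFn-roots n f-poly (0# ∷ map x xs) (≡.cong suc (length-map x xs))
           (All.map⁺ (All.universal (λ i → Apart-0 (x-inv i)) xs) ∷ Apart-x u)
           (root-0 ∷ All.map⁺ (All.tabulate root-x)) (x z)) ⟩
    P (x z) * G ∎)
    where
    n = length xs
    G = gauss w (suc n)
    P : Carrier → Carrier
    P Z = ∏ (λ i → Z - x i) xs
    α β : List ℕ → List ℕ → Carrier → Carrier
    α S C Z = w (suc (length C))
    β S C Z = w (length C)
    f : Carrier → Carrier
    f Z = cleared α β xs Z - P Z * G
    f-poly : PolyFn n f
    f-poly = ≡.subst (λ k → PolyFn k f) (ℕₚ.+-identityʳ n) (PolyFn-+ (n ℕ.+ 0)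
      (PolyFn-cleared 0 xs (λ S C _ → PolyFn-const 0 _ , PolyFn-const 0 _))
      (PolyFn-resp (n ℕ.+ 0) (λ Z → solve 2 (λ p g → p :* (:- g) := :- (p :* g)) refl (P Z) G)
        (PolyFn-∏ 0 (λ i Z → Z - x i) (λ i → affine-Z- (x i)) xs (PolyFn-const 0 (- G)))))
    root-x : ∀ {y} → y ∈ xs → f (x y) ≈ 0#
    root-x {y} m = x≈y⇒x-y≈0 (trans
      (cleared-root α β (λ Z s c → reflexive (≡.cong (w ∘ suc) (↭-length c))) (λ Z s c → reflexive (≡.cong w (↭-length c)))
        u m (λ S C → refl))
      (sym (trans (*-congʳ (∏-zero _ m (-‿inverseʳ _))) (zeroˡ _))))
    root-0 : f 0# ≈ 0#
    root-0 = x≈y⇒x-y≈0 (begin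
      cleared α β xs 0#
        ≈⟨ splitSum-cong xs term ⟩
      splitSum (λ S C → P 0# * (w (suc (length C)) * D S C + t ^ length C * w (length C) * D S C)) xs
        ≈⟨ trans (splitSum-*ˡ _ _ xs) (*-congˡ (trans (splitSum-+ _ _ xs) (+-cong (splitSum-gauss (w ∘ suc) xs u) (splitSum-gauss (λ k → t ^ k * w k) xs u)))) ⟩
      P 0# * G ∎)
      where
      term : ∀ S C → S ++ C ↭ xs → residueTerm α β 0# S C ≈ P 0# * (w (suc (length C)) * D S C + t ^ length C * w (length C) * D S C)
      term S C p = begin
        D S C * (w₁ * (∏ (λ i → t * 0# - x i) S * PC) + w₀ * (∏ (λ i → 0# - t * x i) C * PS))
          ≈⟨ *-congˡ (+-cong
               (*-congˡ (*-congʳ (∏-cong S (λ i → solve 2 (λ t a → t :* con (+ 0) :- a := con (+ 0) :- a) refl t (x i)))))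
               (*-congˡ (*-congʳ (trans (∏-cong C (λ i → solve 2 (λ t a → con (+ 0) :- t :* a := t :* (con (+ 0) :- a)) refl t (x i)))
                 (trans (∏-* _ _ C) (*-congʳ (∏-const t C))))))) ⟩
        D S C * (w₁ * (PS * PC) + w₀ * ((t ^ length C * PC) * PS))
          ≈⟨ solve 6 (λ d w₁ PS PC w₀ tc → d :* (w₁ :* (PS :* PC) :+ w₀ :* ((tc :* PC) :* PS)) := (PS :* PC) :* (w₁ :* d :+ tc :* w₀ :* d))
               refl (D S C) w₁ PS PC w₀ (t ^ length C) ⟩
        (PS * PC) * (w₁ * D S C + t ^ length C * w₀ * D S C)
          ≈⟨ *-congʳ (trans (sym (∏-++ _ S C)) (∏-↭ _ p)) ⟩
        P 0# * (w₁ * D S C + t ^ length C * w₀ * D S C) ∎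
        where
        w₁ = w (suc (length C))
        w₀ = w (length C)
        PS = ∏ (λ i → 0# - x i) S
        PC = ∏ (λ i → 0# - x i) C
  module _ (u : Carrier) where

    private
      m : List ℕ → Carrier
      m = ∏ (λ i → u * x i)
      α β : List ℕ → List ℕ → Carrier → Carrier
      α S C Z = m S
      β S C Z = u * Z * m S
      m-↭ : ∀ {S S′} → S ↭ S′ → m S ≈ m S′
      m-↭ = ∏-↭ _

    -- The nodes are again 0 and the x i. Now β carries a factor Z, so `PolyFn-cleared` would only
    -- bound the degree by n + 1, one too many for n + 1 nodes; the bound n comes from cancellation
    -- against the subtracted right side.
    splitSum-elementary : ∀ xs → Unique xs → splitSum (λ S C → m S * D S C) xs ≈ ∏ (λ i → 1# + u * x i) xs
    splitSum-elementary [] _ = *-identityʳ _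
    splitSum-elementary (z ∷ xs) (z∉ ∷ un) = *-cancelˡ (∏Z-inv z∉) (begin
      P (x z) * splitSum (λ S C → m S * D S C) (z ∷ xs)
        ≈⟨ trans (*-comm _ _) (*-congˡ (sym (*-identityˡ _))) ⟩
      splitSum (λ S C → m S * D S C) (z ∷ xs) * (1# * P (x z))
        ≈⟨ cleared-∷ α β (λ S C → m S) 1# z∉ (λ S C _ → *-identityʳ _) (λ S C _ → *-identityʳ _) ⟩
      cleared α β xs (x z)
        ≈⟨ x-y≈0⇒x≈y (PolyFn-roots n f-poly (0# ∷ map x xs) (≡.cong suc (length-map x xs))
             (All.map⁺ (All.universal (λ i → Apart-0 (x-inv i)) xs) ∷ Apart-x un)
             (root-0 ∷ All.map⁺ (All.tabulate root-x)) (x z)) ⟩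
      P (x z) * ((1# + u * x z) * E) ∎)
      where
      n = length xs
      E = ∏ (λ i → 1# + u * x i) xs
      E-sum : splitSum (λ S C → m S * D S C) xs ≈ E
      E-sum = splitSum-elementary xs un
      P : Carrier → Carrier
      P Z = ∏ (λ i → Z - x i) xs
      A B T : List ℕ → Carrier → Carrier
      A S Z = ∏ (λ i → t * Z - x i) S
      B S Z = ∏ (λ i → Z - x i) S
      T S Z = ∏ (λ i → Z - t * x i) S
      f : Carrier → Carrier
      f Z = cleared α β xs Z - P Z * ((1# + u * Z) * E)

      -- The leading terms of T and B agree, which keeps the degree of f at most n.
      drop-poly : ∀ C → PolyFn (length C) (λ Z → Z * (T C Z - B C Z))
      drop-poly [] = PolyFn-resp 0 (λ Z → solve 1 (λ z → con (+ 0) := z :* (con (+ 1) :- con (+ 1))) refl Z) (PolyFn-const 0 0#)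
      drop-poly (y ∷ C) = PolyFn-resp (suc (length C))
        (λ Z → solve 5 (λ Z y t T B → (Z :- y) :* (Z :* (T :- B)) :+ T :* ((con (+ 0) :+ (y :- t :* y) :* Z) :* con (+ 1))
                                    := Z :* ((Z :- t :* y) :* T :- (Z :- y) :* B)) refl Z (x y) t (T C Z) (B C Z))
        (PolyFn-+ (suc (length C)) (PolyFn-affine (length C) (affine-Z- (x y)) (drop-poly C))
          (≡.subst (λ k → PolyFn k (λ Z → T C Z * ((0# + (x y - t * x y) * Z) * 1#))) (ℕₚ.+-comm (length C) 1)
            (PolyFn-∏ 1 (λ i Z → Z - t * x i) (λ i → affine-Z- (t * x i)) C
              (PolyFn-linear 0 0# (x y - t * x y) (PolyFn-const 0 1#)))))

      -- `E` is expanded by the induction hypothesis, which spreads the subtracted term over the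
      -- splittings and lets the terms of degree n + 1 cancel within each of them.
      piece : List ℕ → List ℕ → Carrier → Carrier
      piece S C Z = D S C * m S * ((A S Z * B C Z + - (B S Z * B C Z)) + u * (B S Z * (Z * (T C Z - B C Z))))
      piece-poly : ∀ S C → length S ℕ.+ length C ≡ n → PolyFn n (piece S C)
      piece-poly S C e = PolyFn-scale n _ (PolyFn-+ n (PolyFn-+ n
        (≡.subst (λ k → PolyFn k (λ Z → A S Z * B C Z)) (≡.trans (≡.cong (length S ℕ.+_) (ℕₚ.+-identityʳ _)) e)
          (PolyFn-∏ _ (λ i Z → t * Z - x i) (λ i → affine-tZ- (x i)) S B-poly))
        (PolyFn-resp n (λ Z → solve 1 (λ a → (:- con (+ 1)) :* a := :- a) refl _) (PolyFn-scale n (- 1#)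
          (≡.subst (λ k → PolyFn k (λ Z → B S Z * B C Z)) (≡.trans (≡.cong (length S ℕ.+_) (ℕₚ.+-identityʳ _)) e)
            (PolyFn-∏ _ (λ i Z → Z - x i) (λ i → affine-Z- (x i)) S B-poly)))))
        (PolyFn-scale n u (≡.subst (λ k → PolyFn k (λ Z → B S Z * (Z * (T C Z - B C Z)))) e
          (PolyFn-∏ _ (λ i Z → Z - x i) (λ i → affine-Z- (x i)) S (drop-poly C)))))
        where
        B-poly : PolyFn (length C ℕ.+ 0) (B C)
        B-poly = PolyFn-resp (length C ℕ.+ 0) (λ Z → *-identityʳ _)
          (PolyFn-∏ 0 (λ i Z → Z - x i) (λ i → affine-Z- (x i)) C (PolyFn-const 0 1#))

      f≈ : ∀ Z → splitSum (λ S C → piece S C Z) xs ≈ f Z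
      f≈ Z = begin
        splitSum (λ S C → piece S C Z) xs
          ≈⟨ splitSum-cong xs (λ S C p → trans
               (solve 9 (λ d m A BC BS u Z T e →
                   d :* m :* ((A :* BC :+ :- (BS :* BC)) :+ u :* (BS :* (Z :* (T :- BC))))
                   := d :* (m :* (A :* BC) :+ u :* Z :* m :* (T :* BS)) :+ (:- (BS :* BC)) :* ((con (+ 1) :+ u :* Z) :* (m :* d)))
                 refl (D S C) (m S) (A S Z) (B C Z) (B S Z) u Z (T C Z) 0#)
               (+-congˡ (*-congʳ (-‿cong (trans (sym (∏-++ _ S C)) (∏-↭ _ p)))))) ⟩
        splitSum (λ S C → residueTerm α β Z S C + - P Z * ((1# + u * Z) * (m S * D S C))) xs
          ≈⟨ trans (splitSum-+ _ _ xs) (+-congˡ (trans (splitSum-*ˡ _ _ xs) (*-congˡ (trans (splitSum-*ˡ _ _ xs) (*-congˡ E-sum))))) ⟩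
        cleared α β xs Z + - P Z * ((1# + u * Z) * E)
          ≈⟨ +-congˡ (solve 2 (λ a b → (:- a) :* b := :- (a :* b)) refl _ _) ⟩
        f Z ∎
      f-poly : PolyFn n f
      f-poly = PolyFn-resp n f≈ (PolyFn-splitSum n piece xs piece-poly)
      root-x : ∀ {y} → y ∈ xs → f (x y) ≈ 0#
      root-x {y} mem = x≈y⇒x-y≈0 (trans
        (cleared-root α β (λ Z s c → m-↭ s) (λ Z s c → *-congˡ (m-↭ s)) un mem (λ S C → refl))
        (sym (trans (*-congʳ (∏-zero _ mem (-‿inverseʳ _))) (zeroˡ _))))
      root-0 : f 0# ≈ 0#
      root-0 = x≈y⇒x-y≈0 (begin
        cleared α β xs 0#
          ≈⟨ splitSum-cong xs (λ S C p → trans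
               (*-congˡ (+-congʳ (*-congˡ (*-congʳ (∏-cong S (λ i → solve 2 (λ t a → t :* con (+ 0) :- a := con (+ 0) :- a) refl t (x i)))))))
               (trans (solve 6 (λ d m BS BC u T → d :* (m :* (BS :* BC) :+ u :* con (+ 0) :* m :* (T :* BS)) := (BS :* BC) :* (m :* d))
                 refl (D S C) (m S) (B S 0#) (B C 0#) u (T C 0#))
               (*-congʳ (trans (sym (∏-++ _ S C)) (∏-↭ _ p))))) ⟩
        splitSum (λ S C → P 0# * (m S * D S C)) xs
          ≈⟨ trans (splitSum-*ˡ _ _ xs) (*-congˡ E-sum) ⟩
        P 0# * E
          ≈⟨ *-congˡ (solve 2 (λ u e → e := (con (+ 1) :+ u :* con (+ 0)) :* e) refl u E) ⟩
        P 0# * ((1# + u * 0#) * E) ∎)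

-- The fixed point equation for Ψ.

module Littlewood {c ℓ} (K : CommutativeRing c ℓ) (V : GenericPoint K) where

  open UniqueLists
  open SumsAndProducts K
  open Interpolation K
  open ShuffleAlgebra K V
  open ShuffleIdentities K V
  open GenericPoint V
  open import Relation.Binary.Reasoning.Setoid setoid

  ρ : ℕ → ℕ → Carrier
  ρ i j = (1# - t * (x i * x j)) * 1/[1- i * j ]

  1-*-invertible : ∀ i j → Invertible (1# - x i * x j)
  1-*-invertible i j = 1/[1- i * j ] , 1-*-inverse i j

  1-x-invertible : ∀ i → Invertible (1# - x i)
  1-x-invertible i = Invertible-factor (Invertible-resp
    (solve 1 (λ a → con (+ 1) :- a :* a := (con (+ 1) :- a) :* (con (+ 1) :+ a)) refl (x i)) (1-*-invertible i i))

  ρ-* : ∀ i j → ρ i j * (1# - x i * x j) ≈ 1# - t * (x i * x j)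
  ρ-* i j = trans (solve 3 (λ a b c → a :* b :* c := a :* (c :* b)) refl _ _ _)
    (trans (*-congˡ (1-*-inverse i j)) (*-identityʳ _))

  ρ-sym : ∀ i j → ρ i j ≈ ρ j i
  ρ-sym i j = *-cancelˡ (1-*-invertible i j) (begin
    (1# - x i * x j) * ρ i j ≈⟨ *-comm _ _ ⟩
    ρ i j * (1# - x i * x j) ≈⟨ ρ-* i j ⟩
    1# - t * (x i * x j) ≈⟨ solve 3 (λ t a b → con (+ 1) :- t :* (a :* b) := con (+ 1) :- t :* (b :* a)) refl t (x i) (x j) ⟩
    1# - t * (x j * x i) ≈⟨ sym (ρ-* j i) ⟩
    ρ j i * (1# - x j * x i) ≈⟨ solve 3 (λ r a b → r :* (con (+ 1) :- b :* a) := (con (+ 1) :- a :* b) :* r) refl (ρ j i) (x i) (x j) ⟩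
    (1# - x i * x j) * ρ j i ∎)

  Ψ : List ℕ → Carrier
  Ψ [] = 1#
  Ψ (i ∷ is) = ∏ (ρ i) is * Ψ is

  Ψ-↭ : ∀ {xs ys} → xs ↭ ys → Ψ xs ≈ Ψ ys
  Ψ-↭ Perm.refl = refl
  Ψ-↭ (Perm.prep i p) = *-cong (∏-↭ _ p) (Ψ-↭ p)
  Ψ-↭ (Perm.swap {ys = ys} i j p) = trans
    (*-cong (*-cong (ρ-sym i j) (∏-↭ _ p)) (*-cong (∏-↭ _ p) (Ψ-↭ p)))
    (solve 4 (λ r a b c → r :* a :* (b :* c) := r :* b :* (a :* c)) refl (ρ j i) (∏ (ρ i) ys) (∏ (ρ j) ys) (Ψ ys))
  Ψ-↭ (Perm.trans p q) = trans (Ψ-↭ p) (Ψ-↭ q)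

  private
    m : List ℕ → List ℕ → Carrier
    m S C = ∏ x S * Ψ S * ∏ (λ i → 1# - x i) C

    m-↭ : Invariant₂ m
    m-↭ s c = *-cong (*-cong (∏-↭ _ s) (Ψ-↭ s)) (∏-↭ _ c)

    U W : Carrier → List ℕ → Carrier
    U Z = ∏ (λ i → 1# - Z * x i)
    W Z = ∏ (λ i → 1# - t * (Z * x i))

    -- These are `m` with Z added to the right or to the left part, multiplied by `U Z xs`; on the
    -- left this turns the factors ρ between Z and S into `W Z S`.
    α β : List ℕ → List ℕ → Carrier → Carrier
    α S C Z = (1# - Z) * (m S C * (U Z S * U Z C))
    β S C Z = Z * (m S C * (W Z S * U Z C))

    α-↭ : ∀ Z → Invariant₂ (λ S C → α S C Z)
    α-↭ Z s c = *-congˡ (*-cong (m-↭ s c) (*-cong (∏-↭ _ s) (∏-↭ _ c)))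
    β-↭ : ∀ Z → Invariant₂ (λ S C → β S C Z)
    β-↭ Z s c = *-congˡ (*-cong (m-↭ s c) (*-cong (∏-↭ _ s) (∏-↭ _ c)))

    ∏ρ-U : ∀ y S → ∏ (ρ y) S * U (x y) S ≈ W (x y) S
    ∏ρ-U y S = trans (sym (∏-* _ _ S)) (∏-cong S (λ i → ρ-* y i))

    target : List ℕ → Carrier → Carrier
    target xs Z = ∏ (λ i → 1# - t * (Z * x i)) xs * (∏ (λ i → Z - x i) xs * Ψ xs)

    f : List ℕ → Carrier → Carrier
    f xs Z = cleared α β xs Z - target xs Z

    -- α and β have degree n + 1 and clearing adds n, so the total is 2n + 1 and 2n + 2 nodes are
    -- required.
    f-poly : ∀ xs → PolyFn (length xs ℕ.+ suc (length xs)) (f xs)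
    f-poly xs = PolyFn-+ (n ℕ.+ suc n)
      (PolyFn-cleared (suc n) xs (λ S C e →
        PolyFn-affine n (- (- 1#) , - 1# , λ Z → solve 1 (λ z → con (+ 1) :- z := :- (:- con (+ 1)) :+ (:- con (+ 1)) :* z) refl Z)
          (PolyFn-scale n (m S C) (≡.subst (λ k → PolyFn k (λ Z → U Z S * U Z C)) (≡.trans (≡.cong (length S ℕ.+_) (ℕₚ.+-identityʳ _)) e)
            (PolyFn-∏ (length C ℕ.+ 0) (λ i Z → 1# - Z * x i) (λ i → affine-1-Z (x i)) S (U-poly C)))) ,
        PolyFn-affine n (0# , 1# , λ Z → solve 1 (λ z → z := con (+ 0) :+ con (+ 1) :* z) refl Z)
          (PolyFn-scale n (m S C) (≡.subst (λ k → PolyFn k (λ Z → W Z S * U Z C)) (≡.trans (≡.cong (length S ℕ.+_) (ℕₚ.+-identityʳ _)) e)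
            (PolyFn-∏ (length C ℕ.+ 0) (λ i Z → 1# - t * (Z * x i)) (λ i → affine-1-tZ (x i)) S (U-poly C))))))
      (PolyFn-resp (n ℕ.+ suc n) (λ Z → solve 3 (λ a b p → a :* (b :* (:- p)) := :- (a :* (b :* p))) refl _ _ _)
        (PolyFn-∏ (suc n) (λ i Z → 1# - t * (Z * x i)) (λ i → affine-1-tZ (x i)) xs
          (≡.subst (λ k → PolyFn k (λ Z → ∏ (λ i → Z - x i) xs * - Ψ xs)) (ℕₚ.+-comm n 1)
            (PolyFn-∏ 1 (λ i Z → Z - x i) (λ i → affine-Z- (x i)) xs (PolyFn-const 1 (- Ψ xs))))))
      where
      n = length xs
      U-poly : ∀ C → PolyFn (length C ℕ.+ 0) (λ Z → U Z C)
      U-poly C = PolyFn-resp (length C ℕ.+ 0) (λ Z → *-identityʳ _)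
        (PolyFn-∏ 0 (λ i Z → 1# - Z * x i) (λ i → affine-1-Z (x i)) C (PolyFn-const 0 1#))

    Holds : List ℕ → Set _
    Holds xs = splitSum (λ S C → m S C * D S C) xs ≈ Ψ xs

    root-x : ∀ {y xs} → Unique xs → y ∈ xs → f xs (x y) ≈ 0#
    root-x {y} {xs} u mem = x≈y⇒x-y≈0 (trans
      (cleared-root α β α-↭ β-↭ u mem λ S C → begin
        (1# - x y) * ((x y * ∏ x S * (∏ (ρ y) S * Ψ S) * ∏ (λ i → 1# - x i) C) * (((1# - x y * x y) * U (x y) S) * U (x y) C))
          ≈⟨ solve 7 (λ y xS r p c uS uC → (con (+ 1) :- y) :* ((y :* xS :* (r :* p) :* c) :* (((con (+ 1) :- y :* y) :* uS) :* uC))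
               := y :* (((xS :* p) :* ((con (+ 1) :- y) :* c)) :* ((r :* uS) :* ((con (+ 1) :- y :* y) :* uC))))
             refl (x y) (∏ x S) (∏ (ρ y) S) (Ψ S) (∏ (λ i → 1# - x i) C) (U (x y) S) (U (x y) C) ⟩
        x y * (((∏ x S * Ψ S) * ((1# - x y) * ∏ (λ i → 1# - x i) C)) * ((∏ (ρ y) S * U (x y) S) * ((1# - x y * x y) * U (x y) C)))
          ≈⟨ *-congˡ (*-congˡ (*-congʳ (∏ρ-U y S))) ⟩
        β S (y ∷ C) (x y) ∎)
      (sym (trans (*-congˡ (trans (*-congʳ (∏-zero _ mem (-‿inverseʳ _))) (zeroˡ _))) (zeroʳ _))))

    -- β carries the factor Z. The α summands that survive all share the factor ∏ (- x i), leaving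
    -- the identity for xs.
    root-0 : ∀ xs → Holds xs → f xs 0# ≈ 0#
    root-0 xs ih = x≈y⇒x-y≈0 (begin
      cleared α β xs 0#
        ≈⟨ splitSum-cong xs (λ S C p → trans
             (*-congˡ (+-congʳ (*-cong (*-congˡ (*-congˡ (trans (*-cong (U0 S) (U0 C)) (*-identityˡ _))))
               (*-congʳ (∏-cong S (λ i → solve 2 (λ t a → t :* con (+ 0) :- a := con (+ 0) :- a) refl t (x i)))))))
             (trans (solve 5 (λ d m e PS r → d :* ((con (+ 1) :- con (+ 0)) :* (m :* con (+ 1)) :* PS :+ con (+ 0) :* e :* r) := PS :* (m :* d))
                refl (D S C) (m S C) _ _ _)
              (*-congʳ (trans (sym (∏-++ _ S C)) (∏-↭ _ p))))) ⟩
      splitSum (λ S C → ∏ (λ i → 0# - x i) xs * (m S C * D S C)) xs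
        ≈⟨ trans (splitSum-*ˡ _ _ xs) (*-congˡ ih) ⟩
      ∏ (λ i → 0# - x i) xs * Ψ xs
        ≈⟨ sym (trans (*-congʳ (trans (∏-cong xs (λ i → solve 2 (λ t a → con (+ 1) :- t :* (con (+ 0) :* a) := con (+ 1)) refl t (x i))) (∏-1 xs))) (*-identityˡ _)) ⟩
      target xs 0# ∎)
      where
      U0 : ∀ S → U 0# S ≈ 1#
      U0 S = trans (∏-cong S (λ i → solve 1 (λ a → con (+ 1) :- con (+ 0) :* a := con (+ 1)) refl (x i))) (∏-1 S)

    -- The factor 1 - Z removes α. In β the linear factors over S and over C combine into two
    -- products over all of xs, leaving again the identity for xs.
    root-1 : ∀ xs → Holds xs → f xs 1# ≈ 0#
    root-1 xs ih = x≈y⇒x-y≈0 (begin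
      cleared α β xs 1#
        ≈⟨ splitSum-cong xs (λ S C p → trans
             (solve 9 (λ d e r m WS UC TC PS o → d :* ((con (+ 1) :- con (+ 1)) :* e :* r :+ con (+ 1) :* (m :* (WS :* UC)) :* (TC :* PS))
                       := (WS :* TC) :* ((PS :* UC) :* (m :* d)))
               refl (D S C) (m S C * (U 1# S * U 1# C)) _ (m S C) (W 1# S) (U 1# C) _ _ 0#)
             (*-cong
               (trans (*-congˡ (∏-cong C (λ i → solve 2 (λ t a → con (+ 1) :- t :* a := con (+ 1) :- t :* (con (+ 1) :* a)) refl t (x i))))
                 (trans (sym (∏-++ _ S C)) (∏-↭ _ p)))
               (*-congʳ (trans (*-congˡ (∏-cong C (λ i → solve 1 (λ a → con (+ 1) :- con (+ 1) :* a := con (+ 1) :- a) refl (x i))))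
                 (trans (sym (∏-++ _ S C)) (∏-↭ _ p)))))) ⟩
      splitSum (λ S C → W 1# xs * (∏ (λ i → 1# - x i) xs * (m S C * D S C))) xs
        ≈⟨ trans (splitSum-*ˡ _ _ xs) (*-congˡ (trans (splitSum-*ˡ _ _ xs) (*-congˡ ih))) ⟩
      target xs 1# ∎)

    -- The factor 1 - Z x y of `U` annihilates every term with y in the right part, and the α
    -- summand with y in the left part. What survives is a common factor `G` times the identity for
    -- xs without y.
    root-x⁻¹ : ∀ {y xs} → Unique xs → y ∈ xs →
      (∀ {ys} → xs ↭ y ∷ ys → Holds ys) → f xs (x⁻¹ y) ≈ 0#
    root-x⁻¹ {y} {xs} u mem ih = x≈y⇒x-y≈0 (begin
      cleared α β xs r
        ≈⟨ splitSum-↭ (residueTerm-↭ α β α-↭ β-↭ r) xs↭ ⟩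
      splitSum (λ S C → residueTerm α β r (y ∷ S) C) ys + splitSum (λ S C → residueTerm α β r S (y ∷ C)) ys
        ≈⟨ +-cong (splitSum-cong ys in-S) (trans (splitSum-cong′ ys in-C) (splitSum-0 ys)) ⟩
      splitSum (λ S C → G * (m S C * D S C)) ys + 0#
        ≈⟨ trans (+-identityʳ _) (trans (splitSum-*ˡ _ _ ys) (*-congˡ (ih xs↭))) ⟩
      G * Ψ ys
        ≈⟨ *-congʳ (*-congˡ (trans (∏-* _ _ ys) (*-congʳ (∏-* _ _ ys)))) ⟩
      (r * x y * (1# - t * (r * x y)) * (r - x y)) * (W r ys * P ys * ∏ (ρ y) ys) * Ψ ys
        ≈⟨ *-congʳ (*-congʳ (*-congʳ (trans (*-congʳ rx) (*-identityˡ _)))) ⟩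
      ((1# - t * (r * x y)) * (r - x y)) * (W r ys * P ys * ∏ (ρ y) ys) * Ψ ys
        ≈⟨ solve 6 (λ a b w p q ψ → a :* b :* (w :* p :* q) :* ψ := a :* w :* (b :* p :* (q :* ψ))) refl
             (1# - t * (r * x y)) (r - x y) (W r ys) (P ys) (∏ (ρ y) ys) (Ψ ys) ⟩
      target (y ∷ ys) r
        ≈⟨ sym (*-cong (∏-↭ _ xs↭) (*-cong (∏-↭ _ xs↭) (Ψ-↭ xs↭))) ⟩
      target xs r ∎)
      where
      r = x⁻¹ y
      rx : r * x y ≈ 1#
      rx = trans (*-comm _ _) (x-inverse y)
      ys = proj₁ (∈⇒↭ mem)
      xs↭ : xs ↭ y ∷ ys
      xs↭ = proj₂ (∈⇒↭ mem)
      y∉ : All (y ≢_) ys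
      y∉ = AllPairs.head (Unique-resp-↭ xs↭ u)
      P : List ℕ → Carrier
      P = ∏ (λ i → r - x i)
      κ : ℕ → Carrier
      κ i = (1# - t * (r * x i)) * (r - x i) * ρ y i
      G = (r * x y * (1# - t * (r * x y)) * (r - x y)) * ∏ κ ys
      reflect : ∀ a b → r * x y * a - r * b ≈ a - r * b
      reflect a b = +-congʳ (trans (*-congʳ rx) (*-identityˡ _))
      -- At Z = 1/x y every linear factor becomes, up to r = 1/x y, a factor of D or of Ψ.
      κ-χ : ∀ {i} → y ≢ i → χ y i * (1# - r * x i) * (r - t * x i) ≈ κ i
      κ-χ {i} ne = begin
        χ y i * (1# - r * x i) * (r - t * x i)
          ≈⟨ *-cong (*-congˡ (trans (sym (reflect 1# (x i))) (solve 3 (λ r y a → r :* y :* con (+ 1) :- r :* a := r :* (y :- a)) refl r (x y) (x i))))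
                    (trans (+-congˡ (-‿cong (trans (sym (*-identityˡ _)) (*-congʳ (sym rx)))))
                           (solve 4 (λ r y t a → r :- r :* y :* (t :* a) := r :* (con (+ 1) :- t :* (y :* a))) refl r (x y) t (x i))) ⟩
        χ y i * (r * (x y - x i)) * (r * (1# - t * (x y * x i)))
          ≈⟨ solve 4 (λ c r d e → c :* (r :* d) :* (r :* e) := r :* (c :* d) :* (r :* e)) refl _ _ _ _ ⟩
        r * (χ y i * (x y - x i)) * (r * (1# - t * (x y * x i)))
          ≈⟨ *-cong (*-congˡ (χˡ ne)) (*-congˡ (sym (ρ-* y i))) ⟩
        r * (x y - t * x i) * (r * (ρ y i * (1# - x y * x i)))
          ≈⟨ solve 6 (λ r y t a p o → r :* (y :- t :* a) :* (r :* (p :* (con (+ 1) :- y :* a)))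
               := (r :* y :- t :* (r :* a)) :* (r :- r :* y :* a) :* p) refl r (x y) t (x i) (ρ y i) 0# ⟩
        (r * x y - t * (r * x i)) * (r - r * x y * x i) * ρ y i
          ≈⟨ *-congʳ (*-cong (+-congʳ rx) (+-congˡ (-‿cong (trans (*-congʳ rx) (*-identityˡ _))))) ⟩
        κ i ∎
      in-C : ∀ S C → residueTerm α β r S (y ∷ C) ≈ 0#
      in-C S C = trans (*-congˡ (+-cong
        (*-congʳ (*-congˡ (*-congˡ (*-congˡ (*-congʳ 1-rx)))))
        (*-congʳ (*-congˡ (*-congˡ (*-congˡ (*-congʳ 1-rx)))))))
        (solve 11 (λ d a b u v p a′ b′ u′ v′ p′ → d :* (a :* (b :* (u :* (con (+ 0) :* v))) :* p :+ a′ :* (b′ :* (u′ :* (con (+ 0) :* v′))) :* p′) := con (+ 0))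
          refl _ _ _ _ _ _ _ _ _ _ _)
        where
        1-rx : 1# - r * x y ≈ 0#
        1-rx = x≈y⇒x-y≈0 (sym rx)
      in-S : ∀ S C → S ++ C ↭ ys → residueTerm α β r (y ∷ S) C ≈ G * (m S C * D S C)
      in-S S C p = begin
        residueTerm α β r (y ∷ S) C
          ≈⟨ *-congˡ (+-congʳ (*-congʳ (*-congˡ (*-congˡ (*-congʳ (*-congʳ (x≈y⇒x-y≈0 (sym rx)))))))) ⟩
        (∏ (χ y) C * D S C) * ((1# - r) * (m (y ∷ S) C * ((0# * U r S) * U r C)) * pα
          + r * ((x y * ∏ x S * (∏ (ρ y) S * Ψ S) * cC) * (((1# - t * (r * x y)) * W r S) * U r C)) * (TC * ((r - x y) * P S)))
          ≈⟨ solve 18 (λ χC d e m′ uS uC p r y xS ρS ψ c w WS TC rd PS →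
                (χC :* d) :* (e :* (m′ :* ((con (+ 0) :* uS) :* uC)) :* p
                  :+ r :* ((y :* xS :* (ρS :* ψ) :* c) :* ((w :* WS) :* uC)) :* (TC :* (rd :* PS)))
                := ((r :* y :* w :* rd) :* ((WS :* PS :* ρS) :* (χC :* uC :* TC))) :* (xS :* ψ :* c :* d))
             refl (∏ (χ y) C) (D S C) (1# - r) (m (y ∷ S) C) (U r S) (U r C) pα r (x y) (∏ x S) (∏ (ρ y) S) (Ψ S) cC
               (1# - t * (r * x y)) (W r S) TC (r - x y) (P S) ⟩
        ((r * x y * (1# - t * (r * x y)) * (r - x y)) * ((W r S * P S * ∏ (ρ y) S) * (∏ (χ y) C * U r C * TC))) * (m S C * D S C)
          ≈⟨ *-congʳ (*-congˡ (*-cong κS κC)) ⟩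
        ((r * x y * (1# - t * (r * x y)) * (r - x y)) * (∏ κ S * ∏ κ C)) * (m S C * D S C)
          ≈⟨ *-congʳ (*-congˡ (trans (sym (∏-++ κ S C)) (∏-↭ κ p))) ⟩
        G * (m S C * D S C) ∎
        where
        pα = ∏ (λ i → t * r - x i) (y ∷ S) * ∏ (λ i → r - x i) C
        cC = ∏ (λ i → 1# - x i) C
        TC = ∏ (λ i → r - t * x i) C
        κS : W r S * P S * ∏ (ρ y) S ≈ ∏ κ S
        κS = sym (trans (∏-* _ _ S) (*-congʳ (∏-* _ _ S)))
        κC : ∏ (χ y) C * U r C * TC ≈ ∏ κ C
        κC = trans (sym (trans (∏-* _ _ C) (*-congʳ (∏-* _ _ C))))
          (∏-cong∈ C (λ c → κ-χ (All.lookup y∉ (∈-resp-↭ p (∈-++⁺ʳ S c)))))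

    nodes : List ℕ → List Carrier
    nodes xs = 0# ∷ 1# ∷ map x xs ++ map x⁻¹ xs

    length-nodes : ∀ xs → length (nodes xs) ≡ suc (length xs ℕ.+ suc (length xs))
    length-nodes xs = ≡.cong suc (≡.trans (≡.cong suc (≡.trans (length-++ (map x xs))
      (≡.cong₂ ℕ._+_ (length-map x xs) (length-map x⁻¹ xs)))) (≡.sym (ℕₚ.+-suc (length xs) (length xs))))

    -- Up to units every difference is one of 1, x i, x i - x j, 1 - x i and 1 - x i x j.
    nodes-Apart : ∀ {xs} → Unique xs → AllPairs Apart (nodes xs)
    nodes-Apart {xs} u =
      (1-0 ∷ All.++⁺ (All.map⁺ (All.universal (λ i → Apart-0 (x-inv i)) xs)) (All.map⁺ (All.universal (λ i → Apart-0 (x⁻¹-inv i)) xs)))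
      ∷ All.++⁺ (All.map⁺ (All.universal x-1 xs)) (All.map⁺ (All.universal x⁻¹-1 xs))
      ∷ AllPairs.++⁺ (Apart-x u) (AllPairs.map⁺ (AllPairs.map x⁻¹-Apart u))
          (All.map⁺ (All.universal (λ i → All.map⁺ (All.universal (x-x⁻¹ i) xs)) xs))
      where
      1-0 : Apart 0# 1#
      1-0 = 1# , solve 0 ((con (+ 1) :- con (+ 0)) :* con (+ 1) := con (+ 1)) refl
      x-1 : ∀ i → Apart 1# (x i)
      x-1 i = Invertible-resp (solve 1 (λ a → :- (con (+ 1) :- a) := a :- con (+ 1)) refl (x i)) (Invertible-neg (1-x-invertible i))
      x⁻¹-1 : ∀ i → Apart 1# (x⁻¹ i)
      x⁻¹-1 i = Invertible-resp (trans (solve 2 (λ a b → b :* (con (+ 1) :- a) := b :- a :* b) refl (x i) (x⁻¹ i)) (+-congˡ (-‿cong (x-inverse i))))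
        (Invertible-* (x⁻¹-inv i) (1-x-invertible i))
      x-x⁻¹ : ∀ i j → Apart (x i) (x⁻¹ j)
      x-x⁻¹ i j = Invertible-resp (trans (solve 3 (λ a b b′ → b′ :* (con (+ 1) :- a :* b) := b′ :- b :* b′ :* a) refl (x i) (x j) (x⁻¹ j))
          (+-congˡ (-‿cong (trans (*-congʳ (x-inverse j)) (*-identityˡ _)))))
        (Invertible-* (x⁻¹-inv j) (1-*-invertible i j))
      x⁻¹-Apart : ∀ {i j} → i ≢ j → Apart (x⁻¹ i) (x⁻¹ j)
      x⁻¹-Apart {i} {j} ne = Invertible-resp (trans
          (solve 4 (λ a a′ b b′ → a′ :* b′ :* (a :- b) := a :* a′ :* b′ :- b :* b′ :* a′) refl (x i) (x⁻¹ i) (x j) (x⁻¹ j))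
          (+-cong (trans (*-congʳ (x-inverse i)) (*-identityˡ _)) (-‿cong (trans (*-congʳ (x-inverse j)) (*-identityˡ _)))))
        (Invertible-* (Invertible-* (x⁻¹-inv i) (x⁻¹-inv j)) (x-Apart (λ e → ne (≡.sym e))))

    -- The induction is on a bound for the length, since the nodes 1/x y call for the identity on xs
    -- with an arbitrary entry removed.
    holds : ∀ n xs → length xs ℕ.≤ n → Unique xs → Holds xs
    holds n [] _ _ = solve 0 (con (+ 1) :* con (+ 1) :* con (+ 1) :* con (+ 1) := con (+ 1)) refl
    holds (suc n) (z ∷ xs) (s≤s l) (z∉ ∷ u) =
      *-cancelˡ (Invertible-* (Invertible-∏ (λ i → 1# - x z * x i) (All.universal (λ i → 1-*-invertible z i) xs)) (∏Z-inv z∉)) (begin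
      (U (x z) xs * P) * splitSum (λ S C → m S C * D S C) (z ∷ xs)
        ≈⟨ *-comm _ _ ⟩
      splitSum (λ S C → m S C * D S C) (z ∷ xs) * (U (x z) xs * P)
        ≈⟨ cleared-∷ α β m (U (x z) xs) z∉ hβ hα ⟩
      cleared α β xs (x z)
        ≈⟨ x-y≈0⇒x≈y (PolyFn-roots _ (f-poly xs) (nodes xs) (length-nodes xs) (nodes-Apart u)
             (root-0 xs ih ∷ root-1 xs ih ∷ All.++⁺ (All.map⁺ (All.tabulate (root-x u)))
               (All.map⁺ (All.tabulate (λ mem → root-x⁻¹ u mem (ih′ mem))))) (x z)) ⟩
      W (x z) xs * (P * Ψ xs)
        ≈⟨ *-congʳ (sym (∏ρ-U z xs)) ⟩
      (∏ (ρ z) xs * U (x z) xs) * (P * Ψ xs)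
        ≈⟨ solve 4 (λ r u p ψ → (r :* u) :* (p :* ψ) := (u :* p) :* (r :* ψ)) refl _ _ _ _ ⟩
      (U (x z) xs * P) * Ψ (z ∷ xs) ∎)
      where
      P = ∏ (λ i → x z - x i) xs
      ih : Holds xs
      ih = holds n xs l u
      ih′ : ∀ {y} → y ∈ xs → ∀ {ys} → xs ↭ y ∷ ys → Holds ys
      ih′ _ {ys} p = holds n ys (ℕₚ.≤-trans (ℕₚ.n≤1+n _) (≡.subst (ℕ._≤ n) (↭-length p) l)) (AllPairs.tail (Unique-resp-↭ p u))
      hβ : ∀ S C → S ++ C ↭ xs → m (z ∷ S) C * U (x z) xs ≈ β S C (x z)
      hβ S C p = begin
        (x z * ∏ x S * (∏ (ρ z) S * Ψ S) * _) * U (x z) xs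
          ≈⟨ *-congˡ (trans (sym (∏-↭ _ p)) (∏-++ _ S C)) ⟩
        (x z * ∏ x S * (∏ (ρ z) S * Ψ S) * _) * (U (x z) S * U (x z) C)
          ≈⟨ solve 7 (λ z xS r ψ c uS uC → (z :* xS :* (r :* ψ) :* c) :* (uS :* uC) := z :* ((xS :* ψ :* c) :* ((r :* uS) :* uC)))
               refl (x z) (∏ x S) (∏ (ρ z) S) (Ψ S) (∏ (λ i → 1# - x i) C) (U (x z) S) (U (x z) C) ⟩
        x z * (m S C * ((∏ (ρ z) S * U (x z) S) * U (x z) C))
          ≈⟨ *-congˡ (*-congˡ (*-congʳ (∏ρ-U z S))) ⟩
        β S C (x z) ∎
      hα : ∀ S C → S ++ C ↭ xs → m S (z ∷ C) * U (x z) xs ≈ α S C (x z)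
      hα S C p = trans (*-congˡ (trans (sym (∏-↭ _ p)) (∏-++ _ S C)))
        (solve 4 (λ a b c d → (a :* (b :* c)) :* d := b :* ((a :* c) :* d)) refl _ _ _ _)

  littlewood : (∏ x · Ψ) ⋆ ∏ (λ i → 1# - x i) ≐ Ψ
  littlewood xs u = holds (length xs) xs ℕₚ.≤-refl u

-- Iteration of the product side and collapse of the sum side.

module MasterIdentity {c ℓ} (K : CommutativeRing c ℓ) (V : GenericPoint K) (a b : CommutativeRing.Carrier K) where

  open import Defs using (evenb)
  open UniqueLists
  open SumsAndProducts K
  open Interpolation K
  open ShuffleAlgebra K V
  open ShuffleIdentities K V
  open Littlewood K V
  open GenericPoint V
  open import Relation.Binary.Reasoning.Setoid setoid

  pointwise : ∀ {f g : List ℕ → Carrier} → (∀ xs → f xs ≈ g xs) → f ≐ g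
  pointwise e xs _ = e xs

  ∏-≐ : ∀ {φ ψ} → (∀ i → φ i ≈ ψ i) → ∏ φ ≐ ∏ ψ
  ∏-≐ e = pointwise (λ xs → ∏-cong xs e)

  -- This is `splitSum-elementary` twisted by the multiplicative function `∏ φ`.
  ∏-elementary : ∀ u φ → ∏ (λ i → φ i * (u * x i)) ⋆ ∏ φ ≐ ∏ (λ i → φ i * (1# + u * x i))
  ∏-elementary u φ = ≐-trans (⋆-cong (pointwise (∏-* φ (λ i → u * x i))) (pointwise (λ xs → sym (*-identityʳ _))))
    (≐-trans (∏-·-⋆ φ (∏ (λ i → u * x i)) (λ _ → 1#))
      (λ xs un → trans (*-congˡ (trans (splitSum-cong′ xs (λ S C → *-congʳ (*-identityʳ _))) (splitSum-elementary u xs un)))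
        (sym (∏-* φ _ xs))))

  ε : List ℕ → Carrier
  ε [] = 1#
  ε (_ ∷ _) = 0#

  ⋆-identityʳ : ∀ f → f ⋆ ε ≐ f
  ⋆-identityʳ f = pointwise (go f)
    where
    go : ∀ f xs → (f ⋆ ε) xs ≈ f xs
    go f [] = trans (*-identityʳ _) (*-identityʳ _)
    go f (x ∷ xs) = trans (+-cong
      (trans (splitSum-cong xs drop) (go (λ S → f (x ∷ S)) xs))
      (trans (splitSum-cong′ xs (λ S C → trans (*-congʳ (zeroʳ _)) (zeroˡ _))) (splitSum-0 xs))) (+-identityʳ _)
      where
      drop : ∀ S C → S ++ C ↭ xs → f (x ∷ S) * ε C * D (x ∷ S) C ≈ f (x ∷ S) * ε C * D S C
      drop S [] _ = *-congˡ (*-identityˡ _)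
      drop S (_ ∷ _) _ = trans (trans (*-congʳ (zeroʳ _)) (zeroˡ _)) (sym (trans (*-congʳ (zeroʳ _)) (zeroˡ _)))

  ⋆-identityˡ : ∀ f → ε ⋆ f ≐ f
  ⋆-identityˡ f = pointwise (go f)
    where
    go : ∀ f xs → (ε ⋆ f) xs ≈ f xs
    go f [] = trans (*-identityʳ _) (*-identityˡ _)
    go f (x ∷ xs) = trans (+-cong
      (trans (splitSum-cong′ xs (λ S C → trans (*-congʳ (zeroˡ _)) (zeroˡ _))) (splitSum-0 xs))
      (trans (splitSum-cong xs drop) (go (λ C → f (x ∷ C)) xs))) (+-identityˡ _)
      where
      drop : ∀ S C → S ++ C ↭ xs → ε S * f (x ∷ C) * D S (x ∷ C) ≈ ε S * f (x ∷ C) * D S C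
      drop [] C _ = refl
      drop (_ ∷ _) C _ = trans (trans (*-congʳ (zeroˡ _)) (zeroˡ _)) (sym (trans (*-congʳ (zeroˡ _)) (zeroˡ _)))

  X : ℕ → List ℕ → Carrier
  X n = ∏ (λ i → x i ^ n)

  g : ℕ → Carrier
  g i = (1# + a * x i) * (1# + b * x i)

  γ : ℕ → Carrier
  γ i = g i * 1/[1- i * i ]

  -- The product side of the theorem, without truncation.
  Φ : List ℕ → Carrier
  Φ = ∏ γ · Ψ

  -- Two rounds of `littlewood`: Ψ = xΨ ⋆ [1 - x] and, multiplied by ∏ x, xΨ = x²Ψ ⋆ [x(1 - x)]. The
  -- two right factors merge, as [x(1 - x)] ⋆ [1 - x] = [(1 - x)(1 + x)], and multiplication by ∏ γ
  -- cancels 1 - x².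
  Φ-step : Φ ≐ (X 2 · Φ) ⋆ ∏ g
  Φ-step = ≐-trans (λ xs u → *-congˡ (Ψ-step xs u)) (≐-trans (≐-sym (∏-·-⋆ γ _ _))
    (⋆-cong (pointwise (λ xs → solve 3 (λ a b c → a :* (b :* c) := b :* (a :* c)) refl _ _ _))
      (pointwise (λ xs → trans (sym (∏-* γ _ xs)) (∏-cong xs (λ i → begin
        g i * 1/[1- i * i ] * ((1# - x i) * (1# + 1# * x i))
          ≈⟨ solve 3 (λ g e x → g :* e :* ((con (+ 1) :- x) :* (con (+ 1) :+ con (+ 1) :* x)) := g :* ((con (+ 1) :- x :* x) :* e)) refl (g i) 1/[1- i * i ] (x i) ⟩
        g i * ((1# - x i * x i) * 1/[1- i * i ])
          ≈⟨ trans (*-congˡ (1-*-inverse i i)) (*-identityʳ _) ⟩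
        g i ∎))))))
    where
    xΨ-step : (X 2 · Ψ) ⋆ ∏ (λ i → (1# - x i) * (1# * x i)) ≐ ∏ x · Ψ
    xΨ-step = ≐-trans (⋆-cong
      (pointwise (λ xs → trans (*-congʳ (trans (∏-cong xs (λ i → *-congˡ (*-identityʳ _))) (∏-* x x xs))) (*-assoc _ _ _)))
      (pointwise (λ xs → trans (∏-cong xs (λ i → trans (*-comm _ _) (*-congʳ (*-identityˡ _)))) (∏-* x _ xs))))
      (≐-trans (∏-·-⋆ x (∏ x · Ψ) (∏ (λ i → 1# - x i))) (λ xs u → *-congˡ (littlewood xs u)))
    Ψ-step : Ψ ≐ (X 2 · Ψ) ⋆ ∏ (λ i → (1# - x i) * (1# + 1# * x i))
    Ψ-step = ≐-trans (≐-sym littlewood) (≐-trans (⋆-cong (≐-sym xΨ-step) (λ _ _ → refl))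
      (≐-trans (⋆-assoc _ _ _) (⋆-cong {X 2 · Ψ} (λ _ _ → refl) (∏-elementary 1# (λ i → 1# - x i)))))

  -- Doubling in a form that lets `evenb` and `F` unfold two steps at a time, one even and one odd
  -- part.
  dbl : ℕ → ℕ
  dbl zero = zero
  dbl (suc k) = suc (suc (dbl k))

  -- The ⋆-product of the blocks [x^(2j) (1 + ax)(1 + bx)] for j from k - 1 down to 0; it is the
  -- right factor common to both sides of the theorem.
  tail : ℕ → List ℕ → Carrier
  tail zero = ε
  tail (suc k) = ∏ (λ i → x i ^ dbl k * g i) ⋆ tail k

  Φ-tail : ∀ k → Φ ≐ (X (dbl k) · Φ) ⋆ tail k
  Φ-tail zero = ≐-sym (≐-trans (⋆-identityʳ _) (pointwise (λ xs → trans (*-congʳ (∏-1 xs)) (*-identityˡ _))))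
  Φ-tail (suc k) = ≐-trans (Φ-tail k) (≐-trans (⋆-cong {g = tail k} X-step (λ _ _ → refl)) (⋆-assoc _ _ _))
    where
    X-step : X (dbl k) · Φ ≐ (X (dbl (suc k)) · Φ) ⋆ ∏ (λ i → x i ^ dbl k * g i)
    X-step = ≐-trans (λ xs u → *-congˡ (Φ-step xs u)) (≐-trans (≐-sym (∏-·-⋆ _ _ _)) (⋆-cong
      (pointwise (λ xs → trans (sym (*-assoc _ _ _)) (*-congʳ (trans (sym (∏-* _ _ xs))
        (∏-cong xs (λ i → solve 2 (λ x y → y :* (x :* (x :* con (+ 1))) := x :* (x :* y)) refl (x i) (x i ^ dbl k)))))))
      (pointwise (λ xs → sym (∏-* _ _ xs)))))
  -- The weight of a part r of multiplicity m: H_m(ab;t) for even r, a^m H_m(b/a;t) for odd r.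
  H : ℕ → ℕ → Carrier
  H r m = if evenb r then gauss (λ k → (a * b) ^ k) m else gauss (λ k → a ^ (m ∸ k) * b ^ k) m

  E : ℕ → List ℕ → Carrier
  E r S = H r (length S) * X r S

  -- The weighted sum over partitions with parts at most M, see `F-HL`. The base case is the block
  -- of the part 0, which fills the remaining variables with 1.
  F : ℕ → List ℕ → Carrier
  F zero _ = 1#
  F (suc M) = E (suc M) ⋆ F M

  evenb-dbl : ∀ k → evenb (dbl k) ≡ true
  evenb-dbl zero = ≡.refl
  evenb-dbl (suc k) = evenb-dbl k

  oddb-dbl : ∀ k → evenb (suc (dbl k)) ≡ false
  oddb-dbl zero = ≡.refl
  oddb-dbl (suc k) = oddb-dbl k

  E-even : ∀ r → evenb r ≡ true → E r ≐ X r ⋆ ∏ (λ i → x i ^ r * (a * b))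
  E-even r e xs u rewrite e = sym (trans (⋆-cong {X r}
      (pointwise (λ xs → sym (*-identityʳ _)))
      (pointwise (∏-* (λ i → x i ^ r) (λ i → a * b))) xs u)
    (trans (∏-·-⋆ (λ i → x i ^ r) (λ _ → 1#) (∏ (λ i → a * b)) xs u)
      (trans (*-congˡ (trans (splitSum-cong′ xs (λ S C → *-congʳ (trans (*-identityˡ _) (∏-const (a * b) C)))) (splitSum-gauss _ xs u)))
        (*-comm _ _))))

  E-odd : ∀ r → evenb r ≡ false → E r ≐ ∏ (λ i → x i ^ r * a) ⋆ ∏ (λ i → x i ^ r * b)
  E-odd r e xs u rewrite e = sym (trans (⋆-cong
      (pointwise (∏-* (λ i → x i ^ r) (λ i → a)))
      (pointwise (∏-* (λ i → x i ^ r) (λ i → b))) xs u)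
    (trans (∏-·-⋆ (λ i → x i ^ r) (∏ (λ i → a)) (∏ (λ i → b)) xs u)
      (trans (*-congˡ (trans (splitSum-cong xs (λ S C p → *-congʳ (*-cong (trans (∏-const a S) (reflexive (≡.cong (a ^_) (len S C p)))) (∏-const b C))))
          (splitSum-gauss (λ k → a ^ (length xs ∸ k) * b ^ k) xs u)))
        (*-comm _ _))))
    where
    len : ∀ S C → S ++ C ↭ xs → length S ≡ length xs ∸ length C
    len S C p = ≡.trans (≡.sym (ℕₚ.m+n∸n≡m (length S) (length C)))
      (≡.cong (_∸ length C) (≡.trans (≡.sym (length-++ S)) (↭-length p)))

  -- With n = 2k, the parts n + 2 and n + 1 put [x^(n+2)] ⋆ [ab x^(n+2)] ⋆ [a x^(n+1)] ⋆ [b x^(n+1)]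
  -- in front of [x^n] ⋆ `tail k`. All but the first factor and `tail k` collapse by [ux] ⋆ [1] =
  -- [1 + ux]: with u = b on the two adjacent pairs, then with u = a on the results, giving
  -- [x^n (1 + ax)(1 + bx)].
  F-tail : ∀ k → F (dbl k) ≐ X (dbl k) ⋆ tail k
  F-tail zero = ≐-sym (≐-trans (⋆-identityʳ _) (pointwise ∏-1))
  F-tail (suc k) = ≐-trans (⋆-cong (E-even (suc (suc n)) (evenb-dbl k))
      (⋆-cong (E-odd (suc n) (oddb-dbl k)) (F-tail k)))
    (≐-trans (⋆-assoc (X (suc (suc n))) _ _) (⋆-cong {X (suc (suc n))} (λ _ _ → refl)
      (≐-trans (≐-trans (⋆-cong {f = P} {g = (Q ⋆ R) ⋆ (X n ⋆ tail k)} (λ _ _ → refl) (≐-trans (⋆-assoc Q R _) (⋆-cong {f = Q} (λ _ _ → refl) (≐-sym (⋆-assoc R (X n) (tail k))))))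
          (≐-sym (⋆-assoc P Q _)))
        (≐-trans (⋆-cong PQ (⋆-cong {g = tail k} RX (λ _ _ → refl)))
          (≐-trans (≐-sym (⋆-assoc _ _ _)) (⋆-cong {g = tail k} PQRX (λ _ _ → refl)))))))
    where
    n = dbl k
    P = ∏ (λ i → x i ^ suc (suc n) * (a * b))
    Q = ∏ (λ i → x i ^ suc n * a)
    R = ∏ (λ i → x i ^ suc n * b)
    φ : ℕ → Carrier
    φ i = x i ^ n * (1# + b * x i)
    PQ : P ⋆ Q ≐ ∏ (λ i → φ i * (a * x i))
    PQ = ≐-trans (⋆-cong {g = Q} (∏-≐ (λ i → solve 4 (λ x y a b → x :* (x :* y) :* (a :* b) := x :* y :* a :* (b :* x)) refl (x i) (x i ^ n) a b)) (λ _ _ → refl))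
      (≐-trans (∏-elementary b (λ i → x i ^ suc n * a))
        (∏-≐ (λ i → solve 4 (λ x y a b → x :* y :* a :* (con (+ 1) :+ b :* x) := y :* (con (+ 1) :+ b :* x) :* (a :* x)) refl (x i) (x i ^ n) a b)))
    RX : R ⋆ X n ≐ ∏ φ
    RX = ≐-trans (⋆-cong {g = X n} (∏-≐ (λ i → solve 3 (λ x y b → x :* y :* b := y :* (b :* x)) refl (x i) (x i ^ n) b)) (λ _ _ → refl))
      (∏-elementary b (λ i → x i ^ n))
    PQRX : ∏ (λ i → φ i * (a * x i)) ⋆ ∏ φ ≐ ∏ (λ i → x i ^ n * g i)
    PQRX = ≐-trans (∏-elementary a φ) (∏-≐ (λ i → solve 4 (λ x y a b →
      y :* (con (+ 1) :+ b :* x) :* (con (+ 1) :+ a :* x) := y :* ((con (+ 1) :+ a :* x) :* (con (+ 1) :+ b :* x))) refl (x i) (x i ^ n) a b))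

  -- The two sides differ only in the left factor. As `Φ []` is 1, an empty S contributes nothing,
  -- and every other S brings a factor x i ^ 2k.
  Φ-F : ∀ k xs → Unique xs → Φ xs - F (dbl k) xs ≈ splitSum (λ S C → X (dbl k) S * (Φ S - 1#) * tail k C * D S C) xs
  Φ-F k xs u = begin
    Φ xs - F (dbl k) xs
      ≈⟨ +-cong (Φ-tail k xs u) (trans (-‿cong (F-tail k xs u)) (trans (solve 1 (λ a → :- a := (:- con (+ 1)) :* a) refl _) (sym (splitSum-*ˡ (- 1#) _ xs)))) ⟩
    _ + _
      ≈⟨ sym (splitSum-+ _ _ xs) ⟩
    splitSum (λ S C → X (dbl k) S * Φ S * tail k C * D S C + - 1# * (X (dbl k) S * tail k C * D S C)) xs
      ≈⟨ splitSum-cong′ xs (λ S C → solve 4 (λ x p v d → x :* p :* v :* d :+ (:- con (+ 1)) :* (x :* v :* d) := x :* (p :- con (+ 1)) :* v :* d) refl (X (dbl k) S) (Φ S) (tail k C) (D S C)) ⟩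
    splitSum (λ S C → X (dbl k) S * (Φ S - 1#) * tail k C * D S C) xs ∎

-- Hall-Littlewood polynomials as ⋆-products of blocks.

module HallLittlewood {c ℓ} (K : CommutativeRing c ℓ) (V : GenericPoint K) (a b : CommutativeRing.Carrier K) where

  open UniqueLists
  open Partitions using (part; multiplicities; multiplicities-length)
  open SumsAndProducts K
  open ShuffleAlgebra K V
  open ShuffleIdentities K V
  open MasterIdentity K V a b
  open GenericPoint V
  open import Relation.Binary.Reasoning.Setoid setoid

  -- The Kronecker delta with values in `K`.
  ind : ℕ → ℕ → Carrier
  ind zero zero = 1#
  ind zero (suc n) = 0#
  ind (suc m) zero = 0#
  ind (suc m) (suc n) = ind m n

  ind-≡ : ∀ m → ind m m ≈ 1#
  ind-≡ zero = refl
  ind-≡ (suc m) = ind-≡ m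

  ind-≢ : ∀ {m n} → m ≢ n → ind m n ≈ 0#
  ind-≢ {zero} {zero} ne = contradiction ≡.refl ne
  ind-≢ {zero} {suc n} ne = refl
  ind-≢ {suc m} {zero} ne = refl
  ind-≢ {suc m} {suc n} ne = ind-≢ (ne ∘ ≡.cong suc)

  ind-cong : ∀ m n {p q} → (m ≡ n → p ≈ q) → ind m n * p ≈ ind m n * q
  ind-cong m n e with m ℕ.≟ n
  ... | yes eq = *-congˡ (e eq)
  ... | no ne = trans (trans (*-congʳ (ind-≢ ne)) (zeroˡ _)) (sym (trans (*-congʳ (ind-≢ ne)) (zeroˡ _)))

  ∑-ind : ∀ m n (f : ℕ → Carrier) → m ℕ.< n → ∑ (λ j → ind m j * f j) (upTo n) ≈ f m
  ∑-ind zero (suc n) f _ = trans (∑-upTo-suc _ n) (trans (+-cong (*-identityˡ _)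
    (trans (∑-cong∈ (upTo n) (λ _ → zeroˡ _)) (∑-0 (upTo n)))) (+-identityʳ _))
  ∑-ind (suc m) (suc n) f (s≤s l) = trans (∑-upTo-suc _ n) (trans (+-cong (zeroˡ _) (∑-ind m n (f ∘ suc) l)) (+-identityˡ _))

  gauss-cong : ∀ n {w w′} → (∀ k → k ℕ.≤ n → w k ≈ w′ k) → gauss w n ≈ gauss w′ n
  gauss-cong zero e = e 0 z≤n
  gauss-cong (suc n) e = +-cong (gauss-cong n (λ k l → e (suc k) (s≤s l))) (gauss-cong n (λ k l → *-congˡ (e k (ℕₚ.m≤n⇒m≤1+n l))))

  gauss-*ˡ : ∀ n k w → gauss (λ i → k * w i) n ≈ k * gauss w n
  gauss-*ˡ zero k w = refl
  gauss-*ˡ (suc n) k w = trans (+-cong (gauss-*ˡ n k (w ∘ suc))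
    (trans (gauss-cong n (λ j _ → solve 3 (λ t k w → t :* (k :* w) := k :* (t :* w)) refl (t ^ j) k (w j))) (gauss-*ˡ n k _))) (sym (distribˡ _ _ _))

  gauss-0 : ∀ n → gauss (λ _ → 0#) n ≈ 0#
  gauss-0 n = trans (gauss-cong n (λ _ _ → sym (zeroˡ 0#))) (trans (gauss-*ˡ n 0# (λ _ → 0#)) (zeroˡ _))

  gauss-top : ∀ n → gauss (λ k → ind k n) n ≈ 1#
  gauss-top zero = refl
  gauss-top (suc n) = trans (+-cong (gauss-top n)
    (trans (gauss-cong n (λ k l → trans (*-congˡ (ind-≢ (ℕₚ.<⇒≢ (s≤s l)))) (zeroʳ _))) (gauss-0 n))) (+-identityʳ _)

  -- The delta picks out the t-binomial [n+1 choose n], that is 1 + t + ... + t^n.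
  qInt-suc : ∀ n → gauss (λ k → ind k n) (suc n) * (1# - t) ≈ 1# - t ^ suc n
  qInt-suc zero = solve 1 (λ t → (con (+ 0) :+ con (+ 1) :* con (+ 1)) :* (con (+ 1) :- t) := con (+ 1) :- t :* con (+ 1)) refl t
  qInt-suc (suc n) = begin
    (gauss (λ k → ind k n) (suc n) + gauss (λ k → t ^ k * ind k (suc n)) (suc n)) * (1# - t)
      ≈⟨ *-congʳ (+-congˡ (begin
        gauss (λ k → t ^ k * ind k (suc n)) (suc n)
          ≈⟨ gauss-cong (suc n) (λ k _ → trans (*-comm _ _) (trans (ind-cong k (suc n) (λ e → reflexive (≡.cong (t ^_) e))) (*-comm _ _))) ⟩
        gauss (λ k → t ^ suc n * ind k (suc n)) (suc n)
          ≈⟨ trans (gauss-*ˡ (suc n) _ _) (trans (*-congˡ (gauss-top (suc n))) (*-identityʳ _)) ⟩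
        t ^ suc n ∎)) ⟩
    (gauss (λ k → ind k n) (suc n) + t ^ suc n) * (1# - t)
      ≈⟨ trans (distribʳ _ _ _) (+-congʳ (qInt-suc n)) ⟩
    (1# - t ^ suc n) + t ^ suc n * (1# - t)
      ≈⟨ solve 2 (λ p t → (con (+ 1) :- p) :+ p :* (con (+ 1) :- t) := con (+ 1) :- t :* p) refl (t ^ suc n) t ⟩
    1# - t ^ suc (suc n) ∎

  poch : ℕ → Carrier
  poch n = ∏ (λ j → 1# - t ^ suc j) (upTo n)

  poch-suc : ∀ n → poch (suc n) ≈ poch n * (1# - t ^ suc n)
  poch-suc n = trans (reflexive (≡.cong (∏ _) (≡.sym (upTo-∷ʳ n)))) (trans (∏-++ _ (upTo n) (n ∷ [])) (*-congˡ (*-identityʳ _)))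

  blk : ℕ → ℕ → List ℕ → Carrier
  blk m r S = ind (length S) m * X r S

  single : ℕ → List ℕ → Carrier
  single r = blk 1 r

  -- R es is Σ_w w(x^es ∏_{i<j} (x_i - t x_j)/(x_i - x_j)), see R-symmetrization.
  R : List ℕ → List ℕ → Carrier
  R [] = ε
  R (e ∷ es) = single e ⋆ R es

  blk-0 : ∀ r → blk 0 r ≐ ε
  blk-0 r = pointwise λ { [] → *-identityˡ _ ; (_ ∷ _) → zeroˡ _ }

  infixr 7 _•_
  _•_ : Carrier → (List ℕ → Carrier) → List ℕ → Carrier
  (k • f) xs = k * f xs

  ⋆-•ʳ : ∀ k f g → f ⋆ (k • g) ≐ k • (f ⋆ g)
  ⋆-•ʳ k f g xs _ = trans (splitSum-cong′ xs (λ S C → solve 4 (λ f k g d → f :* (k :* g) :* d := k :* (f :* g :* d)) refl _ _ _ _)) (splitSum-*ˡ k _ xs)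

  ⋆-•ˡ : ∀ k f g → (k • f) ⋆ g ≐ k • (f ⋆ g)
  ⋆-•ˡ k f g xs _ = trans (splitSum-cong′ xs (λ S C → solve 4 (λ f k g d → k :* f :* g :* d := k :* (f :* g :* d)) refl _ _ _ _)) (splitSum-*ˡ k _ xs)

  split-length : ∀ {xs : List ℕ} S C → S ++ C ↭ xs → length S ℕ.+ length C ≡ length xs
  split-length S C p = ≡.trans (≡.sym (length-++ S)) (↭-length p)

  -- The monomial in x is the same for every splitting, and the sum of `D` over one-element left
  -- parts is [m+1 choose m] by `splitSum-gauss`.
  single-blk : ∀ m r → (1# - t) • (single r ⋆ blk m r) ≐ (1# - t ^ suc m) • blk (suc m) r
  single-blk m r xs u = begin
    (1# - t) * splitSum (λ S C → (ind (length S) 1 * X r S) * (ind (length C) m * X r C) * D S C) xs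
      ≈⟨ *-congˡ (splitSum-cong xs term) ⟩
    (1# - t) * splitSum (λ S C → (ind (length xs) (suc m) * X r xs) * (ind (length C) m * D S C)) xs
      ≈⟨ *-congˡ (trans (splitSum-*ˡ _ _ xs) (trans (*-congˡ (splitSum-gauss (λ k → ind k m) xs u)) (*-assoc _ _ _))) ⟩
    (1# - t) * (ind (length xs) (suc m) * (X r xs * gauss (λ k → ind k m) (length xs)))
      ≈⟨ solve 4 (λ k i x g → k :* (i :* (x :* g)) := i :* (x :* (g :* k))) refl _ _ _ _ ⟩
    ind (length xs) (suc m) * (X r xs * (gauss (λ k → ind k m) (length xs) * (1# - t)))
      ≈⟨ ind-cong (length xs) (suc m) (λ e → *-congˡ (trans (*-congʳ (reflexive (≡.cong (gauss _) e))) (qInt-suc m))) ⟩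
    ind (length xs) (suc m) * (X r xs * (1# - t ^ suc m))
      ≈⟨ solve 3 (λ i x k → i :* (x :* k) := k :* (i :* x)) refl _ _ _ ⟩
    (1# - t ^ suc m) * blk (suc m) r xs ∎
    where
    ind-complement : ∀ s k n → s ℕ.+ k ≡ n → ind k m * ind s 1 ≈ ind k m * ind n (suc m)
    ind-complement s k n e = ind-cong k m (λ k≡m → reflexive (≡.sym (≡.trans (≡.cong₂ ind (≡.sym e) (≡.cong suc (≡.sym k≡m))) (shift s k))))
      where
      shift : ∀ s k → ind (s ℕ.+ k) (suc k) ≡ ind s 1
      shift s zero = ≡.cong (λ n → ind n 1) (ℕₚ.+-identityʳ s)
      shift s (suc k) = ≡.trans (≡.cong (λ n → ind n (suc (suc k))) (ℕₚ.+-suc s k)) (shift s k)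
    term : ∀ S C → S ++ C ↭ xs → (ind (length S) 1 * X r S) * (ind (length C) m * X r C) * D S C
      ≈ (ind (length xs) (suc m) * X r xs) * (ind (length C) m * D S C)
    term S C p = begin
      (ind (length S) 1 * X r S) * (ind (length C) m * X r C) * D S C
        ≈⟨ solve 5 (λ a b c d e → a :* b :* (c :* d) :* e := (c :* a) :* ((b :* d) :* e)) refl _ _ _ _ _ ⟩
      (ind (length C) m * ind (length S) 1) * ((X r S * X r C) * D S C)
        ≈⟨ *-cong (ind-complement (length S) (length C) (length xs) (split-length S C p)) (*-congʳ (trans (sym (∏-++ _ S C)) (∏-↭ _ p))) ⟩
      (ind (length C) m * ind (length xs) (suc m)) * (X r xs * D S C)
        ≈⟨ solve 4 (λ a b c d → a :* b :* (c :* d) := b :* c :* (a :* d)) refl _ _ _ _ ⟩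
      (ind (length xs) (suc m) * X r xs) * (ind (length C) m * D S C) ∎

  -- A run of m equal exponents fuses into one block at the price of (t;t)_m / (1 - t)^m, the factor
  -- v_m(t) in the definition of P_λ.
  R-replicate : ∀ m r es → (1# - t) ^ m • R (replicate m r ++ es) ≐ poch m • (blk m r ⋆ R es)
  R-replicate zero r es xs u = *-congˡ (trans (sym (⋆-identityˡ (R es) xs u))
    (⋆-cong {g = R es} (≐-sym (blk-0 r)) (λ _ _ → refl) xs u))
  R-replicate (suc m) r es xs u = begin
    ((1# - t) * (1# - t) ^ m) * (single r ⋆ R (replicate m r ++ es)) xs
      ≈⟨ trans (*-assoc _ _ _) (*-congˡ (sym (⋆-•ʳ _ (single r) _ xs u))) ⟩
    (1# - t) * (single r ⋆ ((1# - t) ^ m • R (replicate m r ++ es))) xs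
      ≈⟨ *-congˡ (trans (⋆-cong {single r} (λ _ _ → refl) (R-replicate m r es) xs u) (⋆-•ʳ _ (single r) _ xs u)) ⟩
    (1# - t) * (poch m * (single r ⋆ (blk m r ⋆ R es)) xs)
      ≈⟨ *-congˡ (*-congˡ (sym (⋆-assoc (single r) (blk m r) (R es) xs u))) ⟩
    (1# - t) * (poch m * ((single r ⋆ blk m r) ⋆ R es) xs)
      ≈⟨ trans (solve 3 (λ a b c → a :* (b :* c) := b :* (a :* c)) refl _ _ _) (*-congˡ (sym (⋆-•ˡ _ _ (R es) xs u))) ⟩
    poch m * (((1# - t) • (single r ⋆ blk m r)) ⋆ R es) xs
      ≈⟨ *-congˡ (trans (⋆-cong {g = R es} (single-blk m r) (λ _ _ → refl) xs u) (⋆-•ˡ _ _ (R es) xs u)) ⟩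
    poch m * ((1# - t ^ suc m) * (blk (suc m) r ⋆ R es) xs)
      ≈⟨ trans (sym (*-assoc _ _ _)) (*-congʳ (sym (poch-suc m))) ⟩
    poch (suc m) * (blk (suc m) r ⋆ R es) xs ∎

  -- This is P_λ for λ = `part ms`, by `IsHL⇒HL`. The base case is the block of the part 0 on all
  -- remaining variables, hence 1 and not `ε`.
  HL : List ℕ → List ℕ → Carrier
  HL [] xs = 1#
  HL (m ∷ ms) = blk m (suc (length ms)) ⋆ HL ms

  weight : List ℕ → Carrier
  weight [] = 1#
  weight (m ∷ ms) = H (suc (length ms)) m * weight ms

  -- The argument n counts the variables still free, so the final `poch` belongs to the multiplicity
  -- of the part 0.
  pochs : ℕ → List ℕ → Carrier
  pochs n [] = poch n
  pochs n (m ∷ ms) = poch m * pochs (n ∸ m) ms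

  -- Each `E r` is the sum over j of `H r j` times its component `blk j r` of degree j; the
  -- ⋆-product is multiplied out accordingly.
  F-HL : ∀ M xs → Unique xs → F M xs ≈ ∑ (λ ms → weight ms * HL ms xs) (multiplicities M (length xs))
  F-HL zero xs u = solve 0 (con (+ 1) := con (+ 1) :* con (+ 1) :+ con (+ 0)) refl
  F-HL (suc M) xs u = begin
    splitSum (λ S C → E (suc M) S * F M C * D S C) xs
      ≈⟨ splitSum-cong xs term ⟩
    splitSum (λ S C → ∑ (λ j → ∑ (λ ms → f j ms S C) (multiplicities M (n ∸ j))) (upTo (suc n))) xs
      ≈⟨ splitSum-∑ _ (upTo (suc n)) xs ⟩
    ∑ (λ j → splitSum (λ S C → ∑ (λ ms → f j ms S C) (multiplicities M (n ∸ j))) xs) (upTo (suc n))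
      ≈⟨ ∑-cong∈ (upTo (suc n)) (λ {j} _ → trans (splitSum-∑ _ (multiplicities M (n ∸ j)) xs)
           (∑-cong∈ (multiplicities M (n ∸ j)) (λ {ms} m → trans (splitSum-*ˡ _ _ xs)
             (reflexive (≡.cong (λ r → (H (suc r) j * weight ms) * splitSum (λ S C → blk j (suc r) S * HL ms C * D S C) xs) (≡.sym (multiplicities-length M (n ∸ j) m))))))) ⟩
    ∑ (λ j → ∑ (λ ms → weight (j ∷ ms) * HL (j ∷ ms) xs) (multiplicities M (n ∸ j))) (upTo (suc n))
      ≈⟨ ∑-cong∈ (upTo (suc n)) (λ {j} _ → reflexive (≡.sym (∑-map _ (j ∷_) (multiplicities M (n ∸ j))))) ⟩
    ∑ (λ j → ∑ (λ ms → weight ms * HL ms xs) (map (j ∷_) (multiplicities M (n ∸ j)))) (upTo (suc n))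
      ≈⟨ sym (∑-concatMap (λ ms → weight ms * HL ms xs) (λ j → map (j ∷_) (multiplicities M (n ∸ j))) (upTo (suc n))) ⟩
    ∑ (λ ms → weight ms * HL ms xs) (multiplicities (suc M) n) ∎
    where
    n = length xs
    f : ℕ → List ℕ → List ℕ → List ℕ → Carrier
    f j ms S C = (H (suc M) j * weight ms) * (blk j (suc M) S * HL ms C * D S C)
    term : ∀ S C → S ++ C ↭ xs → E (suc M) S * F M C * D S C ≈
      ∑ (λ j → ∑ (λ ms → f j ms S C) (multiplicities M (n ∸ j))) (upTo (suc n))
    term S C p = begin
      E (suc M) S * F M C * D S C
        -- The inserted delta fixes j = `length S`, so that the number of variables left for C
        -- becomes n ∸ j, independent of the splitting.
        ≈⟨ sym (∑-ind (length S) (suc n) (λ j → H (suc M) j * X (suc M) S * F M C * D S C)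
             (s≤s (≡.subst (length S ℕ.≤_) (split-length S C p) (ℕₚ.m≤m+n (length S) (length C))))) ⟩
      ∑ (λ j → ind (length S) j * (H (suc M) j * X (suc M) S * F M C * D S C)) (upTo (suc n))
        ≈⟨ ∑-cong∈ (upTo (suc n)) (λ {j} _ → trans (ind-cong (length S) j (λ e → *-congʳ (*-congˡ (trans
               (F-HL M C (proj₂ (Unique-++⁻ S (Unique-resp-↭ (↭-sym p) u))))
               (reflexive (≡.cong (λ k → ∑ (λ ms → weight ms * HL ms C) (multiplicities M k))
                 (≡.trans (≡.sym (ℕₚ.m+n∸m≡n (length S) (length C))) (≡.cong₂ _∸_ (split-length S C p) e))))))))
             (trans (solve 5 (λ i h x s d → i :* (h :* x :* s :* d) := (h :* (i :* x) :* d) :* s) refl _ _ _ _ _)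
               (trans (sym (∑-*ˡ _ _ (multiplicities M (n ∸ j))))
                 (∑-cong∈ (multiplicities M (n ∸ j)) (λ _ → solve 5 (λ h B d w P → h :* B :* d :* (w :* P) := h :* w :* (B :* P :* d)) refl _ _ _ _ _))))) ⟩
      ∑ (λ j → ∑ (λ ms → f j ms S C) (multiplicities M (n ∸ j))) (upTo (suc n)) ∎

  -- `R-replicate` is applied to each run of equal exponents, the padding zeros being the last run.
  -- The support of `blk m r` forces m variables to the left, so n ∸ m remain for the rest.
  HL-R : ∀ ms xs → Unique xs → sum ms ℕ.≤ length xs →
    pochs (length xs) ms * HL ms xs ≈ (1# - t) ^ length xs * R (part ms ++ replicate (length xs ∸ sum ms) 0) xs
  HL-R [] xs u _ = begin
    poch n * 1#
      ≈⟨ *-congˡ (sym (trans (*-cong (ind-≡ n) (∏-1 xs)) (*-identityˡ _))) ⟩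
    poch n * blk n 0 xs
      ≈⟨ *-congˡ (sym (⋆-identityʳ (blk n 0) xs u)) ⟩
    poch n * (blk n 0 ⋆ R []) xs
      ≈⟨ sym (R-replicate n 0 [] xs u) ⟩
    (1# - t) ^ n * R (replicate n 0 ++ []) xs
      ≈⟨ *-congˡ (reflexive (≡.cong (λ es → R es xs) (++-identityʳ (replicate n 0)))) ⟩
    (1# - t) ^ n * R (replicate n 0) xs ∎
    where
    n = length xs
  HL-R (m ∷ ms) xs u l = begin
    (poch m * pochs (n ∸ m) ms) * (blk m r ⋆ HL ms) xs
      ≈⟨ trans (*-assoc _ _ _) (*-congˡ (sym (⋆-•ʳ _ (blk m r) (HL ms) xs u))) ⟩
    poch m * (blk m r ⋆ (pochs (n ∸ m) ms • HL ms)) xs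
      ≈⟨ *-congˡ (splitSum-cong xs term) ⟩
    poch m * (blk m r ⋆ ((1# - t) ^ (n ∸ m) • R rest)) xs
      ≈⟨ *-congˡ (⋆-•ʳ _ (blk m r) (R rest) xs u) ⟩
    poch m * ((1# - t) ^ (n ∸ m) * (blk m r ⋆ R rest) xs)
      ≈⟨ solve 3 (λ a b c → a :* (b :* c) := b :* (a :* c)) refl _ _ _ ⟩
    (1# - t) ^ (n ∸ m) * (poch m * (blk m r ⋆ R rest) xs)
      ≈⟨ *-congˡ (sym (R-replicate m r rest xs u)) ⟩
    (1# - t) ^ (n ∸ m) * ((1# - t) ^ m * R (replicate m r ++ rest) xs)
      ≈⟨ trans (sym (*-assoc _ _ _)) (*-congʳ (trans (sym (^-+ _ (n ∸ m) m)) (reflexive (≡.cong ((1# - t) ^_) (ℕₚ.m∸n+n≡m m≤n))))) ⟩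
    (1# - t) ^ n * R (replicate m r ++ rest) xs
      ≈⟨ *-congˡ (reflexive (≡.cong (λ es → R es xs) (≡.trans (≡.sym (++-assoc (replicate m r) (part ms) _))
           (≡.cong (λ k → part (m ∷ ms) ++ replicate k 0) (ℕₚ.∸-+-assoc n m (sum ms)))))) ⟩
    (1# - t) ^ n * R (part (m ∷ ms) ++ replicate (n ∸ sum (m ∷ ms)) 0) xs ∎
    where
    n = length xs
    r = suc (length ms)
    rest = part ms ++ replicate (n ∸ m ∸ sum ms) 0
    m≤n : m ℕ.≤ n
    m≤n = ℕₚ.m+n≤o⇒m≤o m l
    term : ∀ S C → S ++ C ↭ xs →
      blk m r S * (pochs (n ∸ m) ms * HL ms C) * D S C ≈ blk m r S * ((1# - t) ^ (n ∸ m) * R rest C) * D S C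
    term S C p = *-congʳ (trans (*-assoc _ _ _) (trans (ind-cong (length S) m (λ e → *-congˡ (ih e))) (sym (*-assoc _ _ _))))
      where
      ih : length S ≡ m → pochs (n ∸ m) ms * HL ms C ≈ (1# - t) ^ (n ∸ m) * R rest C
      ih e = ≡.subst (λ k → pochs k ms * HL ms C ≈ (1# - t) ^ k * R (part ms ++ replicate (k ∸ sum ms) 0) C) |C|
        (HL-R ms C (proj₂ (Unique-++⁻ S (Unique-resp-↭ (↭-sym p) u)))
          (≡.subst (sum ms ℕ.≤_) (≡.sym |C|) (ℕₚ.m+n≤o⇒m≤o∸n (sum ms) (≡.subst (ℕ._≤ n) (ℕₚ.+-comm m (sum ms)) l))))
        where
        |C| : length C ≡ n ∸ m
        |C| = ≡.trans (≡.sym (ℕₚ.m+n∸m≡n (length S) (length C))) (≡.cong₂ _∸_ (split-length S C p) e)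

-- The signed sum over permutations as an iterated ⋆-product.

module Symmetrization {c ℓ} (K : CommutativeRing c ℓ) (V : GenericPoint K) (a b : CommutativeRing.Carrier K) where

  open import Data.Bool.Properties using (T-≡; ¬-not)
  open import Data.Nat using (_<ᵇ_)
  open import Data.List.Relation.Binary.Permutation.Propositional.Properties using (All-resp-↭)
  open import Function using (Equivalence)
  open import Defs using (insertAll; inversions; countLess)
  open UniqueLists
  open SumsAndProducts K
  open ShuffleAlgebra K V
  open MasterIdentity K V a b
  open HallLittlewood K V a b
  open GenericPoint V
  open import Relation.Binary.Reasoning.Setoid setoid

  -- Extends `perms` to arbitrary lists of indices, as induction requires; `perms n` is the case of
  -- `downFrom n`.
  insertions : List ℕ → List (List ℕ)
  insertions [] = [] ∷ []
  insertions (x ∷ xs) = concatMap (insertAll x) (insertions xs)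

  insertAll-↭ : ∀ {x} w {w′} → w′ ∈ insertAll x w → w′ ↭ x ∷ w
  insertAll-↭ [] (here ≡.refl) = ↭-refl
  insertAll-↭ (y ∷ w) (here ≡.refl) = ↭-refl
  insertAll-↭ {x} (y ∷ w) (there m) with ∈-map⁻ (y ∷_) m
  ... | w″ , m′ , ≡.refl = ↭-trans (↭-prep y (insertAll-↭ w m′)) (Perm.swap y x ↭-refl)
  insertions-↭ : ∀ xs {w} → w ∈ insertions xs → w ↭ xs
  insertions-↭ [] (here ≡.refl) = ↭-refl
  insertions-↭ (x ∷ xs) m = go (insertions xs) (insertions-↭ xs) m
    where
    go : ∀ ws → (∀ {w} → w ∈ ws → w ↭ xs) → ∀ {w} → w ∈ concatMap (insertAll x) ws → w ↭ x ∷ xs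
    go (w ∷ ws) e m with ∈-++⁻ (insertAll x w) m
    ... | inj₁ m′ = ↭-trans (insertAll-↭ w m′) (↭-prep x (e (here ≡.refl)))
    ... | inj₂ m′ = go ws (e ∘ there) m′

  pickSum : (ℕ → List ℕ → Carrier) → List ℕ → Carrier
  pickSum f [] = 0#
  pickSum f (x ∷ xs) = f x xs + pickSum (λ y r → f y (x ∷ r)) xs

  pickSum-cong : ∀ {f h} xs → (∀ y r → f y r ≈ h y r) → pickSum f xs ≈ pickSum h xs
  pickSum-cong [] e = refl
  pickSum-cong (x ∷ xs) e = +-cong (e x xs) (pickSum-cong xs (λ y r → e y (x ∷ r)))

  -- Permutations are generated by inserting x, whereas `R` peels off a first factor, so they are
  -- regrouped by first entry: either this is x, or x is inserted further back. The second case is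
  -- the same statement for xs, applied to the function `later`.
  ∑-insertions : ∀ T x xs → ∑ T (insertions (x ∷ xs)) ≈ pickSum (λ y r → ∑ (T ∘ (y ∷_)) (insertions r)) (x ∷ xs)
  ∑-insertions T x xs = begin
    ∑ T (concatMap (insertAll x) (insertions xs))
      ≈⟨ ∑-concatMap T (insertAll x) (insertions xs) ⟩
    ∑ (λ w → ∑ T (insertAll x w)) (insertions xs)
      ≈⟨ ∑-cong∈ (insertions xs) (λ {w} _ → first w) ⟩
    ∑ (λ w → T (x ∷ w) + later w) (insertions xs)
      ≈⟨ ∑-+ _ _ (insertions xs) ⟩
    ∑ (T ∘ (x ∷_)) (insertions xs) + ∑ later (insertions xs)
      ≈⟨ +-congˡ (rest xs) ⟩
    pickSum (λ y r → ∑ (T ∘ (y ∷_)) (insertions r)) (x ∷ xs) ∎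
    where
    later : List ℕ → Carrier
    later [] = 0#
    later (y ∷ w) = ∑ (T ∘ (y ∷_)) (insertAll x w)
    first : ∀ w → ∑ T (insertAll x w) ≈ T (x ∷ w) + later w
    first [] = refl
    first (y ∷ w) = +-congˡ (reflexive (∑-map T (y ∷_) (insertAll x w)))
    rest : ∀ xs → ∑ later (insertions xs) ≈ pickSum (λ y r → ∑ (T ∘ (y ∷_)) (insertions (x ∷ r))) xs
    rest [] = +-identityˡ _
    rest (x′ ∷ xs′) = trans (∑-insertions later x′ xs′)
      (pickSum-cong (x′ ∷ xs′) (λ y r → sym (∑-concatMap (T ∘ (y ∷_)) (insertAll x) (insertions r))))

  splitSum-[] : ∀ (f : List ℕ → List ℕ → Carrier) xs → (∀ y S C → f (y ∷ S) C ≈ 0#) → splitSum f xs ≈ f [] xs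
  splitSum-[] f [] e = refl
  splitSum-[] f (x ∷ xs) e = trans (+-cong (trans (splitSum-cong′ xs (λ S C → e x S C)) (splitSum-0 xs))
    (splitSum-[] (λ S C → f S (x ∷ C)) xs (λ y S C → e y S (x ∷ C)))) (+-identityˡ _)

  splitSum-pick : ∀ (f : List ℕ → List ℕ → Carrier) xs → (∀ C → f [] C ≈ 0#) → (∀ y z S C → f (y ∷ z ∷ S) C ≈ 0#) →
    splitSum f xs ≈ pickSum (λ y r → f (y ∷ []) r) xs
  splitSum-pick f [] e₀ e₂ = e₀ []
  splitSum-pick f (x ∷ xs) e₀ e₂ = +-cong (splitSum-[] (λ S C → f (x ∷ S) C) xs (e₂ x))
    (splitSum-pick (λ S C → f S (x ∷ C)) xs (λ C → e₀ (x ∷ C)) (λ y z S C → e₂ y z S (x ∷ C)))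

  summand : List ℕ → List ℕ → Carrier
  summand [] [] = 1#
  summand [] (_ ∷ _) = 0#
  summand (_ ∷ _) [] = 0#
  summand (e ∷ es) (y ∷ ys) = x y ^ e * ∏ (χ y) ys * summand es ys

  -- The first entry of the permutation is the one-element left part of `single e ⋆ R es`; its
  -- product of χ with the remaining entries does not depend on their order and is the weight `D`.
  R-symmetrization : ∀ es xs → ∑ (summand es) (insertions xs) ≈ R es xs
  R-symmetrization [] [] = +-identityʳ _
  R-symmetrization [] (z ∷ zs) = trans (∑-insertions (summand []) z zs)
    (trans (pickSum-cong (z ∷ zs) (λ y r → ∑-0 (insertions r))) (pick-0 (z ∷ zs)))
    where
    pick-0 : ∀ xs → pickSum (λ _ _ → 0#) xs ≈ 0#
    pick-0 [] = refl
    pick-0 (x ∷ xs) = trans (+-identityˡ _) (pick-0 xs)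
  R-symmetrization (e ∷ es) [] = trans (+-identityʳ _) (sym (trans (*-congʳ (trans (*-congʳ (zeroˡ _)) (zeroˡ _))) (zeroˡ _)))
  R-symmetrization (e ∷ es) (z ∷ zs) = begin
    ∑ (summand (e ∷ es)) (insertions (z ∷ zs))
      ≈⟨ ∑-insertions (summand (e ∷ es)) z zs ⟩
    pickSum (λ y r → ∑ (λ w → x y ^ e * ∏ (χ y) w * summand es w) (insertions r)) (z ∷ zs)
      ≈⟨ pickSum-cong (z ∷ zs) (λ y r → begin
           ∑ (λ w → x y ^ e * ∏ (χ y) w * summand es w) (insertions r)
             ≈⟨ ∑-cong∈ (insertions r) (λ m → *-congʳ (*-congˡ (∏-↭ (χ y) (insertions-↭ r m)))) ⟩
           ∑ (λ w → x y ^ e * ∏ (χ y) r * summand es w) (insertions r)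
             ≈⟨ ∑-*ˡ _ _ (insertions r) ⟩
           x y ^ e * ∏ (χ y) r * ∑ (summand es) (insertions r)
             ≈⟨ *-congˡ (R-symmetrization es r) ⟩
           x y ^ e * ∏ (χ y) r * R es r
             ≈⟨ solve 3 (λ e d r → e :* d :* r := (con (+ 1) :* (e :* con (+ 1))) :* r :* (d :* con (+ 1))) refl _ _ _ ⟩
           single e (y ∷ []) * R es r * D (y ∷ []) r ∎) ⟩
    pickSum (λ y r → single e (y ∷ []) * R es r * D (y ∷ []) r) (z ∷ zs)
      ≈⟨ sym (splitSum-pick (λ S C → single e S * R es C * D S C) (z ∷ zs) (λ C → trans (*-congʳ (trans (*-congʳ (zeroˡ _)) (zeroˡ _))) (zeroˡ _))
           (λ y y′ S C → trans (*-congʳ (trans (*-congʳ (zeroˡ _)) (zeroˡ _))) (zeroˡ _))) ⟩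
    R (e ∷ es) (z ∷ zs) ∎

  sgn : ℕ → Carrier
  sgn zero = 1#
  sgn (suc n) = - sgn n

  sgn-+ : ∀ m n → sgn (m ℕ.+ n) ≈ sgn m * sgn n
  sgn-+ zero n = sym (*-identityˡ _)
  sgn-+ (suc m) n = trans (-‿cong (sgn-+ m n)) (solve 2 (λ a b → :- (a :* b) := (:- a) :* b) refl _ _)

  sgn-sq : ∀ n → sgn n * sgn n ≈ 1#
  sgn-sq zero = *-identityˡ _
  sgn-sq (suc n) = trans (solve 1 (λ a → (:- a) :* (:- a) := a :* a) refl _) (sgn-sq n)

  ∏-flip : ∀ n w → ∏ (λ i → x n - x i) w ≈ sgn (length w) * ∏ (λ i → x i - x n) w
  ∏-flip n [] = sym (*-identityˡ _)
  ∏-flip n (i ∷ w) = trans (*-congˡ (∏-flip n w))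
    (solve 4 (λ a b s p → (a :- b) :* (s :* p) := (:- s) :* ((b :- a) :* p)) refl (x n) (x i) _ _)

  vdm : List ℕ → Carrier
  vdm [] = 1#
  vdm (y ∷ ys) = ∏ (λ j → x y - x j) ys * vdm ys

  <ᵇ-true : ∀ {m n} → m ℕ.< n → (m <ᵇ n) ≡ true
  <ᵇ-true p = Equivalence.to T-≡ (ℕₚ.<⇒<ᵇ p)

  <ᵇ-false : ∀ {m n} → n ℕ.≤ m → (m <ᵇ n) ≡ false
  <ᵇ-false {m} {n} p = ¬-not (λ e → ℕₚ.≤⇒≯ p (ℕₚ.<ᵇ⇒< m n (Equivalence.from T-≡ e)))

  countLess-all : ∀ {n} w → All (ℕ._< n) w → countLess n w ≡ length w
  countLess-all [] [] = ≡.refl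
  countLess-all {n} (y ∷ w) (p ∷ ps) rewrite <ᵇ-true p = ≡.cong suc (countLess-all w ps)

  countLess-insertAll : ∀ {n} y w {w′} → y ℕ.≤ n → w′ ∈ insertAll n w → countLess y w′ ≡ countLess y w
  countLess-insertAll y [] y≤n (here ≡.refl) rewrite <ᵇ-false y≤n = ≡.refl
  countLess-insertAll y (z ∷ w) y≤n (here ≡.refl) rewrite <ᵇ-false y≤n = ≡.refl
  countLess-insertAll y (z ∷ w) y≤n (there m) with ∈-map⁻ (z ∷_) m
  ... | w″ , m′ , ≡.refl with z <ᵇ y
  ...   | true = ≡.cong suc (countLess-insertAll y w y≤n m′)
  ...   | false = countLess-insertAll y w y≤n m′

  -- As n exceeds all entries, exactly the entries behind it form new inversions, and for exactly
  -- these the factor is x n - x i instead of x i - x n. The signs cancel.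
  vdm-insertAll : ∀ {n} w {w′} → All (ℕ._< n) w → w′ ∈ insertAll n w →
    sgn (inversions w′) * vdm w′ ≈ sgn (inversions w) * (∏ (λ i → x i - x n) w * vdm w)
  vdm-insertAll {n} w lt m = go w lt m
    where
    front : ∀ w → All (ℕ._< n) w → sgn (inversions (n ∷ w)) * vdm (n ∷ w) ≈ sgn (inversions w) * (∏ (λ i → x i - x n) w * vdm w)
    front w lt = begin
      sgn (countLess n w ℕ.+ inversions w) * (∏ (λ i → x n - x i) w * vdm w)
        ≈⟨ *-cong (trans (sgn-+ (countLess n w) (inversions w)) (*-congʳ (reflexive (≡.cong sgn (countLess-all w lt))))) (*-congʳ (∏-flip n w)) ⟩
      (sgn (length w) * sgn (inversions w)) * ((sgn (length w) * ∏ (λ i → x i - x n) w) * vdm w)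
        ≈⟨ solve 4 (λ s i p v → (s :* i) :* ((s :* p) :* v) := (s :* s) :* (i :* (p :* v))) refl _ _ _ _ ⟩
      (sgn (length w) * sgn (length w)) * (sgn (inversions w) * (∏ (λ i → x i - x n) w * vdm w))
        ≈⟨ trans (*-congʳ (sgn-sq (length w))) (*-identityˡ _) ⟩
      sgn (inversions w) * (∏ (λ i → x i - x n) w * vdm w) ∎
    go : ∀ w {w′} → All (ℕ._< n) w → w′ ∈ insertAll n w →
      sgn (inversions w′) * vdm w′ ≈ sgn (inversions w) * (∏ (λ i → x i - x n) w * vdm w)
    go [] lt (here ≡.refl) = front [] lt
    go (y ∷ w) lt (here ≡.refl) = front (y ∷ w) lt
    go (y ∷ w) (p ∷ lt) (there m) with ∈-map⁻ (y ∷_) m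
    ... | w″ , m′ , ≡.refl = begin
      sgn (countLess y w″ ℕ.+ inversions w″) * (∏ (λ j → x y - x j) w″ * vdm w″)
        ≈⟨ *-cong (trans (sgn-+ (countLess y w″) (inversions w″)) (*-congʳ (reflexive (≡.cong sgn (countLess-insertAll y w (ℕₚ.<⇒≤ p) m′)))))
                  (*-congʳ (∏-↭ _ (insertAll-↭ w m′))) ⟩
      (s * sgn (inversions w″)) * (((x y - x n) * ∏ (λ j → x y - x j) w) * vdm w″)
        ≈⟨ solve 5 (λ s i d p v → (s :* i) :* ((d :* p) :* v) := s :* d :* p :* (i :* v)) refl _ _ _ _ _ ⟩
      s * (x y - x n) * ∏ (λ j → x y - x j) w * (sgn (inversions w″) * vdm w″)
        ≈⟨ *-congˡ (go w lt m′) ⟩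
      s * (x y - x n) * ∏ (λ j → x y - x j) w * (sgn (inversions w) * (∏ (λ i → x i - x n) w * vdm w))
        ≈⟨ solve 6 (λ s d p i q v → s :* d :* p :* (i :* (q :* v)) := (s :* i) :* ((d :* q) :* (p :* v))) refl _ _ _ _ _ _ ⟩
      (s * sgn (inversions w)) * (((x y - x n) * ∏ (λ i → x i - x n) w) * (∏ (λ j → x y - x j) w * vdm w))
        ≈⟨ *-congʳ (sym (sgn-+ (countLess y w) (inversions w))) ⟩
      sgn (inversions (y ∷ w)) * (((x y - x n) * ∏ (λ i → x i - x n) w) * (∏ (λ j → x y - x j) w * vdm w)) ∎
      where s = sgn (countLess y w)

  -- On a decreasing list the head is the largest index, so every factor is x i - x j with i < j, as
  -- in `vandermonde`.
  Δ : List ℕ → Carrier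
  Δ [] = 1#
  Δ (n ∷ ns) = ∏ (λ i → x i - x n) ns * Δ ns

  Decr : List ℕ → Set
  Decr = AllPairs (λ m n → n ℕ.< m)

  vdm-insertions : ∀ ns → Decr ns → ∀ {w} → w ∈ insertions ns → sgn (inversions w) * vdm w ≈ Δ ns
  vdm-insertions [] [] (here ≡.refl) = *-identityˡ _
  vdm-insertions (n ∷ ns) (p ∷ ps) m = go (insertions ns) (λ m′ → m′) m
    where
    go : ∀ ws → (∀ {w} → w ∈ ws → w ∈ insertions ns) → ∀ {w} → w ∈ concatMap (insertAll n) ws → sgn (inversions w) * vdm w ≈ Δ (n ∷ ns)
    go (w ∷ ws) e m with ∈-++⁻ (insertAll n w) m
    ... | inj₂ m′ = go ws (e ∘ there) m′
    ... | inj₁ m′ = begin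
      _ ≈⟨ vdm-insertAll w (All-resp-↭ (↭-sym w↭) p) m′ ⟩
      sgn (inversions w) * (∏ (λ i → x i - x n) w * vdm w)
        ≈⟨ solve 3 (λ a b c → a :* (b :* c) := b :* (a :* c)) refl _ _ _ ⟩
      ∏ (λ i → x i - x n) w * (sgn (inversions w) * vdm w)
        ≈⟨ *-cong (∏-↭ _ w↭) (vdm-insertions ns ps (e (here ≡.refl))) ⟩
      Δ (n ∷ ns) ∎
      where
      w↭ : w ↭ ns
      w↭ = insertions-↭ ns (e (here ≡.refl))

  monomial : List ℕ → List ℕ → Carrier
  monomial [] [] = 1#
  monomial [] (_ ∷ _) = 0#
  monomial (_ ∷ _) [] = 0#
  monomial (e ∷ es) (y ∷ ys) = x y ^ e * monomial es ys

  tvdm : List ℕ → Carrier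
  tvdm [] = 1#
  tvdm (y ∷ ys) = ∏ (λ j → x y - t * x j) ys * tvdm ys

  vdm-summand : ∀ es ys → Unique ys → vdm ys * summand es ys ≈ monomial es ys * tvdm ys
  vdm-summand [] [] _ = refl
  vdm-summand [] (_ ∷ _) _ = trans (zeroʳ _) (sym (zeroˡ _))
  vdm-summand (_ ∷ _) [] _ = trans (zeroʳ _) (sym (zeroˡ _))
  vdm-summand (e ∷ es) (y ∷ ys) (y∉ ∷ u) = begin
    (∏ (λ j → x y - x j) ys * vdm ys) * (x y ^ e * ∏ (χ y) ys * summand es ys)
      ≈⟨ solve 5 (λ p v q c s → (p :* v) :* (q :* c :* s) := q :* (c :* p) :* (v :* s)) refl _ _ _ _ _ ⟩
    x y ^ e * (∏ (χ y) ys * ∏ (λ j → x y - x j) ys) * (vdm ys * summand es ys)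
      ≈⟨ *-cong (*-congˡ (trans (sym (∏-* _ _ ys)) (∏-cong∈ ys (λ m → χˡ (All.lookup y∉ m))))) (vdm-summand es ys u) ⟩
    x y ^ e * ∏ (λ j → x y - t * x j) ys * (monomial es ys * tvdm ys)
      ≈⟨ solve 4 (λ a b c d → a :* b :* (c :* d) := a :* c :* (b :* d)) refl _ _ _ _ ⟩
    (x y ^ e * monomial es ys) * (∏ (λ j → x y - t * x j) ys * tvdm ys) ∎

  -- Since ε(w) w(a_δ) = a_δ, in each term the factor `Δ ns` may be exchanged for the signed
  -- `vdm w`, which clears the denominators of the χ.
  Δ-R : ∀ es ns → Decr ns →
    ∑ (λ w → sgn (inversions w) * (monomial es w * tvdm w)) (insertions ns) ≈ Δ ns * R es ns
  Δ-R es ns d = begin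
    ∑ (λ w → sgn (inversions w) * (monomial es w * tvdm w)) (insertions ns)
      ≈⟨ ∑-cong∈ (insertions ns) (λ {w} m → trans
           (*-congˡ (sym (vdm-summand es w (Unique-resp-↭ (↭-sym (insertions-↭ ns m)) Decr-Unique))))
           (trans (sym (*-assoc _ _ _)) (*-congʳ (vdm-insertions ns d m)))) ⟩
    ∑ (λ w → Δ ns * summand es w) (insertions ns)
      ≈⟨ trans (∑-*ˡ _ _ (insertions ns)) (*-congˡ (R-symmetrization es ns)) ⟩
    Δ ns * R es ns ∎
    where
    Decr-Unique : Unique ns
    Decr-Unique = AllPairs.map (λ lt e → ℕₚ.<⇒≢ lt (≡.sym e)) d

-- Lower bounds for the x-adic order.

module Filtrations {c ℓ} (K : CommutativeRing c ℓ) (V : GenericPoint K) (a b : CommutativeRing.Carrier K) where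

  open import Defs using (evenb)
  open Partitions using (size)
  open SumsAndProducts K
  open ShuffleAlgebra K V
  open ShuffleIdentities K V
  open Littlewood K V
  open MasterIdentity K V a b
  open HallLittlewood K V a b
  open GenericPoint V

  -- `Ord N u` reads: the x-adic order of u is at least N. The inverses of x i - x j have order -1,
  -- which is why χ, a quotient of order 0, is treated as a whole.
  record Filtration p : Set (c ⊔ ℓ ⊔ Level.suc p) where
    field
      Ord : ℕ → Carrier → Set p
      Ord-resp : ∀ {N u v} → u ≈ v → Ord N u → Ord N v
      Ord-≤ : ∀ {M N u} → M ℕ.≤ N → Ord N u → Ord M u
      Ord-0 : ∀ {N} → Ord N 0#
      Ord-1 : Ord 0 1#
      Ord-+ : ∀ {N u v} → Ord N u → Ord N v → Ord N (u + v)
      Ord-neg : ∀ {N u} → Ord N u → Ord N (- u)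
      Ord-* : ∀ {M N u v} → Ord M u → Ord N v → Ord (M ℕ.+ N) (u * v)
      Ord-a : Ord 0 a
      Ord-b : Ord 0 b
      Ord-t : Ord 0 t
      Ord-x : ∀ i → Ord 1 (x i)
      Ord-χ : ∀ i j → Ord 0 (χ i j)
      Ord-1/[1-*] : ∀ i j → Ord 0 1/[1- i * j ]

  module _ {p} (Fil : Filtration p) where
    open Filtration Fil

    Ord₀-* : ∀ {u v} → Ord 0 u → Ord 0 v → Ord 0 (u * v)
    Ord₀-* = Ord-*

    Ord-*ˡ : ∀ {N u v} → Ord N u → Ord 0 v → Ord N (u * v)
    Ord-*ˡ {N} {u} {v} p q = ≡.subst (λ M → Ord M (u * v)) (ℕₚ.+-identityʳ N) (Ord-* p q)

    Ord-^ : ∀ {u} n → Ord 0 u → Ord 0 (u ^ n)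
    Ord-^ zero p = Ord-1
    Ord-^ (suc n) p = Ord₀-* p (Ord-^ n p)

    Ord-x^ : ∀ i n → Ord n (x i ^ n)
    Ord-x^ i zero = Ord-1
    Ord-x^ i (suc n) = Ord-* (Ord-x i) (Ord-x^ i n)

    Ord-∏ : ∀ {i} {I : Set i} {φ : I → Carrier} is → (∀ i → Ord 0 (φ i)) → Ord 0 (∏ φ is)
    Ord-∏ [] p = Ord-1
    Ord-∏ (i ∷ is) p = Ord₀-* (p i) (Ord-∏ is p)

    Ord-x₀ : ∀ i → Ord 0 (x i)
    Ord-x₀ i = Ord-≤ z≤n (Ord-x i)

    Ord-X : ∀ r S → Ord (length S ℕ.* r) (X r S)
    Ord-X r [] = Ord-1
    Ord-X r (i ∷ S) = Ord-* (Ord-x^ i r) (Ord-X r S)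

    Ord-D : ∀ S C → Ord 0 (D S C)
    Ord-D S C = Ord-∏ S (λ i → Ord-∏ C (Ord-χ i))

    Ord-splitSum : ∀ {N} {f : List ℕ → List ℕ → Carrier} xs → (∀ S C → Ord N (f S C)) → Ord N (splitSum f xs)
    Ord-splitSum [] p = p [] []
    Ord-splitSum (x ∷ xs) p = Ord-+ (Ord-splitSum xs (λ S C → p (x ∷ S) C)) (Ord-splitSum xs (λ S C → p S (x ∷ C)))

    Ord-∑ : ∀ {i} {I : Set i} {N} {f : I → Carrier} is → (∀ i → Ord N (f i)) → Ord N (∑ f is)
    Ord-∑ [] p = Ord-0
    Ord-∑ (i ∷ is) p = Ord-+ (p i) (Ord-∑ is p)

    Ord-g : ∀ i → Ord 0 (g i)
    Ord-g i = Ord₀-* (Ord-+ Ord-1 (Ord₀-* Ord-a (Ord-x₀ i))) (Ord-+ Ord-1 (Ord₀-* Ord-b (Ord-x₀ i)))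

    Ord-Ψ : ∀ S → Ord 0 (Ψ S)
    Ord-Ψ [] = Ord-1
    Ord-Ψ (i ∷ S) = Ord₀-* (Ord-∏ S (λ j → Ord₀-* (Ord-+ Ord-1 (Ord-neg (Ord₀-* Ord-t (Ord₀-* (Ord-x₀ i) (Ord-x₀ j))))) (Ord-1/[1-*] i j))) (Ord-Ψ S)

    Ord-Φ : ∀ S → Ord 0 (Φ S)
    Ord-Φ S = Ord₀-* (Ord-∏ S (λ i → Ord₀-* (Ord-g i) (Ord-1/[1-*] i i))) (Ord-Ψ S)

    Ord-tail : ∀ k C → Ord 0 (tail k C)
    Ord-tail zero [] = Ord-1
    Ord-tail zero (_ ∷ _) = Ord-0
    Ord-tail (suc k) C = Ord-splitSum C (λ S C → Ord₀-* (Ord₀-* (Ord-∏ S (λ i → Ord₀-* (Ord-^ (dbl k) (Ord-x₀ i)) (Ord-g i))) (Ord-tail k C)) (Ord-D S C))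

    Ord-Φ-F : ∀ k xs → Unique xs → Ord (dbl k) (Φ xs - F (dbl k) xs)
    Ord-Φ-F k xs u = Ord-resp (sym (Φ-F k xs u)) (Ord-splitSum xs term)
      where
      term : ∀ S C → Ord (dbl k) (X (dbl k) S * (Φ S - 1#) * tail k C * D S C)
      term [] C = Ord-resp (sym (trans (*-congʳ (trans (*-congʳ (trans (*-congˡ (trans (+-congʳ (*-identityˡ _)) (-‿inverseʳ _))) (zeroʳ _))) (zeroˡ _))) (zeroˡ _))) Ord-0
      term (i ∷ S) C = Ord-*ˡ (Ord-*ˡ (Ord-*ˡ
        (Ord-≤ (ℕₚ.m≤m+n (dbl k) _) (Ord-X (dbl k) (i ∷ S)))
        (Ord-+ (Ord-Φ (i ∷ S)) (Ord-neg Ord-1))) (Ord-tail k C)) (Ord-D (i ∷ S) C)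

    Ord-ind : ∀ m n → Ord 0 (ind m n)
    Ord-ind zero zero = Ord-1
    Ord-ind zero (suc n) = Ord-0
    Ord-ind (suc m) zero = Ord-0
    Ord-ind (suc m) (suc n) = Ord-ind m n

    Ord-blk : ∀ m r S → Ord (m ℕ.* r) (blk m r S)
    Ord-blk m r S with length S ℕ.≟ m
    ... | yes ≡.refl = Ord-* (Ord-ind (length S) m) (Ord-X r S)
    ... | no ne = Ord-resp (sym (trans (*-congʳ (ind-≢ ne)) (zeroˡ _))) Ord-0

    Ord-HL : ∀ ms xs → Ord (size ms) (HL ms xs)
    Ord-HL [] xs = Ord-1
    Ord-HL (m ∷ ms) xs = Ord-splitSum xs (λ S C → Ord-*ˡ (Ord-* (Ord-blk m _ S) (Ord-HL ms C)) (Ord-D S C))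

    Ord-gauss : ∀ n {w} → (∀ k → Ord 0 (w k)) → Ord 0 (gauss w n)
    Ord-gauss zero p = p 0
    Ord-gauss (suc n) p = Ord-+ (Ord-gauss n (p ∘ suc)) (Ord-gauss n (λ k → Ord₀-* (Ord-^ k Ord-t) (p k)))

    Ord-H : ∀ r m → Ord 0 (H r m)
    Ord-H r m with evenb r
    ... | true = Ord-gauss m (λ k → Ord-^ k (Ord₀-* Ord-a Ord-b))
    ... | false = Ord-gauss m (λ k → Ord₀-* (Ord-^ (m ∸ k) Ord-a) (Ord-^ k Ord-b))

    Ord-weight : ∀ ms → Ord 0 (weight ms)
    Ord-weight [] = Ord-1
    Ord-weight (m ∷ ms) = Ord₀-* (Ord-H (suc (length ms)) m) (Ord-weight ms)

open Filtrations using (Filtration)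

-- The commutative ring of polynomials given as formal sums.

module PolynomialRing where

  open import Data.Bool using (_∧_; T)
  open import Data.Empty using (⊥-elim)
  open import Data.Nat using (_≡ᵇ_)
  open import Data.Integer as ℤ using (ℤ; +_; -_) renaming (_+_ to _+ℤ_; _*_ to _*ℤ_)
  open import Data.Integer.Solver using (module +-*-Solver)
  open import Relation.Binary.PropositionalEquality using (refl; sym; trans; cong; cong₂; subst)
  open import Defs hiding (T)

  open +-*-Solver using (solve; _:+_; _:*_; :-_; _:=_)
  open ≡.≡-Reasoning

  infix 4 _≋_
  -- Equality of exponents up to trailing zeros, decided by `monEq`.
  _≋_ : Mon → Mon → Set
  m ≋ k = ∀ i → at m i ≡ at k i

  T-ext : ∀ {b c} → (T b → T c) → (T c → T b) → b ≡ c
  T-ext {true} {true} f g = refl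
  T-ext {true} {false} f g = ⊥-elim (f tt)
  T-ext {false} {true} f g = ⊥-elim (g tt)
  T-ext {false} {false} f g = refl

  ∧-intro : ∀ {b c} → T b → T c → T (b ∧ c)
  ∧-intro {true} _ q = q

  ∧-elim : ∀ {b c} → T (b ∧ c) → T b × T c
  ∧-elim {true} q = tt , q

  ≡ᵇ-elim : ∀ {m n} → T (m ≡ᵇ n) → m ≡ n
  ≡ᵇ-elim {m} {n} = ℕₚ.≡ᵇ⇒≡ m n

  ≡ᵇ-intro : ∀ {m n} → m ≡ n → T (m ≡ᵇ n)
  ≡ᵇ-intro {m} {n} = ℕₚ.≡⇒≡ᵇ m n

  monEq⇒≋ : ∀ m k → T (monEq m k) → m ≋ k
  monEq⇒≋ [] [] e i = refl
  monEq⇒≋ [] (y ∷ ys) e zero = sym (≡ᵇ-elim (proj₁ (∧-elim e)))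
  monEq⇒≋ [] (y ∷ ys) e (suc i) = monEq⇒≋ [] ys (proj₂ (∧-elim {y ≡ᵇ 0} e)) i
  monEq⇒≋ (x ∷ xs) [] e zero = ≡ᵇ-elim (proj₁ (∧-elim e))
  monEq⇒≋ (x ∷ xs) [] e (suc i) = monEq⇒≋ xs [] (proj₂ (∧-elim {x ≡ᵇ 0} e)) i
  monEq⇒≋ (x ∷ xs) (y ∷ ys) e zero = ≡ᵇ-elim (proj₁ (∧-elim e))
  monEq⇒≋ (x ∷ xs) (y ∷ ys) e (suc i) = monEq⇒≋ xs ys (proj₂ (∧-elim {x ≡ᵇ y} e)) i

  ≋⇒monEq : ∀ m k → m ≋ k → T (monEq m k)
  ≋⇒monEq [] [] e = tt
  ≋⇒monEq [] (y ∷ ys) e = ∧-intro (≡ᵇ-intro (sym (e 0))) (≋⇒monEq [] ys (e ∘ suc))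
  ≋⇒monEq (x ∷ xs) [] e = ∧-intro (≡ᵇ-intro (e 0)) (≋⇒monEq xs [] (e ∘ suc))
  ≋⇒monEq (x ∷ xs) (y ∷ ys) e = ∧-intro (≡ᵇ-intro (e 0)) (≋⇒monEq xs ys (e ∘ suc))

  at-addMon : ∀ m k i → at (addMon m k) i ≡ at m i ℕ.+ at k i
  at-addMon [] k i = refl
  at-addMon (x ∷ xs) [] i = sym (ℕₚ.+-identityʳ _)
  at-addMon (x ∷ xs) (y ∷ ys) zero = refl
  at-addMon (x ∷ xs) (y ∷ ys) (suc i) = at-addMon xs ys i

  addMon-comm : ∀ m k → addMon m k ≡ addMon k m
  addMon-comm [] [] = refl
  addMon-comm [] (y ∷ ys) = refl
  addMon-comm (x ∷ xs) [] = refl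
  addMon-comm (x ∷ xs) (y ∷ ys) = cong₂ _∷_ (ℕₚ.+-comm x y) (addMon-comm xs ys)

  addMon-assoc : ∀ m k l → addMon (addMon m k) l ≡ addMon m (addMon k l)
  addMon-assoc [] k l = refl
  addMon-assoc (x ∷ xs) [] l = refl
  addMon-assoc (x ∷ xs) (y ∷ ys) [] = refl
  addMon-assoc (x ∷ xs) (y ∷ ys) (z ∷ zs) = cong₂ _∷_ (ℕₚ.+-assoc x y z) (addMon-assoc xs ys zs)

  subMon : Mon → Mon → Mon
  subMon [] m = []
  subMon (y ∷ ys) [] = y ∷ ys
  subMon (y ∷ ys) (x ∷ xs) = (y ∸ x) ∷ subMon ys xs

  at-subMon : ∀ k m i → at (subMon k m) i ≡ at k i ∸ at m i
  at-subMon [] m i = sym (ℕₚ.0∸n≡0 (at m i))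
  at-subMon (y ∷ ys) [] i = refl
  at-subMon (y ∷ ys) (x ∷ xs) zero = refl
  at-subMon (y ∷ ys) (x ∷ xs) (suc i) = at-subMon ys xs i

  leqMon : Mon → Mon → Bool
  leqMon [] k = true
  leqMon (x ∷ xs) [] = (x ≡ᵇ 0) ∧ leqMon xs []
  leqMon (x ∷ xs) (y ∷ ys) = (x ≤ᵇ y) ∧ leqMon xs ys

  leqMon-elim : ∀ m k → T (leqMon m k) → ∀ i → at m i ℕ.≤ at k i
  leqMon-elim [] k e i = z≤n
  leqMon-elim (x ∷ xs) [] e zero = ℕₚ.≤-reflexive (≡ᵇ-elim (proj₁ (∧-elim e)))
  leqMon-elim (x ∷ xs) [] e (suc i) = leqMon-elim xs [] (proj₂ (∧-elim {x ≡ᵇ 0} e)) i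
  leqMon-elim (x ∷ xs) (y ∷ ys) e zero = ℕₚ.≤ᵇ⇒≤ x y (proj₁ (∧-elim e))
  leqMon-elim (x ∷ xs) (y ∷ ys) e (suc i) = leqMon-elim xs ys (proj₂ (∧-elim {x ≤ᵇ y} e)) i

  leqMon-intro : ∀ m k → (∀ i → at m i ℕ.≤ at k i) → T (leqMon m k)
  leqMon-intro [] k e = tt
  leqMon-intro (x ∷ xs) [] e = ∧-intro (≡ᵇ-intro (ℕₚ.n≤0⇒n≡0 (e 0))) (leqMon-intro xs [] (e ∘ suc))
  leqMon-intro (x ∷ xs) (y ∷ ys) e = ∧-intro (ℕₚ.≤⇒≤ᵇ (e 0)) (leqMon-intro xs ys (e ∘ suc))

  sub-add : ∀ m k → subMon (addMon m k) m ≋ k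
  sub-add m k i = trans (at-subMon (addMon m k) m i) (trans (cong (_∸ at m i) (at-addMon m k i)) (ℕₚ.m+n∸m≡n (at m i) (at k i)))

  add-sub : ∀ m k → T (leqMon m k) → addMon m (subMon k m) ≋ k
  add-sub m k l i = trans (at-addMon m (subMon k m) i)
    (trans (cong (at m i ℕ.+_) (at-subMon k m i)) (ℕₚ.m+[n∸m]≡n (leqMon-elim m k l i)))

  -- Divisibility turned into a test: x^m x^k = x^l means that x^m divides x^l with quotient x^k.
  -- This makes coefficients of a product into shifted coefficients of one factor.
  monEq-addMon : ∀ m k l → monEq (addMon m k) l ≡ leqMon m l ∧ monEq k (subMon l m)
  monEq-addMon m k l = T-ext to from
    where
    to : T (monEq (addMon m k) l) → T (leqMon m l ∧ monEq k (subMon l m))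
    to e = ∧-intro
      (leqMon-intro m l (λ i → subst (at m i ℕ.≤_) (trans (sym (at-addMon m k i)) (monEq⇒≋ (addMon m k) l e i)) (ℕₚ.m≤m+n _ _)))
      (≋⇒monEq k (subMon l m) (λ i → trans (sym (sub-add m k i)) (trans (at-subMon (addMon m k) m i)
        (trans (cong (_∸ at m i) (monEq⇒≋ (addMon m k) l e i)) (sym (at-subMon l m i))))))
    from : T (leqMon m l ∧ monEq k (subMon l m)) → T (monEq (addMon m k) l)
    from e = ≋⇒monEq (addMon m k) l (λ i → trans (at-addMon m k i) (trans (cong (at m i ℕ.+_) (monEq⇒≋ k (subMon l m) (proj₂ (∧-elim {leqMon m l} e)) i))
      (trans (sym (at-addMon m (subMon l m) i)) (add-sub m l (proj₁ (∧-elim e)) i))))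

  -- The linear functional on formal sums extending φ. A product becomes an iterated functional
  -- (`eval-⊗`), which reduces the ring laws to those of `addMon` and to exchanging finite sums.
  eval : (Mon → ℤ) → Poly → ℤ
  eval φ [] = + 0
  eval φ ((c , m) ∷ p) = c *ℤ φ m +ℤ eval φ p

  δ : Mon → Mon → ℤ
  δ k m = if monEq m k then + 1 else + 0

  coeff-eval : ∀ p k → coeff p k ≡ eval (δ k) p
  coeff-eval [] k = refl
  coeff-eval ((c , m) ∷ p) k with monEq m k
  ... | true = cong₂ _+ℤ_ (sym (ℤₚ.*-identityʳ c)) (coeff-eval p k)
  ... | false = trans (coeff-eval p k) (trans (sym (ℤₚ.+-identityˡ _)) (cong (_+ℤ _) (sym (ℤₚ.*-zeroʳ c))))

  eval-cong : ∀ {φ ψ} p → (∀ m → φ m ≡ ψ m) → eval φ p ≡ eval ψ p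
  eval-cong [] e = refl
  eval-cong ((c , m) ∷ p) e = cong₂ _+ℤ_ (cong (c *ℤ_) (e m)) (eval-cong p e)

  eval-++ : ∀ φ p q → eval φ (p ++ q) ≡ eval φ p +ℤ eval φ q
  eval-++ φ [] q = sym (ℤₚ.+-identityˡ _)
  eval-++ φ ((c , m) ∷ p) q = trans (cong (c *ℤ φ m +ℤ_) (eval-++ φ p q)) (sym (ℤₚ.+-assoc (c *ℤ φ m) (eval φ p) (eval φ q)))

  eval-+ : ∀ φ ψ p → eval (λ m → φ m +ℤ ψ m) p ≡ eval φ p +ℤ eval ψ p
  eval-+ φ ψ [] = refl
  eval-+ φ ψ ((c , m) ∷ p) = trans (cong (c *ℤ (φ m +ℤ ψ m) +ℤ_) (eval-+ φ ψ p))
    (solve 5 (λ c a b p q → c :* (a :+ b) :+ (p :+ q) := c :* a :+ p :+ (c :* b :+ q)) refl c (φ m) (ψ m) (eval φ p) (eval ψ p))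

  eval-*ˡ : ∀ k φ p → eval (λ m → k *ℤ φ m) p ≡ k *ℤ eval φ p
  eval-*ˡ k φ [] = sym (ℤₚ.*-zeroʳ k)
  eval-*ˡ k φ ((c , m) ∷ p) = trans (cong (c *ℤ (k *ℤ φ m) +ℤ_) (eval-*ˡ k φ p))
    (solve 4 (λ c k f p → c :* (k :* f) :+ k :* p := k :* (c :* f :+ p)) refl c k (φ m) (eval φ p))

  eval-0 : ∀ p → eval (λ _ → + 0) p ≡ + 0
  eval-0 [] = refl
  eval-0 ((c , m) ∷ p) = trans (cong₂ _+ℤ_ (ℤₚ.*-zeroʳ c) (eval-0 p)) refl

  eval-swap : ∀ (ψ : Mon → Mon → ℤ) p q → eval (λ m → eval (ψ m) q) p ≡ eval (λ m′ → eval (λ m → ψ m m′) p) q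
  eval-swap ψ [] q = sym (eval-0 q)
  eval-swap ψ ((c , m) ∷ p) q = trans (cong₂ _+ℤ_ (sym (eval-*ˡ c (ψ m) q)) (eval-swap ψ p q)) (sym (eval-+ (λ m′ → c *ℤ ψ m m′) (λ m′ → eval (λ m → ψ m m′) p) q))

  -- The two auxiliary functions stand for the anonymous ones in the definitions of _⊗_ and neg.

  eval-map-scale : ∀ φ c m q r (f : ℤ × Mon → ℤ × Mon) → (∀ c′ m′ → f (c′ , m′) ≡ (c *ℤ c′ , addMon m m′)) →
    eval φ (map f q ++ r) ≡ c *ℤ eval (λ m′ → φ (addMon m m′)) q +ℤ eval φ r
  eval-map-scale φ c m [] r f e = sym (trans (cong (_+ℤ _) (ℤₚ.*-zeroʳ c)) (ℤₚ.+-identityˡ _))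
  eval-map-scale φ c m ((c′ , m′) ∷ q) r f e rewrite e c′ m′ = trans (cong (c *ℤ c′ *ℤ φ (addMon m m′) +ℤ_) (eval-map-scale φ c m q r f e))
    (solve 5 (λ c c′ a b d → c :* c′ :* a :+ (c :* b :+ d) := c :* (c′ :* a :+ b) :+ d) refl c c′ (φ (addMon m m′)) (eval (λ m′ → φ (addMon m m′)) q) (eval φ r))

  eval-⊗ : ∀ φ p q → eval φ (p ⊗ q) ≡ eval (λ m → eval (λ m′ → φ (addMon m m′)) q) p
  eval-⊗ φ [] q = refl
  eval-⊗ φ ((c , m) ∷ p) q = trans (eval-map-scale φ c m q (p ⊗ q) _ (λ _ _ → refl)) (cong (c *ℤ eval (λ m′ → φ (addMon m m′)) q +ℤ_) (eval-⊗ φ p q))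

  eval-map-neg : ∀ φ p (f : ℤ × Mon → ℤ × Mon) → (∀ c m → f (c , m) ≡ (- c , m)) → eval φ (map f p) ≡ - eval φ p
  eval-map-neg φ [] f e = refl
  eval-map-neg φ ((c , m) ∷ p) f e rewrite e c m = trans (cong (- c *ℤ φ m +ℤ_) (eval-map-neg φ p f e))
    (solve 3 (λ c a b → :- c :* a :+ :- b := :- (c :* a :+ b)) refl c (φ m) (eval φ p))

  eval-neg : ∀ φ p → eval φ (neg p) ≡ - eval φ p
  eval-neg φ p = eval-map-neg φ p _ (λ _ _ → refl)

  shift : Mon → (Mon → ℤ) → Mon → ℤ
  shift m f k = if leqMon m k then f (subMon k m) else + 0

  coeff-⊗ : ∀ p q k → coeff (p ⊗ q) k ≡ eval (λ m → shift m (coeff q) k) p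
  coeff-⊗ p q k = trans (coeff-eval (p ⊗ q) k) (trans (eval-⊗ (δ k) p q) (eval-cong p inner))
    where
    inner : ∀ m → eval (λ m′ → δ k (addMon m m′)) q ≡ shift m (coeff q) k
    inner m with leqMon m k in eq
    ... | true = trans (eval-cong q (λ m′ → cong (λ b → if b then + 1 else + 0) (trans (monEq-addMon m m′ k) (cong (_∧ monEq m′ (subMon k m)) eq)))) (sym (coeff-eval q (subMon k m)))
    ... | false = trans (eval-cong q (λ m′ → cong (λ b → if b then + 1 else + 0) (trans (monEq-addMon m m′ k) (cong (_∧ monEq m′ (subMon k m)) eq)))) (eval-0 q)

  coeff-++ : ∀ p q k → coeff (p ⊕ q) k ≡ coeff p k +ℤ coeff q k
  coeff-++ p q k = trans (coeff-eval (p ++ q) k) (trans (eval-++ (δ k) p q) (sym (cong₂ _+ℤ_ (coeff-eval p k) (coeff-eval q k))))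

  coeff-neg : ∀ p k → coeff (neg p) k ≡ - coeff p k
  coeff-neg p k = trans (coeff-eval (neg p) k) (trans (eval-neg (δ k) p) (cong -_ (sym (coeff-eval p k))))

  coeff-≋ : ∀ p {k l} → k ≋ l → coeff p k ≡ coeff p l
  coeff-≋ [] e = refl
  coeff-≋ ((c , m) ∷ p) {k} {l} e = cong₂ (λ b z → if b then c +ℤ z else z)
    (T-ext (λ t → ≋⇒monEq m l (λ i → trans (monEq⇒≋ m k t i) (e i)))
           (λ t → ≋⇒monEq m k (λ i → trans (monEq⇒≋ m l t i) (sym (e i))))) (coeff-≋ p e)

  eval-ext : ∀ p q → (∀ φ → eval φ p ≡ eval φ q) → p ≈ₚ q
  eval-ext p q e k = trans (coeff-eval p k) (trans (e (δ k)) (sym (coeff-eval q k)))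

  ⊗-comm : ∀ p q → (p ⊗ q) ≈ₚ (q ⊗ p)
  ⊗-comm p q = eval-ext (p ⊗ q) (q ⊗ p) (λ φ → trans (eval-⊗ φ p q) (trans (eval-swap (λ m m′ → φ (addMon m m′)) p q)
    (trans (eval-cong q (λ m′ → eval-cong p (λ m → cong φ (addMon-comm m m′)))) (sym (eval-⊗ φ q p)))))

  -- An arbitrary functional may tell apart monomials that differ by trailing zeros and so need not
  -- respect `≈ₚ`; congruence therefore goes through coefficients.
  ⊗-congˡ : ∀ p {q q′} → q ≈ₚ q′ → (p ⊗ q) ≈ₚ (p ⊗ q′)
  ⊗-congˡ p {q} {q′} e k = trans (coeff-⊗ p q k) (trans (eval-cong p (λ m → cong (λ z → if leqMon m k then z else + 0) (e (subMon k m)))) (sym (coeff-⊗ p q′ k)))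

  ⊗-congʳ : ∀ {p p′} q → p ≈ₚ p′ → (p ⊗ q) ≈ₚ (p′ ⊗ q)
  ⊗-congʳ {p} {p′} q e k = trans (⊗-comm p q k) (trans (⊗-congˡ q {p} {p′} e k) (⊗-comm q p′ k))

  polyRing : CommutativeRing _ _
  polyRing = record
    { Carrier = Poly ; _≈_ = _≈ₚ_ ; _+_ = _⊕_ ; _*_ = _⊗_ ; -_ = neg ; 0# = [] ; 1# = one
    ; isCommutativeRing = record
      { isRing = record
        { +-isAbelianGroup = record
          { isGroup = record
            { isMonoid = record
              { isSemigroup = record
                { isMagma = record
                  { isEquivalence = record { refl = λ k → refl ; sym = λ e k → sym (e k) ; trans = λ e f k → trans (e k) (f k) }
                  ; ∙-cong = λ {p} {p′} {q} {q′} e f k → trans (coeff-++ p q k) (trans (cong₂ _+ℤ_ (e k) (f k)) (sym (coeff-++ p′ q′ k))) }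
                ; assoc = ⊕-assoc }
              ; identity = (λ p k → refl) , ⊕-identityʳ }
            ; inverse = ⊕-inverseˡ , λ p k → trans (⊕-comm p (neg p) k) (⊕-inverseˡ p k)
            ; ⁻¹-cong = λ {p} {q} e k → trans (coeff-neg p k) (trans (cong -_ (e k)) (sym (coeff-neg q k))) }
          ; comm = ⊕-comm }
        ; *-cong = λ {p} {p′} {q} {q′} e f k → trans (⊗-congʳ {p} {p′} q e k) (⊗-congˡ p′ {q} {q′} f k)
        ; *-assoc = assoc
        ; *-identity = identityˡ , (λ p k → trans (⊗-comm p one k) (identityˡ p k))
        ; distrib = distribˡ , (λ r p q k → trans (⊗-comm (p ⊕ q) r k) (trans (distribˡ r p q k)
            (trans (coeff-++ (r ⊗ p) (r ⊗ q) k) (trans (cong₂ _+ℤ_ (⊗-comm r p k) (⊗-comm r q k)) (sym (coeff-++ (p ⊗ r) (q ⊗ r) k)))))) }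
      ; *-comm = ⊗-comm } }
    where
    ⊕-assoc : ∀ p q r → ((p ⊕ q) ⊕ r) ≈ₚ (p ⊕ (q ⊕ r))
    ⊕-assoc p q r k = cong (λ s → coeff s k) (++-assoc p q r)
    ⊕-identityʳ : ∀ p → (p ⊕ []) ≈ₚ p
    ⊕-identityʳ p k = cong (λ s → coeff s k) (++-identityʳ p)
    ⊕-comm : ∀ p q → (p ⊕ q) ≈ₚ (q ⊕ p)
    ⊕-comm p q k = trans (coeff-++ p q k) (trans (ℤₚ.+-comm (coeff p k) (coeff q k)) (sym (coeff-++ q p k)))
    ⊕-inverseˡ : ∀ p → (neg p ⊕ p) ≈ₚ []
    ⊕-inverseˡ p k = trans (coeff-++ (neg p) p k) (trans (cong (_+ℤ coeff p k) (coeff-neg p k)) (ℤₚ.+-inverseˡ (coeff p k)))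
    assoc : ∀ p q r → ((p ⊗ q) ⊗ r) ≈ₚ (p ⊗ (q ⊗ r))
    assoc p q r = eval-ext ((p ⊗ q) ⊗ r) (p ⊗ (q ⊗ r)) (λ φ → begin
      eval φ ((p ⊗ q) ⊗ r)
        ≡⟨ eval-⊗ φ (p ⊗ q) r ⟩
      eval (λ m → eval (λ m″ → φ (addMon m m″)) r) (p ⊗ q)
        ≡⟨ eval-⊗ (λ m → eval (λ m″ → φ (addMon m m″)) r) p q ⟩
      eval (λ m → eval (λ m′ → eval (λ m″ → φ (addMon (addMon m m′) m″)) r) q) p
        ≡⟨ eval-cong p (λ m → trans (eval-cong q (λ m′ → eval-cong r (λ m″ → cong φ (addMon-assoc m m′ m″))))
             (sym (eval-⊗ (λ l → φ (addMon m l)) q r))) ⟩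
      eval (λ m → eval (λ l → φ (addMon m l)) (q ⊗ r)) p
        ≡⟨ sym (eval-⊗ φ p (q ⊗ r)) ⟩
      eval φ (p ⊗ (q ⊗ r)) ∎)
    identityˡ : ∀ p → (one ⊗ p) ≈ₚ p
    identityˡ p = eval-ext (one ⊗ p) p (λ φ → trans (eval-⊗ φ one p) (trans (ℤₚ.+-identityʳ (+ 1 *ℤ eval φ p)) (ℤₚ.*-identityˡ (eval φ p))))
    distribˡ : ∀ p q r → (p ⊗ (q ⊕ r)) ≈ₚ ((p ⊗ q) ⊕ (p ⊗ r))
    distribˡ p q r = eval-ext (p ⊗ (q ⊕ r)) ((p ⊗ q) ⊕ (p ⊗ r)) (λ φ → begin
      eval φ (p ⊗ (q ⊕ r))
        ≡⟨ eval-⊗ φ p (q ⊕ r) ⟩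
      eval (λ m → eval (λ m′ → φ (addMon m m′)) (q ⊕ r)) p
        ≡⟨ eval-cong p (λ m → eval-++ (λ m′ → φ (addMon m m′)) q r) ⟩
      eval (λ m → eval (λ m′ → φ (addMon m m′)) q +ℤ eval (λ m′ → φ (addMon m m′)) r) p
        ≡⟨ eval-+ (λ m → eval (λ m′ → φ (addMon m m′)) q) (λ m → eval (λ m′ → φ (addMon m m′)) r) p ⟩
      eval (λ m → eval (λ m′ → φ (addMon m m′)) q) p +ℤ eval (λ m → eval (λ m′ → φ (addMon m m′)) r) p
        ≡⟨ sym (cong₂ _+ℤ_ (eval-⊗ φ p q) (eval-⊗ φ p r)) ⟩
      eval φ (p ⊗ q) +ℤ eval φ (p ⊗ r)
        ≡⟨ sym (eval-++ φ (p ⊗ q) (p ⊗ r)) ⟩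
      eval φ ((p ⊗ q) ⊕ (p ⊗ r)) ∎)

-- The order of a polynomial in the x-variables, and elements that can be divided out.

module Orders where

  open import Data.Bool using (T)
  open import Data.Integer as ℤ using (ℤ; +_; -_; -[1+_]) renaming (_+_ to _+ℤ_; _*_ to _*ℤ_)
  open import Data.List using (drop; foldr)
  open import Relation.Binary.PropositionalEquality using (refl; sym; trans; cong; cong₂; subst)
  open import Defs hiding (T)
  open PolynomialRing
  private module P = CommutativeRing polyRing

  total : List ℕ → ℕ
  total = foldr ℕ._+_ 0

  total-zero : ∀ m → (∀ i → at m i ≡ 0) → total m ≡ 0
  total-zero [] e = refl
  total-zero (x ∷ xs) e = cong₂ ℕ._+_ (e 0) (total-zero xs (e ∘ suc))

  total-≋ : ∀ m k → m ≋ k → total m ≡ total k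
  total-≋ [] k e = sym (total-zero k (λ i → sym (e i)))
  total-≋ (x ∷ xs) [] e = total-zero (x ∷ xs) e
  total-≋ (x ∷ xs) (y ∷ ys) e = cong₂ ℕ._+_ (e 0) (total-≋ xs ys (e ∘ suc))

  total-add : ∀ m k → total (addMon m k) ≡ total m ℕ.+ total k
  total-add [] k = refl
  total-add (x ∷ xs) [] = sym (ℕₚ.+-identityʳ _)
  total-add (x ∷ xs) (y ∷ ys) = trans (cong (x ℕ.+ y ℕ.+_) (total-add xs ys))
    (solve 4 (λ x y a b → x :+ y :+ (a :+ b) := x :+ a :+ (y :+ b)) refl x y (total xs) (total ys))
    where
    open import Data.Nat.Solver using (module +-*-Solver)
    open +-*-Solver

  at-drop : ∀ n m i → at (drop n m) i ≡ at m (n ℕ.+ i)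
  at-drop zero m i = refl
  at-drop (suc n) [] i = refl
  at-drop (suc n) (x ∷ m) i = at-drop n m i

  drop-add : ∀ n m k → drop n (addMon m k) ≡ addMon (drop n m) (drop n k)
  drop-add zero m k = refl
  drop-add (suc n) [] k = refl
  drop-add (suc n) (x ∷ xs) [] = sym (add-[] (drop n xs))
    where
    add-[] : ∀ m → addMon m [] ≡ m
    add-[] [] = refl
    add-[] (_ ∷ _) = refl
  drop-add (suc n) (x ∷ xs) (y ∷ ys) = drop-add n xs ys

  xdeg-≋ : ∀ {m k} → m ≋ k → xdeg m ≡ xdeg k
  xdeg-≋ {m} {k} e = total-≋ (drop 3 m) (drop 3 k) (λ i → trans (at-drop 3 m i) (trans (e (3 ℕ.+ i)) (sym (at-drop 3 k i))))

  xdeg-add : ∀ m k → xdeg (addMon m k) ≡ xdeg m ℕ.+ xdeg k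
  xdeg-add m k = trans (cong total (drop-add 3 m k)) (total-add (drop 3 m) (drop 3 k))

  Ord : ℕ → Poly → Set
  Ord N p = ∀ m → xdeg m ℕ.< N → coeff p m ≡ + 0

  Ord-resp : ∀ {N p q} → p ≈ₚ q → Ord N p → Ord N q
  Ord-resp e o m l = trans (sym (e m)) (o m l)

  Ord-≤ : ∀ {M N p} → M ℕ.≤ N → Ord N p → Ord M p
  Ord-≤ M≤N o m l = o m (ℕₚ.≤-trans l M≤N)

  Ord-⊕ : ∀ {N} p q → Ord N p → Ord N q → Ord N (p ⊕ q)
  Ord-⊕ p q o o′ m l = trans (coeff-++ p q m) (cong₂ _+ℤ_ (o m l) (o′ m l))

  Ord-neg : ∀ {N} p → Ord N p → Ord N (neg p)
  Ord-neg p o m l = trans (coeff-neg p m) (cong -_ (o m l))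

  Ord₀ : ∀ p → Ord 0 p
  Ord₀ p m ()

  -- A formal sum of order N may still contain low terms that cancel; removing them turns a
  -- statement about coefficients into one about every listed term.
  high : ℕ → Poly → Poly
  high N [] = []
  high N ((c , m) ∷ p) = if N ≤ᵇ xdeg m then (c , m) ∷ high N p else high N p

  high-All : ∀ N p → All (λ cm → N ℕ.≤ xdeg (proj₂ cm)) (high N p)
  high-All N [] = []
  high-All N ((c , m) ∷ p) with N ≤ᵇ xdeg m in eq
  ... | true = ℕₚ.≤ᵇ⇒≤ N (xdeg m) (subst T (sym eq) tt) ∷ high-All N p
  ... | false = high-All N p

  coeff-high : ∀ N p k → coeff (high N p) k ≡ (if N ≤ᵇ xdeg k then coeff p k else + 0)
  coeff-high N [] k with N ≤ᵇ xdeg k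
  ... | true = refl
  ... | false = refl
  coeff-high N ((c , m) ∷ p) k with N ≤ᵇ xdeg m in eq | monEq m k in eq′ | coeff-high N p k
  ... | false | false | ih = ih
  ... | true | true | ih rewrite eq′ | trans (cong (N ≤ᵇ_) (sym (xdeg-≋ {m} {k} (monEq⇒≋ m k (subst T (sym eq′) tt))))) eq = cong (c +ℤ_) ih
  ... | true | false | ih rewrite eq′ = ih
  ... | false | true | ih rewrite trans (cong (N ≤ᵇ_) (sym (xdeg-≋ {m} {k} (monEq⇒≋ m k (subst T (sym eq′) tt))))) eq = ih

  high-≈ : ∀ N p → Ord N p → high N p ≈ₚ p
  high-≈ N p o k with N ≤ᵇ xdeg k in eq | coeff-high N p k
  ... | true | e = e
  ... | false | e = trans e (sym (o k (ℕₚ.≰⇒> (λ l → subst T eq (ℕₚ.≤⇒≤ᵇ l)))))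

  eval-All : ∀ {φ} {Q : Mon → Set} p → All (λ cm → Q (proj₂ cm)) p → (∀ m → Q m → φ m ≡ + 0) → eval φ p ≡ + 0
  eval-All [] [] e = refl
  eval-All {φ} ((c , m) ∷ p) (q ∷ qs) e = trans (cong₂ (λ a b → c *ℤ a +ℤ b) (e m q) (eval-All p qs e)) (cong (_+ℤ + 0) (ℤₚ.*-zeroʳ c))

  xdeg-sub : ∀ m k → T (leqMon m k) → xdeg m ℕ.+ xdeg (subMon k m) ≡ xdeg k
  xdeg-sub m k l = trans (sym (xdeg-add m (subMon k m))) (xdeg-≋ {addMon m (subMon k m)} {k} (add-sub m k l))

  -- Once p is replaced by `high M p`, each of its monomials has degree at least M; dividing a
  -- monomial of degree below M + N by it leaves degree below N, where q has no coefficients.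
  Ord-⊗ : ∀ {M N} p q → Ord M p → Ord N q → Ord (M ℕ.+ N) (p ⊗ q)
  Ord-⊗ {M} {N} p q o o′ k l = trans (sym (⊗-congʳ {high M p} {p} q (high-≈ M p o) k)) (trans (coeff-⊗ (high M p) q k)
    (eval-All (high M p) (high-All M p) vanish))
    where
    vanish : ∀ m → M ℕ.≤ xdeg m → shift m (coeff q) k ≡ + 0
    vanish m M≤ with leqMon m k in eq
    ... | false = refl
    ... | true = o′ (subMon k m) (ℕₚ.+-cancelˡ-< (xdeg m) _ _ (ℕₚ.<-≤-trans
      (subst (ℕ._< M ℕ.+ N) (sym (xdeg-sub m k (subst T (sym eq) tt))) l) (ℕₚ.+-monoˡ-≤ N M≤)))

  -- a nonzerodivisor whose initial form, of degree e in the x-variables, is a nonzerodivisor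
  record Good (s : Poly) (e : ℕ) : Set where
    field
      ord : Ord e s
      cancel : ∀ N p → Ord (N ℕ.+ e) (s ⊗ p) → Ord N p

  Good-one : Good one 0
  Good-one = record { ord = Ord₀ one ; cancel = λ N p o → Ord-resp {p = one ⊗ p} {p} (P.*-identityˡ p) (Ord-≤ {p = one ⊗ p} (ℕₚ.m≤m+n N 0) o) }

  Good-⊗ : ∀ {s s′ e e′} → Good s e → Good s′ e′ → Good (s ⊗ s′) (e ℕ.+ e′)
  Good-⊗ {s} {s′} {e} {e′} g g′ = record
    { ord = Ord-⊗ s s′ (Good.ord g) (Good.ord g′)
    ; cancel = λ N p o → Good.cancel g′ N p (Good.cancel g (N ℕ.+ e′) (s′ ⊗ p)
        (subst (λ n → Ord n (s ⊗ (s′ ⊗ p))) (trans (cong (N ℕ.+_) (ℕₚ.+-comm e e′)) (sym (ℕₚ.+-assoc N e′ e)))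
          (Ord-resp {p = (s ⊗ s′) ⊗ p} {s ⊗ (s′ ⊗ p)} (P.*-assoc s s′ p) o))) }

  -- A vanishing product has every order, so p has order beyond the degree of any given monomial.
  Good-nonzerodivisor : ∀ {s e} → Good s e → ∀ p → (s ⊗ p) ≈ₚ [] → p ≈ₚ []
  Good-nonzerodivisor {s} g p z m = Good.cancel g (suc (xdeg m)) p (λ k _ → z k) m ℕₚ.≤-refl

  mono : Mon → Poly
  mono m = (+ 1 , m) ∷ []

  binomial : Mon → Mon → Poly
  binomial m k = (+ 1 , m) ∷ (-[1+ 0 ] , k) ∷ []

  leq-add : ∀ m k → T (leqMon m (addMon m k))
  leq-add m k = leqMon-intro m (addMon m k) (λ i → subst (at m i ℕ.≤_) (sym (at-addMon m k i)) (ℕₚ.m≤m+n _ _))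

  shift-add : ∀ m p k → shift m (coeff p) (addMon m k) ≡ coeff p k
  shift-add m p k with leqMon m (addMon m k) in eq
  ... | true = coeff-≋ p {subMon (addMon m k) m} {k} (sub-add m k)
  ... | false = contradiction (subst T eq (leq-add m k)) (λ ())

  Ord-head : ∀ {c m p} → Ord (xdeg m) p → Ord (xdeg m) ((c , m) ∷ p)
  Ord-head {c} {m} o k l with monEq m k in eq
  ... | true = contradiction (xdeg-≋ {m} {k} (monEq⇒≋ m k (subst T (sym eq) tt))) (λ e → ℕₚ.<⇒≢ l (sym e))
  ... | false = o k l

  Good-mono : ∀ m → Good (mono m) (xdeg m)
  Good-mono m = record
    { ord = Ord-head {+ 1} {m} {[]} (λ _ _ → refl)
    ; cancel = λ N p o k l → trans (sym (trans (coeff-⊗ (mono m) p (addMon m k)) (trans (ℤₚ.+-identityʳ _) (trans (ℤₚ.*-identityˡ _) (shift-add m p k)))))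
        (o (addMon m k) (subst (ℕ._< N ℕ.+ xdeg m) (sym (trans (xdeg-add m k) (ℕₚ.+-comm (xdeg m) (xdeg k)))) (ℕₚ.+-monoˡ-< (xdeg m) l))) }

  -- The coefficient of x^k in p is pushed to smaller exponents in coordinate j until it vanishes.
  Good-binomial : ∀ m₀ m₁ j → at m₀ j ℕ.< at m₁ j → xdeg m₀ ℕ.≤ xdeg m₁ → Good (binomial m₀ m₁) (xdeg m₀)
  Good-binomial m₀ m₁ j lt le = record
    { ord = Ord-head {+ 1} {m₀} {(-[1+ 0 ] , m₁) ∷ []} (Ord-≤ {p = (-[1+ 0 ] , m₁) ∷ []} le (Ord-head { -[1+ 0 ]} {m₁} {[]} (λ _ _ → refl)))
    ; cancel = λ N p o k l → go N p o (suc (at k j)) k ℕₚ.≤-refl l }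
    where
    go : ∀ N p → Ord (N ℕ.+ xdeg m₀) (binomial m₀ m₁ ⊗ p) → ∀ fuel k → at k j ℕ.< fuel → xdeg k ℕ.< N → coeff p k ≡ + 0
    go N p o (suc fuel) k f l = trans (sym (shift-add m₀ p k)) (trans step second)
      where
      k′ = addMon m₀ k
      xdeg-k′ : xdeg k′ ≡ xdeg m₀ ℕ.+ xdeg k
      xdeg-k′ = xdeg-add m₀ k
      a b : ℤ
      a = shift m₀ (coeff p) k′
      b = shift m₁ (coeff p) k′
      vanishes : + 1 *ℤ a +ℤ (-[1+ 0 ] *ℤ b +ℤ + 0) ≡ + 0
      vanishes = trans (sym (coeff-⊗ (binomial m₀ m₁) p k′))
        (o k′ (subst (ℕ._< N ℕ.+ xdeg m₀) (sym (trans xdeg-k′ (ℕₚ.+-comm (xdeg m₀) (xdeg k)))) (ℕₚ.+-monoˡ-< (xdeg m₀) l)))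
      step : a ≡ b
      step = trans (solve 2 (λ a b → a := con (+ 1) :* a :+ (con -[1+ 0 ] :* b :+ con (+ 0)) :+ b) refl a b)
        (trans (cong (_+ℤ b) vanishes) (ℤₚ.+-identityˡ b))
        where
        open import Data.Integer.Solver using (module +-*-Solver)
        open +-*-Solver
      second : b ≡ + 0
      second with leqMon m₁ k′ in eq
      ... | false = refl
      ... | true = go N p o fuel (subMon k′ m₁) smaller (ℕₚ.≤-<-trans lower l)
        where
        t′ : T (leqMon m₁ k′)
        t′ = subst T (sym eq) tt
        smaller : at (subMon k′ m₁) j ℕ.< fuel
        smaller = ℕₚ.≤-trans (ℕₚ.+-cancelˡ-< (at m₁ j) _ _ (subst (ℕ._< at m₁ j ℕ.+ at k j)
          (sym (trans (sym (at-addMon m₁ (subMon k′ m₁) j)) (trans (add-sub m₁ k′ t′ j) (at-addMon m₀ k j))))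
          (ℕₚ.+-monoˡ-< (at k j) lt))) (ℕₚ.≤-pred f)
        lower : xdeg (subMon k′ m₁) ℕ.≤ xdeg k
        lower = ℕₚ.+-cancelˡ-≤ (xdeg m₁) _ _ (subst (ℕ._≤ xdeg m₁ ℕ.+ xdeg k) (sym (trans (xdeg-sub m₁ k′ t′) xdeg-k′)) (ℕₚ.+-monoˡ-≤ (xdeg k) le))

  unit : ℕ → Mon
  unit i = replicate i 0 ++ 1 ∷ []

  at-unit : ∀ i → at (unit i) i ≡ 1
  at-unit zero = refl
  at-unit (suc i) = at-unit i

  at-unit-≢ : ∀ i j → i ≢ j → at (unit i) j ≡ 0
  at-unit-≢ zero zero ne = contradiction refl ne
  at-unit-≢ zero (suc j) ne = refl
  at-unit-≢ (suc i) zero ne = refl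
  at-unit-≢ (suc i) (suc j) ne = at-unit-≢ i j (ne ∘ cong suc)

  xdeg-unit : ∀ i → xdeg (unit (3 ℕ.+ i)) ≡ 1
  xdeg-unit i = go i
    where
    go : ∀ i → total (unit i) ≡ 1
    go zero = refl
    go (suc i) = go i

  Good-X : ∀ i → Good (X i) 1
  Good-X i = subst (Good (X i)) (xdeg-unit i) (Good-mono (unit (3 ℕ.+ i)))

  Good-X-X : ∀ i j → i ≢ j → Good (X i ⊖ X j) 1
  Good-X-X i j ne = subst (Good (X i ⊖ X j)) (xdeg-unit i) (Good-binomial (unit (3 ℕ.+ i)) (unit (3 ℕ.+ j)) (3 ℕ.+ j)
    (subst₂ ℕ._<_ (sym (at-unit-≢ i j ne)) (sym (at-unit j)) (s≤s z≤n))
    (ℕₚ.≤-reflexive (trans (xdeg-unit i) (sym (xdeg-unit j)))))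
    where open ≡ using (subst₂)

  Good-1-XX : ∀ i j → Good (one ⊖ X i ⊗ X j) 0
  Good-1-XX i j = Good-binomial [] (addMon (unit (3 ℕ.+ i)) (unit (3 ℕ.+ j))) (3 ℕ.+ i)
    (subst (0 ℕ.<_) (sym (trans (at-addMon (unit i) (unit j) i) (cong (ℕ._+ at (unit j) i) (at-unit i)))) (s≤s z≤n)) z≤n

  tpow : ℕ → Mon
  tpow zero = []
  tpow (suc k) = addMon (unit 2) (tpow k)

  pow-T : ∀ k → pow Defs.T k ≡ mono (tpow k)
  pow-T zero = refl
  pow-T (suc k) = cong (Defs.T ⊗_) (pow-T k)

  -- The variable t does not count in `xdeg`: both terms have degree 0, and the descent takes place
  -- in the exponent of t, coordinate 2.
  Good-1-T : ∀ k → Good (one ⊖ pow Defs.T (suc k)) 0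
  Good-1-T k = subst (λ p → Good (one ⊖ p) 0) (sym (pow-T (suc k)))
    (Good-binomial [] (tpow (suc k)) 2 (subst (0 ℕ.<_) (sym (at-addMon (unit 2) (tpow k) 2)) (s≤s z≤n)) z≤n)

  Ord-X : ∀ i → Ord 1 (X i)
  Ord-X i = Good.ord (Good-X i)

-- Localisation at a multiplicative set of nonzerodivisors.

module Localisation {c ℓ p} (R : CommutativeRing c ℓ) (S : CommutativeRing.Carrier R → Set p)
  (S-1 : S (CommutativeRing.1# R))
  (S-* : ∀ {s r} → S s → S r → S (CommutativeRing._*_ R s r))
  (S-nonzerodivisor : ∀ {s} → S s → ∀ a → CommutativeRing._≈_ R (CommutativeRing._*_ R s a) (CommutativeRing.0# R) →
    CommutativeRing._≈_ R a (CommutativeRing.0# R)) where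

  open CommutativeRing R
  open RingSolver R using (solve; _:+_; _:*_; _:-_; :-_; _:=_; con)
  open import Relation.Binary.Reasoning.Setoid setoid

  record Fraction : Set (c ⊔ p) where
    constructor _/_⟨_⟩
    field
      num den : Carrier
      inS : S den
  open Fraction public

  S-cancel : ∀ {s} → S s → ∀ {a b} → s * a ≈ s * b → a ≈ b
  S-cancel {s} σ {a} {b} e = begin
    a ≈⟨ solve 2 (λ a b → a := (a :- b) :+ b) refl a b ⟩
    (a - b) + b ≈⟨ +-congʳ (S-nonzerodivisor σ (a - b) (trans (solve 3 (λ s a b → s :* (a :- b) := s :* a :- s :* b) refl s a b)
      (trans (+-congʳ e) (-‿inverseʳ _)))) ⟩
    0# + b ≈⟨ +-identityˡ b ⟩
    b ∎

  infix 4 _≃_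
  -- Cross-multiplication alone is transitive, because denominators can be cancelled.
  _≃_ : Fraction → Fraction → Set ℓ
  u ≃ v = num u * den v ≈ num v * den u

  private
    ≃-trans : ∀ {u v w} → u ≃ v → v ≃ w → u ≃ w
    ≃-trans {a / r ⟨ _ ⟩} {b / s ⟨ σ ⟩} {c / t ⟨ _ ⟩} e f = S-cancel σ (begin
      s * (a * t) ≈⟨ solve 3 (λ s a t → s :* (a :* t) := a :* s :* t) refl s a t ⟩
      a * s * t ≈⟨ *-congʳ e ⟩
      b * r * t ≈⟨ solve 3 (λ b r t → b :* r :* t := r :* (b :* t)) refl b r t ⟩
      r * (b * t) ≈⟨ *-congˡ f ⟩
      r * (c * s) ≈⟨ solve 3 (λ r c s → r :* (c :* s) := s :* (c :* r)) refl r c s ⟩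
      s * (c * r) ∎)

    _⊞_ _⊠_ : Fraction → Fraction → Fraction
    (a / s ⟨ σ ⟩) ⊞ (b / r ⟨ ρ ⟩) = (a * r + b * s) / (s * r) ⟨ S-* σ ρ ⟩
    (a / s ⟨ σ ⟩) ⊠ (b / r ⟨ ρ ⟩) = (a * b) / (s * r) ⟨ S-* σ ρ ⟩

    ⊟_ : Fraction → Fraction
    ⊟ (a / s ⟨ σ ⟩) = (- a) / s ⟨ σ ⟩

  ι : Carrier → Fraction
  ι a = a / 1# ⟨ S-1 ⟩

  localisation : CommutativeRing (c ⊔ p) ℓ
  localisation = record
    { Carrier = Fraction ; _≈_ = _≃_ ; _+_ = _⊞_ ; _*_ = _⊠_ ; -_ = ⊟_ ; 0# = ι 0# ; 1# = ι 1#
    ; isCommutativeRing = record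
      { isRing = record
        { +-isAbelianGroup = record
          { isGroup = record
            { isMonoid = record
              { isSemigroup = record
                { isMagma = record
                  { isEquivalence = record { refl = refl ; sym = sym ; trans = λ {u} {v} {w} → ≃-trans {u} {v} {w} }
                  ; ∙-cong = λ {u} {u′} {v} {v′} e f → begin
                      (num u * den v + num v * den u) * (den u′ * den v′)
                        ≈⟨ solve 6 (λ a s s′ b r r′ → (a :* r :+ b :* s) :* (s′ :* r′) := (a :* s′) :* (r :* r′) :+ (b :* r′) :* (s :* s′))
                             refl (num u) (den u) (den u′) (num v) (den v) (den v′) ⟩
                      (num u * den u′) * (den v * den v′) + (num v * den v′) * (den u * den u′)
                        ≈⟨ +-cong (*-congʳ e) (*-congʳ f) ⟩
                      (num u′ * den u) * (den v * den v′) + (num v′ * den v) * (den u * den u′)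
                        ≈⟨ solve 6 (λ a s s′ b r r′ → (a :* s) :* (r :* r′) :+ (b :* r) :* (s :* s′) := (a :* r′ :+ b :* s′) :* (s :* r))
                             refl (num u′) (den u) (den u′) (num v′) (den v) (den v′) ⟩
                      (num u′ * den v′ + num v′ * den u′) * (den u * den v) ∎ }
                ; assoc = λ u v w → solve 6 (λ a s b r c t →
                    ((a :* r :+ b :* s) :* t :+ c :* (s :* r)) :* (s :* (r :* t)) := (a :* (r :* t) :+ (b :* t :+ c :* r) :* s) :* (s :* r :* t))
                    refl (num u) (den u) (num v) (den v) (num w) (den w) }
              ; identity = (λ u → solve 2 (λ a s → (con (+ 0) :* s :+ a :* con (+ 1)) :* s := a :* (con (+ 1) :* s)) refl (num u) (den u))
                         , (λ u → solve 2 (λ a s → (a :* con (+ 1) :+ con (+ 0) :* s) :* s := a :* (s :* con (+ 1))) refl (num u) (den u)) }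
            ; inverse = (λ u → solve 2 (λ a s → ((:- a) :* s :+ a :* s) :* con (+ 1) := con (+ 0) :* (s :* s)) refl (num u) (den u))
                      , (λ u → solve 2 (λ a s → (a :* s :+ (:- a) :* s) :* con (+ 1) := con (+ 0) :* (s :* s)) refl (num u) (den u))
            ; ⁻¹-cong = λ {u} {v} e → trans (solve 2 (λ a s → (:- a) :* s := :- (a :* s)) refl (num u) (den v))
                (trans (-‿cong e) (solve 2 (λ a s → :- (a :* s) := (:- a) :* s) refl (num v) (den u))) }
          ; comm = λ u v → solve 4 (λ a s b r → (a :* r :+ b :* s) :* (r :* s) := (b :* s :+ a :* r) :* (s :* r)) refl (num u) (den u) (num v) (den v) }
        ; *-cong = λ {u} {u′} {v} {v′} e f → begin
            num u * num v * (den u′ * den v′)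
              ≈⟨ solve 4 (λ a b s r → a :* b :* (s :* r) := (a :* s) :* (b :* r)) refl (num u) (num v) (den u′) (den v′) ⟩
            (num u * den u′) * (num v * den v′)
              ≈⟨ *-cong e f ⟩
            (num u′ * den u) * (num v′ * den v)
              ≈⟨ solve 4 (λ a b s r → (a :* s) :* (b :* r) := a :* b :* (s :* r)) refl (num u′) (num v′) (den u) (den v) ⟩
            num u′ * num v′ * (den u * den v) ∎
        ; *-assoc = λ u v w → solve 6 (λ a s b r c t → a :* b :* c :* (s :* (r :* t)) := a :* (b :* c) :* (s :* r :* t))
            refl (num u) (den u) (num v) (den v) (num w) (den w)
        ; *-identity = (λ u → solve 2 (λ a s → con (+ 1) :* a :* s := a :* (con (+ 1) :* s)) refl (num u) (den u))
                     , (λ u → solve 2 (λ a s → a :* con (+ 1) :* s := a :* (s :* con (+ 1))) refl (num u) (den u))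
        ; distrib = (λ u v w → solve 6 (λ a s b r c t →
                      a :* (b :* t :+ c :* r) :* (s :* r :* (s :* t)) := (a :* b :* (s :* t) :+ a :* c :* (s :* r)) :* (s :* (r :* t)))
                      refl (num u) (den u) (num v) (den v) (num w) (den w))
                  , (λ u v w → solve 6 (λ a s b r c t →
                      (b :* t :+ c :* r) :* a :* (r :* s :* (t :* s)) := (b :* a :* (t :* s) :+ c :* a :* (r :* s)) :* (r :* t :* s))
                      refl (num u) (den u) (num v) (den v) (num w) (den w)) }
      ; *-comm = λ u v → solve 4 (λ a s b r → a :* b :* (r :* s) := b :* a :* (s :* r)) refl (num u) (den u) (num v) (den v) } }

  module K = CommutativeRing localisation

  ι-cong : ∀ {a b} → a ≈ b → ι a K.≈ ι b
  ι-cong = *-congʳ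

  ι-+ : ∀ a b → ι (a + b) K.≈ ι a K.+ ι b
  ι-+ = solve 2 (λ a b → (a :+ b) :* (con (+ 1) :* con (+ 1)) := (a :* con (+ 1) :+ b :* con (+ 1)) :* con (+ 1)) refl

  ι-* : ∀ a b → ι (a * b) K.≈ ι a K.* ι b
  ι-* = solve 2 (λ a b → (a :* b) :* (con (+ 1) :* con (+ 1)) := (a :* b) :* con (+ 1)) refl

  ι-neg : ∀ a → ι (- a) K.≈ K.- ι a
  ι-neg a = refl

  1/_⟨_⟩ : ∀ s → S s → Fraction
  1/ s ⟨ σ ⟩ = 1# / s ⟨ σ ⟩

  ι-inverse : ∀ s (σ : S s) → ι s K.* 1/ s ⟨ σ ⟩ K.≈ K.1#
  ι-inverse s σ = solve 1 (λ s → s :* con (+ 1) :* con (+ 1) := con (+ 1) :* (con (+ 1) :* s)) refl s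

-- Ring homomorphisms from the polynomials to a generic point.

module PolyHoms where

  open import Defs using (Poly; _≈ₚ_; _⊕_; _⊗_; neg; one; T; X)

  -- Isolates what the comparison with the formal definitions uses of the map into the localisation,
  -- so that no fraction is unfolded there.
  record PolyHom {c ℓ} (K : CommutativeRing c ℓ) (V : GenericPoint K) : Set (c ⊔ ℓ) where
    open CommutativeRing K
    open GenericPoint V
    field
      ι : Poly → Carrier
      ι-cong : ∀ {p q} → p ≈ₚ q → ι p ≈ ι q
      ι-⊕ : ∀ p q → ι (p ⊕ q) ≈ ι p + ι q
      ι-⊗ : ∀ p q → ι (p ⊗ q) ≈ ι p * ι q
      ι-neg : ∀ p → ι (neg p) ≈ - ι p
      ι-[] : ι [] ≈ 0#
      ι-one : ι one ≈ 1#
      ι-T : ι T ≈ t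
      ι-X : ∀ i → ι (X i) ≈ x i

open PolyHoms using (PolyHom)

-- Images of the formal definitions in the abstract setting.

module Translation {c ℓ} (K : CommutativeRing c ℓ) (V : GenericPoint K) (hom : PolyHom K V) where

  open import Defs hiding (T; X; A; B; _≈ₚ_)
  open Partitions using (part; counts; counts-part; part-Part; Part-maxPart; mult-large; part-length)
  open GenericPoint V
  open PolyHom hom
  open SumsAndProducts K
  private
    a = ι Defs.A
    b = ι Defs.B
  open ShuffleIdentities K V using (gauss)
  open MasterIdentity K V a b using (H)
  open HallLittlewood K V a b
  open Symmetrization K V a b
  open import Relation.Binary.Reasoning.Setoid setoid

  ι-⊖ : ∀ p q → ι (p ⊖ q) ≈ ι p - ι q
  ι-⊖ p q = trans (ι-⊕ p (neg q)) (+-congˡ (ι-neg q))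

  ι-pow : ∀ p n → ι (pow p n) ≈ ι p ^ n
  ι-pow p zero = ι-one
  ι-pow p (suc n) = trans (ι-⊗ p (pow p n)) (*-congˡ (ι-pow p n))

  ι-prodP : ∀ {i} {I : Set i} (f : I → Poly) is → ι (prodP (map f is)) ≈ ∏ (ι ∘ f) is
  ι-prodP f [] = ι-one
  ι-prodP f (i ∷ is) = trans (ι-⊗ (f i) _) (*-congˡ (ι-prodP f is))

  ι-sumP : ∀ {i} {I : Set i} (f : I → Poly) is → ι (sumP (map f is)) ≈ ∑ (ι ∘ f) is
  ι-sumP f [] = ι-[]
  ι-sumP f (i ∷ is) = trans (ι-⊕ (f i) _) (+-congˡ (ι-sumP f is))

  -- Reconciles `maxPart` with the length of the multiplicity list, which may be larger: parts of
  -- multiplicity zero contribute the factor 1.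
  ∏-upTo-≤ : ∀ (φ : ℕ → Carrier) {N M} → N ℕ.≤ M → (∀ i → N ℕ.≤ i → φ i ≈ 1#) → ∏ φ (upTo N) ≈ ∏ φ (upTo M)
  ∏-upTo-≤ φ {N} {M} l e = go (M ∸ N) (ℕₚ.m+[n∸m]≡n l)
    where
    go : ∀ k {M} → N ℕ.+ k ≡ M → ∏ φ (upTo N) ≈ ∏ φ (upTo M)
    go zero ≡.refl = reflexive (≡.cong (∏ φ ∘ upTo) (≡.sym (ℕₚ.+-identityʳ N)))
    go (suc k) ≡.refl = trans (go k ≡.refl) (trans (sym (*-identityʳ _)) (trans (*-congˡ (sym (e (N ℕ.+ k) (ℕₚ.m≤m+n N k))))
      (trans (sym (∏-upTo-∷ʳ φ (N ℕ.+ k))) (reflexive (≡.cong (∏ φ ∘ upTo) (≡.sym (ℕₚ.+-suc N k)))))))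

  gbin-large : ∀ m k → m ℕ.< k → ι (gbin m k) ≈ 0#
  gbin-large zero (suc k) _ = ι-[]
  gbin-large (suc m) (suc k) (s≤s l) = begin
    ι (gbin m k ⊕ pow Defs.T (suc k) ⊗ gbin m (suc k))
      ≈⟨ trans (ι-⊕ (gbin m k) _) (+-cong (gbin-large m k l) (trans (ι-⊗ (pow Defs.T (suc k)) (gbin m (suc k)))
           (trans (*-congˡ (gbin-large m (suc k) (ℕₚ.m≤n⇒m≤1+n l))) (zeroʳ _)))) ⟩
    0# + 0# ≈⟨ +-identityˡ _ ⟩
    0# ∎

  -- Both sides follow the same Pascal rule. The part with unshifted weights is completed by the
  -- term k = m + 1, whose t-binomial is zero.
  ι-gbin : ∀ m (w : ℕ → Carrier) → ∑ (λ k → w k * ι (gbin m k)) (upTo (suc m)) ≈ gauss w m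
  ι-gbin zero w = trans (+-identityʳ _) (trans (*-congˡ ι-one) (*-identityʳ _))
  ι-gbin (suc m) w = begin
    ∑ (λ k → w k * G (suc m) k) (upTo (suc (suc m)))
      ≈⟨ ∑-upTo-suc (λ k → w k * G (suc m) k) (suc m) ⟩
    w 0 * G (suc m) 0 + ∑ (λ k → w (suc k) * G (suc m) (suc k)) (upTo (suc m))
      ≈⟨ +-congˡ (trans (∑-cong∈ (upTo (suc m)) (λ {k} _ → pascal k)) (∑-+ _ _ (upTo (suc m)))) ⟩
    w 0 * G (suc m) 0 + (∑ (λ k → w (suc k) * G m k) (upTo (suc m)) + ∑ (λ k → (t ^ suc k * w (suc k)) * G m (suc k)) (upTo (suc m)))
      ≈⟨ solve 3 (λ a b c → a :+ (b :+ c) := b :+ (a :+ c)) refl _ _ _ ⟩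
    ∑ (λ k → w (suc k) * G m k) (upTo (suc m)) + (w 0 * G (suc m) 0 + ∑ (λ k → (t ^ suc k * w (suc k)) * G m (suc k)) (upTo (suc m)))
      ≈⟨ +-cong (ι-gbin m (w ∘ suc)) (trans (+-congʳ (trans (sym (*-identityˡ _)) (sym (*-assoc _ _ _))))
           (trans (sym (∑-upTo-suc (λ k → (t ^ k * w k) * G m k) (suc m))) top)) ⟩
    gauss (w ∘ suc) m + gauss (λ k → t ^ k * w k) m ∎
    where
    G : ℕ → ℕ → Carrier
    G m k = ι (gbin m k)
    pascal : ∀ k → w (suc k) * G (suc m) (suc k) ≈ w (suc k) * G m k + (t ^ suc k * w (suc k)) * G m (suc k)
    pascal k = trans (*-congˡ (trans (ι-⊕ (gbin m k) _) (+-congˡ (trans (ι-⊗ (pow Defs.T (suc k)) (gbin m (suc k))) (*-congʳ (trans (ι-pow Defs.T (suc k)) (^-cong (suc k) ι-T)))))))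
      (solve 4 (λ w g t h → w :* (g :+ t :* h) := w :* g :+ (t :* w) :* h) refl _ _ _ _)
    top : ∑ (λ k → (t ^ k * w k) * G m k) (upTo (suc (suc m))) ≈ gauss (λ k → t ^ k * w k) m
    top = trans (reflexive (≡.cong (∑ (λ k → (t ^ k * w k) * G m k)) (≡.sym (upTo-∷ʳ (suc m)))))
      (trans (∑-++ (λ k → (t ^ k * w k) * G m k) (upTo (suc m)) (suc m ∷ []))
        (trans (+-cong (ι-gbin m (λ k → t ^ k * w k)) (trans (+-identityʳ _) (trans (*-congˡ (gbin-large m (suc m) ℕₚ.≤-refl)) (zeroʳ _)))) (+-identityʳ _)))

  ι-rogers : ∀ m z → ι (rogers m z) ≈ gauss (λ k → ι z ^ k) m
  ι-rogers m z = trans (ι-sumP (λ k → pow z k ⊗ gbin m k) (upTo (suc m))) (trans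
    (∑-cong∈ (upTo (suc m)) (λ {k} _ → trans (ι-⊗ (pow z k) (gbin m k)) (*-congʳ (ι-pow z k))))
    (ι-gbin m (λ k → ι z ^ k)))

  ι-rogersHom : ∀ m → ι (rogersHom m) ≈ gauss (λ k → a ^ (m ∸ k) * b ^ k) m
  ι-rogersHom m = trans (ι-sumP (λ k → pow Defs.A (m ∸ k) ⊗ pow Defs.B k ⊗ gbin m k) (upTo (suc m))) (trans
    (∑-cong∈ (upTo (suc m)) (λ {k} _ → trans (ι-⊗ (pow Defs.A (m ∸ k) ⊗ pow Defs.B k) (gbin m k))
      (*-congʳ (trans (ι-⊗ (pow Defs.A (m ∸ k)) (pow Defs.B k)) (*-cong (ι-pow Defs.A (m ∸ k)) (ι-pow Defs.B k))))))
    (ι-gbin m (λ k → a ^ (m ∸ k) * b ^ k)))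

  factor : List ℕ → ℕ → Poly
  factor la i = if evenb i then rogers (mult i la) (Defs.A ⊗ Defs.B) else rogersHom (mult i la)

  ι-factor : ∀ la i → ι (factor la i) ≈ H i (mult i la)
  ι-factor la i with evenb i
  ... | true = trans (ι-rogers (mult i la) (Defs.A ⊗ Defs.B)) (gauss-cong (mult i la) (λ k _ → ^-cong k (ι-⊗ Defs.A Defs.B)))
  ... | false = ι-rogersHom (mult i la)

  H-0 : ∀ i → H i 0 ≈ 1#
  H-0 i with evenb i
  ... | true = refl
  ... | false = *-identityˡ _

  weight-counts : ∀ M la → ∏ (λ i → H (suc i) (mult (suc i) la)) (upTo M) ≈ weight (counts M la)
  weight-counts zero la = refl
  weight-counts (suc M) la = trans (∏-upTo-∷ʳ _ M) (trans (*-comm _ _)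
    (*-cong (reflexive (≡.cong (λ r → H (suc r) (mult (suc M) la)) (≡.sym (Partitions.counts-length M la)))) (weight-counts M la)))

  ι-coefLHS : ∀ ms → ι (coefLHS (part ms)) ≈ weight ms
  ι-coefLHS ms = begin
    ι (coefLHS la)
      ≈⟨ unfold _ (λ _ → ≡.refl) ⟩
    ∏ (λ i → H (suc i) (mult (suc i) la)) (upTo (maxPart la))
      ≈⟨ ∏-upTo-≤ _ (Part-maxPart la (part-Part ms)) (λ i l → trans (reflexive (≡.cong (H (suc i)) (mult-large la (s≤s l)))) (H-0 (suc i))) ⟩
    ∏ (λ i → H (suc i) (mult (suc i) la)) (upTo (length ms))
      ≈⟨ weight-counts (length ms) la ⟩
    weight (counts (length ms) la)
      ≈⟨ reflexive (≡.cong weight (counts-part ms)) ⟩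
    weight ms ∎
    where
    la = part ms
    -- The local function inside `coefLHS` has no name outside it, so `f` stands for it.
    unfold : ∀ (f : ℕ → Poly) → (∀ i → f i ≡ factor la i) →
      ι (prodP (map f (map suc (upTo (maxPart la))))) ≈ ∏ (λ i → H (suc i) (mult (suc i) la)) (upTo (maxPart la))
    unfold f e = trans (ι-prodP f (map suc (upTo (maxPart la)))) (trans (reflexive (∏-map (ι ∘ f) suc (upTo (maxPart la))))
      (∏-cong (upTo (maxPart la)) (λ i → trans (reflexive (≡.cong ι (e (suc i)))) (ι-factor la (suc i)))))

  ι-qPoch : ∀ k → ι (qPoch k) ≈ poch k
  ι-qPoch k = trans (ι-prodP (λ j → one ⊖ pow Defs.T (suc j)) (upTo k)) (∏-cong (upTo k) (λ j →
    trans (ι-⊖ one (pow Defs.T (suc j))) (+-cong ι-one (-‿cong (trans (ι-pow Defs.T (suc j)) (^-cong (suc j) ι-T))))))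

  pochs-counts : ∀ M n la → poch (n ∸ sum (counts M la)) * ∏ (λ i → poch (mult (suc i) la)) (upTo M) ≈ pochs n (counts M la)
  pochs-counts zero n la = *-identityʳ _
  pochs-counts (suc M) n la = begin
    poch (n ∸ (mult (suc M) la ℕ.+ sum (counts M la))) * ∏ (λ i → poch (mult (suc i) la)) (upTo (suc M))
      ≈⟨ *-cong (reflexive (≡.cong poch (≡.sym (ℕₚ.∸-+-assoc n (mult (suc M) la) (sum (counts M la)))))) (∏-upTo-∷ʳ _ M) ⟩
    poch (n ∸ mult (suc M) la ∸ sum (counts M la)) * (∏ (λ i → poch (mult (suc i) la)) (upTo M) * poch (mult (suc M) la))
      ≈⟨ solve 3 (λ a b c → a :* (b :* c) := c :* (a :* b)) refl _ _ _ ⟩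
    poch (mult (suc M) la) * (poch (n ∸ mult (suc M) la ∸ sum (counts M la)) * ∏ (λ i → poch (mult (suc i) la)) (upTo M))
      ≈⟨ *-congˡ (pochs-counts M (n ∸ mult (suc M) la) la) ⟩
    pochs n (counts (suc M) la) ∎

  ι-vfact : ∀ n ms → ι (vfact n (part ms)) ≈ pochs n ms
  ι-vfact n ms = begin
    ι (qPoch (n ∸ length la) ⊗ prodP (map (λ i → qPoch (mult (suc i) la)) (upTo (maxPart la))))
      ≈⟨ trans (ι-⊗ (qPoch (n ∸ length la)) _) (*-cong (ι-qPoch (n ∸ length la)) (trans (ι-prodP (λ i → qPoch (mult (suc i) la)) (upTo (maxPart la)))
           (∏-cong (upTo (maxPart la)) (λ i → ι-qPoch (mult (suc i) la))))) ⟩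
    poch (n ∸ length la) * ∏ (λ i → poch (mult (suc i) la)) (upTo (maxPart la))
      ≈⟨ *-cong (reflexive (≡.cong (λ k → poch (n ∸ k)) (≡.trans (part-length ms) (≡.cong sum (≡.sym (counts-part ms))))))
           (∏-upTo-≤ _ (Part-maxPart la (part-Part ms)) (λ i l → reflexive (≡.cong poch (mult-large la (s≤s l))))) ⟩
    poch (n ∸ sum (counts (length ms) la)) * ∏ (λ i → poch (mult (suc i) la)) (upTo (length ms))
      ≈⟨ pochs-counts (length ms) n la ⟩
    pochs n (counts (length ms) la)
      ≈⟨ reflexive (≡.cong (pochs n) (counts-part ms)) ⟩
    pochs n ms ∎
    where
    la = part ms

  pairProd : (ℕ → ℕ → Carrier) → ℕ → Carrier
  pairProd c n = ∏ (λ j → ∏ (λ i → c i j) (upTo j)) (upTo n)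

  ι-pairs : ∀ (f : ℕ × ℕ → Poly) (c : ℕ → ℕ → Carrier) n → (∀ i j → i ℕ.< j → ι (f (i , j)) ≈ c i j) →
    ι (prodP (map f (pairs n))) ≈ pairProd c n
  ι-pairs f c n e = trans (ι-prodP f (pairs n)) (trans (∏-concatMap (ι ∘ f) (λ j → map (λ i → (i , j)) (upTo j)) (upTo n))
    (∏-cong (upTo n) (λ j → trans (reflexive (∏-map (ι ∘ f) (λ i → (i , j)) (upTo j)))
      (∏-cong∈ (upTo j) (λ {i} m → e i j (∈-upTo⁻ m))))))

  -- The enumeration of pairs grows with the largest index, while a permutation is consumed from its
  -- first entry; hence the pairs containing index 0 are split off.
  pairProd-suc : ∀ c n → pairProd c (suc n) ≈ ∏ (λ j → c 0 (suc j)) (upTo n) * pairProd (λ i j → c (suc i) (suc j)) n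
  pairProd-suc c n = trans (∏-upTo-suc _ n) (trans (*-identityˡ _)
    (trans (∏-cong (upTo n) (λ j → ∏-upTo-suc (λ i → c i (suc j)) j)) (∏-* _ _ (upTo n))))

  ∏-at : ∀ (φ : ℕ → Carrier) w → ∏ (λ j → φ (at w j)) (upTo (length w)) ≈ ∏ φ w
  ∏-at φ [] = refl
  ∏-at φ (y ∷ w) = trans (∏-upTo-suc _ (length w)) (*-congˡ (∏-at φ w))

  ∏-upTo-downFrom : ∀ (φ : ℕ → Carrier) n → ∏ φ (upTo n) ≈ ∏ φ (downFrom n)
  ∏-upTo-downFrom φ zero = refl
  ∏-upTo-downFrom φ (suc n) = trans (∏-upTo-∷ʳ φ n) (trans (*-comm _ _) (*-congˡ (∏-upTo-downFrom φ n)))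

  pairProd-tvdm : ∀ w → pairProd (λ i j → x (at w i) - t * x (at w j)) (length w) ≈ tvdm w
  pairProd-tvdm [] = refl
  pairProd-tvdm (y ∷ w) = trans (pairProd-suc (λ i j → x (at (y ∷ w) i) - t * x (at (y ∷ w) j)) (length w)) (*-cong (∏-at (λ j → x y - t * x j) w) (pairProd-tvdm w))

  ∏-monomial : ∀ es w → length es ≡ length w → ∏ (λ i → x (at w i) ^ at es i) (upTo (length w)) ≈ monomial es w
  ∏-monomial [] [] _ = refl
  ∏-monomial (e ∷ es) (y ∷ w) l = trans (∏-upTo-suc _ (length w)) (*-congˡ (∏-monomial es w (ℕₚ.suc-injective l)))

  ι-vandermonde : ∀ n → ι (vandermonde n) ≈ Δ (downFrom n)
  ι-vandermonde n = trans (ι-pairs _ (λ i j → x i - x j) n (λ i j _ → trans (ι-⊖ (Defs.X i) (Defs.X j)) (+-cong (ι-X i) (-‿cong (ι-X j))))) (go n)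
    where
    go : ∀ n → pairProd (λ i j → x i - x j) n ≈ Δ (downFrom n)
    go zero = refl
    go (suc n) = trans (∏-upTo-∷ʳ _ n) (trans (*-comm _ _) (*-cong (∏-upTo-downFrom (λ i → x i - x n) n) (go n)))

  ι-sign : ∀ w → ι (cst (sign w)) ≈ sgn (inversions w)
  ι-sign w = go (inversions w)
    where
    ι-minus : ι (cst -[1+ 0 ]) ≈ - 1#
    ι-minus = trans (ι-neg one) (-‿cong ι-one)
    go : ∀ n → ι (cst (if evenb n then + 1 else -[1+ 0 ])) ≈ sgn n
    go zero = ι-one
    go (suc zero) = ι-minus
    go (suc (suc n)) = trans (go n) (solve 1 (λ a → a := :- (:- a)) refl (sgn n))

  perms-insertions : ∀ n → perms n ≡ insertions (downFrom n)
  perms-insertions zero = ≡.refl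
  perms-insertions (suc n) = ≡.cong (concatMap (insertAll n)) (perms-insertions n)

  at-pad : ∀ la k i → at (la ++ replicate k 0) i ≡ at la i
  at-pad [] zero i = ≡.refl
  at-pad [] (suc k) zero = ≡.refl
  at-pad [] (suc k) (suc i) = at-pad [] k i
  at-pad (e ∷ la) k zero = ≡.refl
  at-pad (e ∷ la) k (suc i) = at-pad la k i

  -- `monomial` requires as many exponents as entries of w, so λ is padded explicitly; `at` supplies
  -- the same zeros by default.
  ι-symTerm : ∀ la k w → length (la ++ replicate k 0) ≡ length w →
    ι (symTerm (length w) la w) ≈ sgn (inversions w) * (monomial (la ++ replicate k 0) w * tvdm w)
  ι-symTerm la k w l = trans (ι-⊗ (cst (sign w) ⊗ M) Q) (trans (*-cong (trans (ι-⊗ (cst (sign w)) M) (*-cong (ι-sign w) ι-M)) ι-Q) (*-assoc _ _ _))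
    where
    n = length w
    M = prodP (map (λ i → pow (Defs.X (at w i)) (at la i)) (upTo n))
    ι-M : ι M ≈ monomial (la ++ replicate k 0) w
    ι-M = trans (ι-prodP (λ i → pow (Defs.X (at w i)) (at la i)) (upTo n)) (trans
      (∏-cong (upTo n) (λ i → trans (ι-pow (Defs.X (at w i)) (at la i)) (trans (^-cong (at la i) (ι-X (at w i)))
        (reflexive (≡.cong (x (at w i) ^_) (≡.sym (at-pad la k i)))))))
      (∏-monomial (la ++ replicate k 0) w l))
    Q = prodP (map (λ { (i , j) → Defs.X (at w i) ⊖ Defs.T ⊗ Defs.X (at w j) }) (pairs n))
    ι-Q : ι Q ≈ tvdm w
    ι-Q = trans (ι-pairs _ (λ i j → x (at w i) - t * x (at w j)) n (λ i j _ →
      trans (ι-⊖ (Defs.X (at w i)) (Defs.T ⊗ Defs.X (at w j))) (+-cong (ι-X (at w i)) (-‿cong (trans (ι-⊗ Defs.T (Defs.X (at w j))) (*-cong ι-T (ι-X (at w j))))))))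
      (pairProd-tvdm w)

-- Comparison of both sides modulo terms of high order.

module Truncation {c ℓ p} (K : CommutativeRing c ℓ) (V : GenericPoint K) (hom : PolyHom K V)
  (Fil : Filtration K V (PolyHom.ι hom Defs.A) (PolyHom.ι hom Defs.B) p)
  (1-t^-invertible : ∀ k → Interpolation.Invertible K (CommutativeRing._-_ K (CommutativeRing.1# K) (SumsAndProducts._^_ K (GenericPoint.t V) (suc k)))) where

  open import Data.List.Relation.Unary.Unique.Propositional.Properties using (downFrom⁺)
  open import Function using (Equivalence)
  open import Data.Bool.Properties using (T-≡)
  open import Defs hiding (T; X; A; B; _≈ₚ_)
  open Partitions
  open GenericPoint V
  open PolyHom hom
  open SumsAndProducts K
  open Interpolation K
  private
    a = ι Defs.A
    b = ι Defs.B
  open Littlewood K V using (Ψ; ρ; ρ-sym)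
  open MasterIdentity K V a b
  open HallLittlewood K V a b
  open Symmetrization K V a b
  open Filtrations K V a b hiding (Filtration)
  open Translation K V hom
  open Filtration Fil
  open import Relation.Binary.Reasoning.Setoid setoid

  poch-invertible : ∀ n → Invertible (poch n)
  poch-invertible n = Invertible-∏ _ (All.universal 1-t^-invertible (upTo n))

  pochs-invertible : ∀ n ms → Invertible (pochs n ms)
  pochs-invertible n [] = poch-invertible n
  pochs-invertible n (m ∷ ms) = Invertible-* (poch-invertible m) (pochs-invertible (n ∸ m) ms)

  downFrom-Decr : ∀ n → Decr (downFrom n)
  downFrom-Decr zero = []
  downFrom-Decr (suc n) = below n ℕₚ.≤-refl ∷ downFrom-Decr n
    where
    below : ∀ {N} k → k ℕ.≤ N → All (ℕ._< N) (downFrom k)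
    below zero l = []
    below (suc k) l = l ∷ below k (ℕₚ.≤-trans (ℕₚ.n≤1+n k) l)

  Δ-invertible : ∀ ns → Decr ns → Invertible (Δ ns)
  Δ-invertible [] _ = 1# , *-identityˡ _
  Δ-invertible (n ∷ ns) (p ∷ d) = Invertible-*
    (Invertible-∏ _ (All.map (λ lt → 1/[ _ - _ ] , ∸-inverse (ℕₚ.<⇒≢ lt)) p)) (Δ-invertible ns d)

  -- The factor ∏ (t;t)_{m_i} · a_δ in front of P is invertible in `K`, so the defining identity
  -- determines `ι P`; its other side is evaluated by `Δ-R` and `HL-R`.
  IsHL⇒HL : ∀ n ms P → sum ms ℕ.≤ n → IsHL n (part ms) P → ι P ≈ HL ms (downFrom n)
  IsHL⇒HL n ms P l isHL = *-cancelˡ (Invertible-* (pochs-invertible n ms) (Δ-invertible ns (downFrom-Decr n))) (begin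
    (pochs n ms * Δ ns) * ι P
      ≈⟨ *-congʳ (sym (*-cong (ι-vfact n ms) (ι-vandermonde n))) ⟩
    (ι (vfact n la) * ι (vandermonde n)) * ι P
      ≈⟨ sym (trans (ι-⊗ (vfact n la ⊗ vandermonde n) P) (*-congʳ (ι-⊗ (vfact n la) (vandermonde n)))) ⟩
    ι (vfact n la ⊗ vandermonde n ⊗ P)
      ≈⟨ ι-cong isHL ⟩
    ι (pow (one ⊖ Defs.T) n ⊗ sumP (map (symTerm n la) (perms n)))
      ≈⟨ trans (ι-⊗ (pow (one ⊖ Defs.T) n) _) (*-cong
           (trans (ι-pow (one ⊖ Defs.T) n) (^-cong n (trans (ι-⊖ one Defs.T) (+-cong ι-one (-‿cong ι-T)))))
           (trans (ι-sumP (symTerm n la) (perms n)) symmetrized)) ⟩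
    (1# - t) ^ n * (Δ ns * R es ns)
      ≈⟨ solve 3 (λ a b c → a :* (b :* c) := b :* (a :* c)) refl _ _ _ ⟩
    Δ ns * ((1# - t) ^ n * R es ns)
      ≈⟨ *-congˡ (≡.subst (λ k → (1# - t) ^ k * R (la ++ replicate (k ∸ sum ms) 0) ns ≈ pochs k ms * HL ms ns) (length-downFrom n)
           (sym (HL-R ms ns (downFrom⁺ n) (≡.subst (sum ms ℕ.≤_) (≡.sym (length-downFrom n)) l)))) ⟩
    Δ ns * (pochs n ms * HL ms ns)
      ≈⟨ solve 3 (λ a b c → a :* (b :* c) := (b :* a) :* c) refl _ _ _ ⟩
    (pochs n ms * Δ ns) * HL ms ns ∎)
    where
    ns = downFrom n
    la = part ms
    es = la ++ replicate (n ∸ sum ms) 0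
    |es| : length es ≡ n
    |es| = ≡.trans (length-++ la) (≡.trans (≡.cong₂ ℕ._+_ (part-length ms) (length-replicate (n ∸ sum ms))) (ℕₚ.m+[n∸m]≡n l))
    symmetrized : ∑ (ι ∘ symTerm n la) (perms n) ≈ Δ ns * R es ns
    symmetrized = trans (reflexive (≡.cong (∑ (ι ∘ symTerm n la)) (perms-insertions n)))
      (trans (∑-cong∈ (insertions ns) (λ {w} m → let |w| = ≡.trans (↭-length (insertions-↭ ns m)) (length-downFrom n) in
        trans (reflexive (≡.cong (λ k → ι (symTerm k la w)) (≡.sym |w|)))
          (ι-symTerm la (n ∸ sum ms) w (≡.trans |es| (≡.sym |w|)))))
        (Δ-R es ns (downFrom-Decr n)))

  infix 4 _∼[_]_
  _∼[_]_ : Carrier → ℕ → Carrier → Set p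
  u ∼[ N ] v = Ord N (u - v)

  ≈⇒∼ : ∀ {N u v} → u ≈ v → u ∼[ N ] v
  ≈⇒∼ e = Ord-resp (sym (trans (+-congʳ e) (-‿inverseʳ _))) Ord-0

  ∼-trans : ∀ {N u v w} → u ∼[ N ] v → v ∼[ N ] w → u ∼[ N ] w
  ∼-trans p q = Ord-resp (solve 3 (λ u v w → (u :- v) :+ (v :- w) := u :- w) refl _ _ _) (Ord-+ p q)

  ∼-sym : ∀ {N u v} → u ∼[ N ] v → v ∼[ N ] u
  ∼-sym p = Ord-resp (solve 2 (λ u v → :- (u :- v) := v :- u) refl _ _) (Ord-neg p)

  ∼-* : ∀ {N u u′ v v′} → Ord 0 u → Ord 0 v′ → u ∼[ N ] u′ → v ∼[ N ] v′ → u * v ∼[ N ] u′ * v′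
  ∼-* ou ov p q = Ord-resp (solve 4 (λ u u′ v v′ → u :* (v :- v′) :+ (u :- u′) :* v′ := u :* v :- u′ :* v′) refl _ _ _ _)
    (Ord-+ (Ord-* ou q) (Ord-*ˡ Fil p ov))

  ∼-∏ : ∀ {N} {i} {I : Set i} (φ ψ : I → Carrier) is → (∀ {i} → i ∈ is → Ord 0 (φ i) × Ord 0 (ψ i) × φ i ∼[ N ] ψ i) →
    Ord 0 (∏ φ is) × Ord 0 (∏ ψ is) × ∏ φ is ∼[ N ] ∏ ψ is
  ∼-∏ φ ψ [] e = Ord-1 , Ord-1 , ≈⇒∼ refl
  ∼-∏ φ ψ (i ∷ is) e with e (here ≡.refl) | ∼-∏ φ ψ is (e ∘ there)
  ... | oφ , oψ , q | oφs , oψs , qs = Ord₀-* Fil oφ oφs , Ord₀-* Fil oψ oψs , ∼-* oφ oψs q qs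

  geomSum : ℕ → Carrier → Carrier
  geomSum d y = ∑ (y ^_) (upTo (suc d))

  ι-geom : ∀ d y → ι (geom d y) ≈ geomSum d (ι y)
  ι-geom d y = trans (ι-sumP (pow y) (upTo (suc d))) (∑-cong∈ (upTo (suc d)) (λ {k} _ → ι-pow y k))

  geomSum-telescopes : ∀ d y → (1# - y) * geomSum d y ≈ 1# - y ^ suc d
  geomSum-telescopes zero y = solve 1 (λ y → (con (+ 1) :- y) :* (con (+ 1) :+ con (+ 0)) := con (+ 1) :- y :* con (+ 1)) refl y
  geomSum-telescopes (suc d) y = begin
    (1# - y) * geomSum (suc d) y
      ≈⟨ *-congˡ (trans (∑-upTo-suc (y ^_) (suc d)) (+-congˡ (∑-*ˡ y (y ^_) (upTo (suc d))))) ⟩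
    (1# - y) * (1# + y * geomSum d y)
      ≈⟨ solve 2 (λ y s → (con (+ 1) :- y) :* (con (+ 1) :+ y :* s) := (con (+ 1) :- y) :+ y :* ((con (+ 1) :- y) :* s)) refl y _ ⟩
    (1# - y) + y * ((1# - y) * geomSum d y)
      ≈⟨ +-congˡ (*-congˡ (geomSum-telescopes d y)) ⟩
    (1# - y) + y * (1# - y ^ suc d)
      ≈⟨ solve 2 (λ y p → (con (+ 1) :- y) :+ y :* (con (+ 1) :- p) := con (+ 1) :- y :* p) refl y _ ⟩
    1# - y ^ suc (suc d) ∎

  Ord-geomSum : ∀ d {y} → Ord 0 y → Ord 0 (geomSum d y)
  Ord-geomSum d o = Ord-∑ Fil (upTo (suc d)) (λ k → Ord-^ Fil k o)

  -- The partial sum differs from 1/(1 - y) by y^(d+1)/(1 - y), and y has order at least 1.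
  geomSum-∼ : ∀ d {y e} → Ord 1 y → Ord 0 e → (1# - y) * e ≈ 1# → geomSum d y ∼[ suc d ] e
  geomSum-∼ d {y} {e} oy oe inv = Ord-resp (begin
    e * - (y ^ suc d)
      ≈⟨ solve 2 (λ e p → e :* (:- p) := e :* (con (+ 1) :- p) :- e) refl e _ ⟩
    e * (1# - y ^ suc d) - e
      ≈⟨ +-congʳ (*-congˡ (sym (geomSum-telescopes d y))) ⟩
    e * ((1# - y) * geomSum d y) - e
      ≈⟨ +-congʳ (trans (solve 3 (λ e y s → e :* (y :* s) := (y :* e) :* s) refl _ _ _) (trans (*-congʳ inv) (*-identityˡ _))) ⟩
    geomSum d y - e ∎) (Ord-* oe (Ord-neg (high (suc d))))
    where
    high : ∀ n → Ord n (y ^ n)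
    high zero = Ord-1
    high (suc n) = Ord-* oy (high n)

  oneVariable : ∀ d i → ι ((one ⊕ Defs.A ⊗ Defs.X i) ⊗ (one ⊕ Defs.B ⊗ Defs.X i) ⊗ geom d (Defs.X i) ⊗ geom d (neg (Defs.X i)))
    ≈ g i * geomSum d (x i) * geomSum d (- x i)
  oneVariable d i = trans (ι-⊗ ((one ⊕ Defs.A ⊗ Defs.X i) ⊗ (one ⊕ Defs.B ⊗ Defs.X i) ⊗ geom d (Defs.X i)) _) (*-cong
    (trans (ι-⊗ ((one ⊕ Defs.A ⊗ Defs.X i) ⊗ (one ⊕ Defs.B ⊗ Defs.X i)) _) (*-cong
      (trans (ι-⊗ (one ⊕ Defs.A ⊗ Defs.X i) (one ⊕ Defs.B ⊗ Defs.X i)) (*-cong (linear Defs.A) (linear Defs.B)))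
      (trans (ι-geom d (Defs.X i)) (geomSum-cong (ι-X i)))))
    (trans (ι-geom d (neg (Defs.X i))) (geomSum-cong (trans (ι-neg (Defs.X i)) (-‿cong (ι-X i))))))
    where
    linear : ∀ C → ι (one ⊕ C ⊗ Defs.X i) ≈ 1# + ι C * x i
    linear C = trans (ι-⊕ one (C ⊗ Defs.X i)) (+-cong ι-one (trans (ι-⊗ C (Defs.X i)) (*-congˡ (ι-X i))))
    geomSum-cong : ∀ {y z} → y ≈ z → geomSum d y ≈ geomSum d z
    geomSum-cong e = ∑-cong∈ (upTo (suc d)) (λ {k} _ → ^-cong k e)

  twoVariables : ∀ d i j → ι ((one ⊖ Defs.T ⊗ Defs.X i ⊗ Defs.X j) ⊗ geom d (Defs.X i ⊗ Defs.X j))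
    ≈ (1# - t * (x i * x j)) * geomSum d (x i * x j)
  twoVariables d i j = trans (ι-⊗ (one ⊖ Defs.T ⊗ Defs.X i ⊗ Defs.X j) _) (*-cong
    (trans (ι-⊖ one (Defs.T ⊗ Defs.X i ⊗ Defs.X j)) (+-cong ι-one (-‿cong (trans (ι-⊗ (Defs.T ⊗ Defs.X i) (Defs.X j))
      (trans (*-cong (trans (ι-⊗ Defs.T (Defs.X i)) (*-cong ι-T (ι-X i))) (ι-X j)) (*-assoc _ _ _))))))
    (trans (ι-geom d (Defs.X i ⊗ Defs.X j)) (∑-cong∈ (upTo (suc d)) (λ {k} _ → ^-cong k (trans (ι-⊗ (Defs.X i) (Defs.X j)) (*-cong (ι-X i) (ι-X j)))))))

  -- The two limits are written as (1 + x)/(1 - x²) and (1 - x)/(1 - x²), so that the inverse of 1 -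
  -- x² serves both series.
  oneVariable-∼ : ∀ d i → Ord 0 (g i * geomSum d (x i) * geomSum d (- x i)) × Ord 0 (γ i) × g i * geomSum d (x i) * geomSum d (- x i) ∼[ suc d ] γ i
  oneVariable-∼ d i = Ord₀-* Fil (Ord₀-* Fil og (Ord-geomSum d ox)) (Ord-geomSum d (Ord-neg ox)) , Ord₀-* Fil og oe ,
    ∼-trans (∼-* (Ord₀-* Fil og (Ord-geomSum d ox)) (Ord₀-* Fil (Ord-+ Ord-1 (Ord-neg ox)) oe)
        (∼-* og (Ord₀-* Fil (Ord-+ Ord-1 ox) oe) (≈⇒∼ refl) (geomSum-∼ d (Ord-x i) (Ord₀-* Fil (Ord-+ Ord-1 ox) oe) inv₁))
        (geomSum-∼ d (Ord-neg (Ord-x i)) (Ord₀-* Fil (Ord-+ Ord-1 (Ord-neg ox)) oe) inv₂))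
      (≈⇒∼ (begin
        g i * ((1# + x i) * e) * ((1# - x i) * e)
          ≈⟨ solve 3 (λ g x e → g :* ((con (+ 1) :+ x) :* e) :* ((con (+ 1) :- x) :* e) := g :* e :* ((con (+ 1) :- x :* x) :* e)) refl (g i) (x i) e ⟩
        g i * e * ((1# - x i * x i) * e)
          ≈⟨ trans (*-congˡ (1-*-inverse i i)) (*-identityʳ _) ⟩
        g i * e ∎))
    where
    e = 1/[1- i * i ]
    oe : Ord 0 e
    oe = Ord-1/[1-*] i i
    og : Ord 0 (g i)
    og = Ord-g Fil i
    ox : Ord 0 (x i)
    ox = Ord-x₀ Fil i
    inv₁ : (1# - x i) * ((1# + x i) * e) ≈ 1#
    inv₁ = trans (solve 2 (λ x e → (con (+ 1) :- x) :* ((con (+ 1) :+ x) :* e) := (con (+ 1) :- x :* x) :* e) refl (x i) e) (1-*-inverse i i)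
    inv₂ : (1# - - x i) * ((1# - x i) * e) ≈ 1#
    inv₂ = trans (solve 2 (λ x e → (con (+ 1) :- (:- x)) :* ((con (+ 1) :- x) :* e) := (con (+ 1) :- x :* x) :* e) refl (x i) e) (1-*-inverse i i)

  twoVariables-∼ : ∀ d i j → Ord 0 ((1# - t * (x i * x j)) * geomSum d (x i * x j)) × Ord 0 (ρ i j) ×
    (1# - t * (x i * x j)) * geomSum d (x i * x j) ∼[ suc d ] ρ i j
  twoVariables-∼ d i j = Ord₀-* Fil o (Ord-geomSum d oxx) , Ord₀-* Fil o oe ,
    ∼-* o oe (≈⇒∼ refl) (geomSum-∼ d (Ord-*ˡ Fil (Ord-x i) (Ord-x₀ Fil j)) oe (1-*-inverse i j))
    where
    oe : Ord 0 1/[1- i * j ]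
    oe = Ord-1/[1-*] i j
    oxx : Ord 0 (x i * x j)
    oxx = Ord₀-* Fil (Ord-x₀ Fil i) (Ord-x₀ Fil j)
    o : Ord 0 (1# - t * (x i * x j))
    o = Ord-+ Ord-1 (Ord-neg (Ord₀-* Fil Ord-t oxx))

  pairProd-Ψ : ∀ n → pairProd ρ n ≈ Ψ (downFrom n)
  pairProd-Ψ zero = refl
  pairProd-Ψ (suc n) = trans (∏-upTo-∷ʳ _ n) (trans (*-comm _ _)
    (*-cong (trans (∏-upTo-downFrom (λ i → ρ i n) n) (∏-cong (downFrom n) (λ i → ρ-sym i n))) (pairProd-Ψ n)))

  RHS-∼ : ∀ n d → ι (RHS n d) ∼[ suc d ] Φ (downFrom n)
  RHS-∼ n d = ∼-trans (≈⇒∼ (trans (ι-⊗ _ _) (*-cong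
      (trans (ι-prodP _ (upTo n)) (∏-cong (upTo n) (oneVariable d)))
      (ι-pairs _ (λ i j → (1# - t * (x i * x j)) * geomSum d (x i * x j)) n (λ i j _ → twoVariables d i j)))))
    (∼-trans (∼-* (proj₁ ones) (proj₁ (proj₂ twos)) (proj₂ (proj₂ ones)) (proj₂ (proj₂ twos)))
      (≈⇒∼ (*-cong (∏-upTo-downFrom γ n) (pairProd-Ψ n))))
    where
    ones = ∼-∏ (λ i → g i * geomSum d (x i) * geomSum d (- x i)) γ (upTo n) (λ {i} _ → oneVariable-∼ d i)
    twos = ∼-∏ (λ j → ∏ (λ i → (1# - t * (x i * x j)) * geomSum d (x i * x j)) (upTo j)) (λ j → ∏ (λ i → ρ i j) (upTo j)) (upTo n)
      (λ {j} _ → ∼-∏ (λ i → (1# - t * (x i * x j)) * geomSum d (x i * x j)) (λ i → ρ i j) (upTo j) (λ {i} _ → twoVariables-∼ d i j))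

  ∑-filterB-∼ : ∀ {N} {I : Set} (f : I → Carrier) (h : I → Bool) is → (∀ {i} → i ∈ is → h i ≡ false → Ord N (f i)) →
    ∑ f is ∼[ N ] ∑ f (filterB h is)
  ∑-filterB-∼ f h [] e = ≈⇒∼ refl
  ∑-filterB-∼ f h (i ∷ is) e with h i in eq
  ... | true = Ord-resp (solve 3 (λ a p q → p :- q := (a :+ p) :- (a :+ q)) refl (f i) _ _) (∑-filterB-∼ f h is (e ∘ there))
  ... | false = Ord-resp (sym (+-assoc _ _ _)) (Ord-+ (e (here ≡.refl) eq) (∑-filterB-∼ f h is (e ∘ there)))

  module _ (n d : ℕ) (P : List ℕ → Poly)
    (isHL : ∀ la → IsPartition la → length la ℕ.≤ n → IsHL n la (P la)) where

    private
      -- Parts up to 2(d + 1) are kept. Then `Ord-Φ-F` leaves an error of order at least d + 1, and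
      -- every partition of size at most d is included.
      k = suc d
      M = dbl k
      L = multiplicities M n
      f : List ℕ → Carrier
      f la = ι (coefLHS la ⊗ P la)

    dbl-≥ : ∀ m → m ℕ.≤ dbl m
    dbl-≥ zero = z≤n
    dbl-≥ (suc m) = s≤s (ℕₚ.≤-trans (dbl-≥ m) (ℕₚ.n≤1+n _))

    f-part : ∀ {ms} → ms ∈ L → f (part ms) ≈ weight ms * HL ms (downFrom n)
    f-part {ms} m = trans (ι-⊗ (coefLHS (part ms)) (P (part ms))) (*-cong (ι-coefLHS ms)
      (IsHL⇒HL n ms (P (part ms)) s (isHL (part ms) (Part-IsPartition (part ms) (part-Part ms)) (≡.subst (ℕ._≤ n) (≡.sym (part-length ms)) s))))
      where
      s : sum ms ℕ.≤ n
      s = multiplicities-sum M n m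

    ∑-f : ∑ f (map part L) ≈ F M (downFrom n)
    ∑-f = trans (reflexive (∑-map f part L)) (trans (∑-cong∈ L f-part)
      (sym (trans (F-HL M (downFrom n) (downFrom⁺ n)) (reflexive (≡.cong (λ k → ∑ (λ ms → weight ms * HL ms (downFrom n)) (multiplicities M k)) (length-downFrom n))))))

    -- P_λ has order at least the size of λ, so partitions of size above d are invisible at this
    -- precision.
    large : ∀ {la} → la ∈ map part L → (sum la ≤ᵇ d) ≡ false → Ord (suc d) (f la)
    large m e with ∈-map⁻ part m
    ... | ms , ms∈ , ≡.refl = Ord-resp (sym (f-part ms∈)) (Ord-≤ size≥ (Ord-* (Ord-weight Fil ms) (Ord-HL Fil ms (downFrom n))))
      where
      size≥ : suc d ℕ.≤ size ms
      size≥ = ≡.subst (suc d ℕ.≤_) (part-sum ms) (ℕₚ.≰⇒> (λ l → contradiction (≡.trans (≡.sym e) (Equivalence.to T-≡ (ℕₚ.≤⇒≤ᵇ l))) (λ ())))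

    LHS-∼ : ι (LHS n d P) ∼[ suc d ] F M (downFrom n)
    LHS-∼ = ∼-trans (≈⇒∼ (trans (ι-sumP (λ la → coefLHS la ⊗ P la) (partitions≤ n d))
        (∑-↭ f (partitions≤-↭ n d M (ℕₚ.≤-trans (ℕₚ.n≤1+n d) (dbl-≥ k))))))
      (∼-trans (∼-sym (∑-filterB-∼ f (λ la → sum la ≤ᵇ d) (map part L) large)) (≈⇒∼ ∑-f))

    LHS-RHS : ι (LHS n d P) ∼[ suc d ] ι (RHS n d)
    LHS-RHS = ∼-trans LHS-∼ (∼-trans (∼-sym (Ord-≤ (dbl-≥ k) (Ord-Φ-F Fil k (downFrom n) (downFrom⁺ n)))) (∼-sym (RHS-∼ n d)))

-- The localisation of the polynomial ring as a filtered ring with a generic point.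

module Fractions where

  open import Data.Nat.Solver using (module +-*-Solver)
  open import Relation.Binary.PropositionalEquality using (refl; sym; trans; cong; subst)
  open import Defs
  open Points using (GenericPoint)
  open PolyHoms using (PolyHom)
  open Filtrations using (Filtration)
  open PolynomialRing
  open Orders
  open +-*-Solver using (solve; _:+_; _:=_)

  private module P = CommutativeRing polyRing

  IsGood : Poly → Set
  IsGood s = ∃ (Good s)

  module L = Localisation polyRing IsGood (0 , Good-one)
    (λ {s} {r} σ ρ → proj₁ σ ℕ.+ proj₁ ρ , Good-⊗ {s} {r} (proj₂ σ) (proj₂ ρ))
    (λ {s} σ → Good-nonzerodivisor {s} (proj₂ σ))

  K : CommutativeRing _ _
  K = L.localisation

  module K = CommutativeRing K
  open L using (Fraction; num; den; inS; ι; 1/_⟨_⟩; ι-inverse)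

  edeg : Fraction → ℕ
  edeg u = proj₁ (inS u)

  den-Good : ∀ u → Good (den u) (edeg u)
  den-Good u = proj₂ (inS u)

  -- The function must be total but is constrained off the diagonal only; the value 0 there makes χ
  -- i i = 0, which has order 0 as `Ord-χ` demands.
  1/X-X : ℕ → ℕ → Fraction
  1/X-X i j with i ℕ.≟ j
  ... | yes _ = K.0#
  ... | no ne = 1/ X i ⊖ X j ⟨ 1 , Good-X-X i j ne ⟩

  good-1-XX : ∀ i j → IsGood (one ⊖ X i ⊗ X j)
  good-1-XX i j = 0 , Good-1-XX i j

  ι-⊖ : ∀ p q → ι (p ⊖ q) K.≈ ι p K.- ι q
  ι-⊖ p q = L.ι-+ p (neg q)

  V : GenericPoint K
  V = record
    { t = ι T
    ; x = λ i → ι (X i)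
    ; x⁻¹ = λ i → 1/ X i ⟨ 1 , Good-X i ⟩
    ; 1/[_-_] = 1/X-X
    ; 1/[1-_*_] = λ i j → 1/ one ⊖ X i ⊗ X j ⟨ good-1-XX i j ⟩
    ; x-inverse = λ i → ι-inverse (X i) (1 , Good-X i)
    ; ∸-inverse = λ {i} {j} → ∸-inverse i j
    ; 1-*-inverse = λ i j → K.trans
        {(K.1# K.- ι (X i) K.* ι (X j)) K.* 1/ one ⊖ X i ⊗ X j ⟨ good-1-XX i j ⟩}
        {ι (one ⊖ X i ⊗ X j) K.* 1/ one ⊖ X i ⊗ X j ⟨ good-1-XX i j ⟩} {K.1#}
        (K.*-congʳ {1/ one ⊖ X i ⊗ X j ⟨ good-1-XX i j ⟩} {K.1# K.- ι (X i) K.* ι (X j)} {ι (one ⊖ X i ⊗ X j)}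
          (K.sym {ι (one ⊖ X i ⊗ X j)} {K.1# K.- ι (X i) K.* ι (X j)} (expand i j)))
        (ι-inverse (one ⊖ X i ⊗ X j) (good-1-XX i j))
    }
    where
    ∸-inverse : ∀ i j → i ≢ j → (ι (X i) K.- ι (X j)) K.* 1/X-X i j K.≈ K.1#
    ∸-inverse i j ne with i ℕ.≟ j
    ... | yes e = contradiction e ne
    ... | no ne′ = K.trans {(ι (X i) K.- ι (X j)) K.* r} {ι (X i ⊖ X j) K.* r} {K.1#}
      (K.*-congʳ {r} {ι (X i) K.- ι (X j)} {ι (X i ⊖ X j)} (K.sym {ι (X i ⊖ X j)} {ι (X i) K.- ι (X j)} (ι-⊖ (X i) (X j))))
      (ι-inverse (X i ⊖ X j) (1 , Good-X-X i j ne′))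
      where r = 1/ X i ⊖ X j ⟨ 1 , Good-X-X i j ne′ ⟩
    expand : ∀ i j → ι (one ⊖ X i ⊗ X j) K.≈ K.1# K.- ι (X i) K.* ι (X j)
    expand i j = K.trans {ι (one ⊖ X i ⊗ X j)} {K.1# K.- ι (X i ⊗ X j)} {K.1# K.- ι (X i) K.* ι (X j)} (ι-⊖ one (X i ⊗ X j))
      (K.+-congˡ {K.1#} {K.- ι (X i ⊗ X j)} {K.- (ι (X i) K.* ι (X j))}
        (K.-‿cong {ι (X i ⊗ X j)} {ι (X i) K.* ι (X j)} (L.ι-* (X i) (X j))))

  hom : PolyHom K V
  hom = record
    { ι = ι
    ; ι-cong = λ {p} {q} e → L.ι-cong {p} {q} e
    ; ι-⊕ = L.ι-+
    ; ι-⊗ = L.ι-*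
    ; ι-neg = L.ι-neg
    ; ι-[] = K.refl {K.0#}
    ; ι-one = K.refl {K.1#}
    ; ι-T = K.refl {ι T}
    ; ι-X = λ i → K.refl {ι (X i)}
    }

  -- The order of a fraction is that of its numerator minus the degree of its denominator; the
  -- degree is read off the proof that the denominator is `Good`.
  OrdK : ℕ → Fraction → Set
  OrdK N u = Ord (N ℕ.+ edeg u) (num u)

  -- Here `Good.cancel` is essential: equality of fractions only bounds the order of
  -- `den u ⊗ num v`, and `den u` has to be divided out.
  OrdK-resp : ∀ {N} u v → u K.≈ v → OrdK N u → OrdK N v
  OrdK-resp {N} u v e o = Good.cancel (den-Good u) (N ℕ.+ edeg v) (num v)
    (subst (λ n → Ord n (den u ⊗ num v)) (solve 3 (λ n a b → (n :+ a) :+ b := (n :+ b) :+ a) refl N (edeg u) (edeg v))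
      (Ord-resp {p = num u ⊗ den v} {den u ⊗ num v}
        (P.trans {num u ⊗ den v} {num v ⊗ den u} {den u ⊗ num v} e (P.*-comm (num v) (den u)))
        (Ord-⊗ (num u) (den v) o (Good.ord (den-Good v)))))

  OrdK-+ : ∀ {N} u v → OrdK N u → OrdK N v → OrdK N (u K.+ v)
  OrdK-+ {N} u v o o′ = Ord-⊕ (num u ⊗ den v) (num v ⊗ den u)
    (subst (λ n → Ord n (num u ⊗ den v)) (ℕₚ.+-assoc N (edeg u) (edeg v)) (Ord-⊗ (num u) (den v) o (Good.ord (den-Good v))))
    (subst (λ n → Ord n (num v ⊗ den u)) (solve 3 (λ n a b → (n :+ b) :+ a := n :+ (a :+ b)) refl N (edeg u) (edeg v))
      (Ord-⊗ (num v) (den u) o′ (Good.ord (den-Good u))))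

  OrdK-* : ∀ {M N} u v → OrdK M u → OrdK N v → OrdK (M ℕ.+ N) (u K.* v)
  OrdK-* {M} {N} u v o o′ = subst (λ n → Ord n (num u ⊗ num v))
    (solve 4 (λ m n a b → (m :+ a) :+ (n :+ b) := (m :+ n) :+ (a :+ b)) refl M N (edeg u) (edeg v))
    (Ord-⊗ (num u) (num v) o o′)

  OrdK-ι : ∀ {N} p → Ord N p → OrdK N (ι p)
  OrdK-ι {N} p o = subst (λ n → Ord n p) (sym (ℕₚ.+-identityʳ N)) o

  OrdK-neg : ∀ {N} u → OrdK N u → OrdK N (K.- u)
  OrdK-neg u o = Ord-neg (num u) o

  Fil : Filtration K V (ι A) (ι B) _
  Fil = record
    { Ord = OrdK
    ; Ord-resp = λ {N} {u} {v} → OrdK-resp u v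
    ; Ord-≤ = λ {M} {N} {u} l → Ord-≤ {p = num u} (ℕₚ.+-monoˡ-≤ (edeg u) l)
    ; Ord-0 = λ _ _ → refl
    ; Ord-1 = Ord₀ one
    ; Ord-+ = λ {N} {u} {v} → OrdK-+ u v
    ; Ord-neg = λ {N} {u} → OrdK-neg u
    ; Ord-* = λ {M} {N} {u} {v} → OrdK-* u v
    ; Ord-a = Ord₀ A
    ; Ord-b = Ord₀ B
    ; Ord-t = Ord₀ T
    ; Ord-x = λ i → OrdK-ι (X i) (Ord-X i)
    ; Ord-χ = Ord-χ
    ; Ord-1/[1-*] = λ i j → Ord₀ one
    }
    where
    Ord-χ : ∀ i j → OrdK 0 ((ι (X i) K.- ι T K.* ι (X j)) K.* 1/X-X i j)
    Ord-χ i j with i ℕ.≟ j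
    ... | yes _ = OrdK-* (ι (X i) K.- ι T K.* ι (X j)) K.0# (Ord₀ (num (ι (X i) K.- ι T K.* ι (X j)))) (λ _ _ → refl)
    -- The numerator X i - T X j has order 1, which offsets the degree 1 of the denominator.
    ... | no ne = Ord-⊗ (num (ι (X i) K.- ι T K.* ι (X j))) one
      (OrdK-+ {1} (ι (X i)) (K.- (ι T K.* ι (X j))) (OrdK-ι (X i) (Ord-X i))
        (OrdK-neg (ι T K.* ι (X j)) (OrdK-* {0} {1} (ι T) (ι (X j)) (Ord₀ T) (OrdK-ι (X j) (Ord-X j))))) (Ord₀ one)

  1-t^-invertible : ∀ k → Interpolation.Invertible K (K.1# K.- SumsAndProducts._^_ K (ι T) (suc k))
  1-t^-invertible k = 1/ s ⟨ 0 , Good-1-T k ⟩ , K.trans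
    {(K.1# K.- SumsAndProducts._^_ K (ι T) (suc k)) K.* r} {ι s K.* r} {K.1#}
    (K.*-congʳ {r} {K.1# K.- SumsAndProducts._^_ K (ι T) (suc k)} {ι s}
      (K.sym {ι s} {K.1# K.- SumsAndProducts._^_ K (ι T) (suc k)} (K.trans {ι s} {K.1# K.- ι (pow T (suc k))} {K.1# K.- SumsAndProducts._^_ K (ι T) (suc k)}
        (ι-⊖ one (pow T (suc k))) (K.+-congˡ {K.1#} {K.- ι (pow T (suc k))} {K.- SumsAndProducts._^_ K (ι T) (suc k)}
          (K.-‿cong {ι (pow T (suc k))} {SumsAndProducts._^_ K (ι T) (suc k)} (ι-pow (suc k)))))))
    (ι-inverse s (0 , Good-1-T k))
    where
    s = one ⊖ pow T (suc k)
    r = 1/ s ⟨ 0 , Good-1-T k ⟩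
    ι-pow : ∀ n → ι (pow T n) K.≈ SumsAndProducts._^_ K (ι T) n
    ι-pow zero = K.refl {K.1#}
    ι-pow (suc n) = K.trans {ι (T ⊗ pow T n)} {ι T K.* ι (pow T n)} {ι T K.* SumsAndProducts._^_ K (ι T) n} (L.ι-* T (pow T n))
      (K.*-congˡ {ι T} {ι (pow T n)} {SumsAndProducts._^_ K (ι T) n} (ι-pow n))

  -- A polynomial has denominator 1 of degree 0, so its order as a fraction is its order as a
  -- polynomial and the congruence becomes equality of coefficients.
  ∼⇒≡ : ∀ {d} p q → OrdK (suc d) (ι p K.- ι q) → ∀ m → xdeg m ℕ.≤ d → coeff p m ≡ coeff q m
  ∼⇒≡ {d} p q o m l = ℤₚ.i-j≡0⇒i≡j (coeff p m) (coeff q m) (trans (cong (λ z → coeff p m ℤ.+ z) (sym (coeff-neg q m)))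
    (trans (sym (coeff-++ p (neg q) m)) (OrdK-resp {suc d} (ι p K.- ι q) (ι (p ⊖ q)) (K.sym {ι (p ⊖ q)} {ι p K.- ι q} (ι-⊖ p q)) o m
      (subst (xdeg m ℕ.<_) (sym (ℕₚ.+-identityʳ (suc d))) (s≤s l)))))

open import Defs
open import Data.Nat using (_≤_)

theorem1p1 : (n d : ℕ) (P : List ℕ → Poly)
    → (∀ (la : List ℕ) → IsPartition la → length la ≤ n → IsHL n la (P la))
    → ∀ (m : Mon) → xdeg m ≤ d → coeff (LHS n d P) m ≡ coeff (RHS n d) m
theorem1p1 n d P isHL m deg = Fractions.∼⇒≡ (LHS n d P) (RHS n d) (Truncation.LHS-RHS Fractions.K Fractions.V Fractions.hom Fractions.Fil Fractions.1-t^-invertible n d P isHL) m deg
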